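{- For odd $n\ge 3$, the graph $\mathcal{H}_n$ has minimum degree $2$, and there are exactly $n\cdot (C_{(n-3)/2})^2$ vertices of degree $2$, namely the matchings that contain one edge of length $\mu$ passing through the circle center and two edges of length $\mu-1$. For even $n\ge 2$, the graph $\mathcal{H}_n$ has minimum degree $1$, and there are exactly $n\cdot (C_{(n-2)/2})^2$ vertices of degree $1$, namely the matchings that contain exactly two edges of length $\mu$.
   Context: Fix an integer $n\ge 2$ and place $2n$ points equidistantly on the unit circle. $\mathcal{M}_n$ is the set of all non-crossing straight-line perfect matchings on these $2n$ points (each has $n$ edges). For $M\in\mathcal{M}_n$, two edges $e,f\in M$ span an empty quadrilateral if the convex hull of $e$ and $f$ contains no other edge of $M$; replacing $e,f$ by the other two edges of this quadrilateral yields another matching of $\mathcal{M}_n$ (a flip). A flip is centered if the closed quadrilateral contains the center of the circle (possibly on its boundary). $\mathcal{H}_n$ is the graph with vertex set $\mathcal{M}_n$ and an edge between two matchings if they differ by a centered flip. For $e\in M$, the length $\ell(e)$ is the minimum, over the two sides of the line through $e$, of the number of other edges of $M$ lying on that side. $\mu:=\lceil (n-2)/2\rceil$ is the maximum possible edge length. $C_k=\frac{1}{k+1}\binom{2k}{k}$ is the $k$th Catalan number. -}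

module Defs where

open import Data.Nat using (ℕ; zero; suc; _+_; _*_; _∸_; _≤_; _<_; _≡ᵇ_; ⌈_/2⌉; _/_; _⊓_; _⊔_)
open import Data.Nat.Combinatorics using (_C_)
open import Data.Fin using (Fin; toℕ)
open import Data.Vec using (Vec; lookup)
open import Data.List using (List; length; filter)
open import Data.List.Relation.Unary.Unique.Propositional using (Unique)
open import Data.List.Membership.Propositional using (_∈_)
open import Data.List using (allFin)
open import Data.Product using (Σ; _×_; ∃; ∃-syntax; _,_)
open import Data.Sum using (_⊎_)
open import Relation.Nullary using (¬_; Dec; yes; no)
open import Relation.Nullary.Decidable using (_×-dec_; _⊎-dec_; ¬?)
open import Relation.Binary.PropositionalEquality using (_≡_; _≢_)
open import Function.Bundles using (_⇔_)
import Data.Nat.Properties as ℕₚ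

HasCard : {A : Set} → (A → Set) → ℕ → Set
HasCard {A} P k = Σ (List A) λ L → Unique L × length L ≡ k × (∀ x → (x ∈ L) ⇔ P x)

Catalan : ℕ → ℕ
Catalan k = ((2 * k) C k) / suc k

μ : ℕ → ℕ
μ n = ⌈ n ∸ 2 /2⌉

module _ (n : ℕ) where

  -- The 2n points on the circle are labelled 0,1,…,2n-1 (type Fin (2 * n))
  -- in counter-clockwise order; point i sits at angle i·π/n.
  -- A (candidate) matching is represented by its partner vector:
  -- M ⟨ i ⟩ is the point matched to i.  This representation is canonical,
  -- so equal matchings are equal vectors.

  Pt : Set
  Pt = Fin (2 * n)

  PM : Set
  PM = Vec (Pt) (2 * n)

  _⟨_⟩ : PM → Pt → Pt
  M ⟨ i ⟩ = lookup M i

  -- x lies strictly between a and b (in label order), i.e. on the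
  -- open arc from a to b that does not pass from label 2n-1 to label 0.
  Sep : Pt → Pt → Pt → Set
  Sep x a b = (toℕ a ⊓ toℕ b < toℕ x) × (toℕ x < toℕ a ⊔ toℕ b)

  -- Two chords ab and cd with four distinct endpoints cross (as straight
  -- segments inside the circle) iff exactly one of c, d lies strictly
  -- between a and b.
  Cross : Pt → Pt → Pt → Pt → Set
  Cross a b c d = (Sep c a b × ¬ Sep d a b) ⊎ (¬ Sep c a b × Sep d a b)

  IsPerfectMatching : PM → Set
  IsPerfectMatching M = ∀ i → (M ⟨ M ⟨ i ⟩ ⟩ ≡ i) × (M ⟨ i ⟩ ≢ i)

  NonCrossing : PM → Set
  NonCrossing M = ∀ i j → j ≢ i → j ≢ M ⟨ i ⟩ → ¬ Cross i (M ⟨ i ⟩) j (M ⟨ j ⟩)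

  IsNCM : PM → Set
  IsNCM M = IsPerfectMatching M × NonCrossing M

  -- Flips.  Let a < b < c < d be four points.  Their convex hull is the
  -- quadrilateral with sides ab, bc, cd, da.  Two non-crossing edges
  -- e, f of M with endpoint set {a,b,c,d} are either the opposite sides
  -- {ab, cd} or the opposite sides {bc, da}.

  NotCorner : Pt → Pt → Pt → Pt → Pt → Set
  NotCorner x a b c d = (x ≢ a) × (x ≢ b) × (x ≢ c) × (x ≢ d)

  Increasing : Pt → Pt → Pt → Pt → Set
  Increasing a b c d = (toℕ a < toℕ b) × (toℕ b < toℕ c) × (toℕ c < toℕ d)

  -- The quadrilateral abcd is empty in M: no other edge {x, M⟨x⟩} of M
  -- meets it.  Since the other edge has its endpoints on the circle away
  -- from the corners, it meets the quadrilateral iff it crosses a side.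
  EmptyQuad : PM → Pt → Pt → Pt → Pt → Set
  EmptyQuad M a b c d =
    ∀ x → NotCorner x a b c d →
      ¬ Cross a b x (M ⟨ x ⟩) × ¬ Cross b c x (M ⟨ x ⟩) ×
      ¬ Cross c d x (M ⟨ x ⟩) × ¬ Cross d a x (M ⟨ x ⟩)

  -- The closed quadrilateral abcd (a<b<c<d) contains the circle center iff
  -- the four points are not contained in an open half circle, i.e. every
  -- cyclic gap between consecutive corners is at most n steps (= π).
  Centered : Pt → Pt → Pt → Pt → Set
  Centered a b c d =
    (toℕ b ∸ toℕ a ≤ n) × (toℕ c ∸ toℕ b ≤ n) × (toℕ d ∸ toℕ c ≤ n) ×
    ((2 * n ∸ toℕ d) + toℕ a ≤ n)

  SwapABCD : PM → PM → Pt → Pt → Pt → Pt → Set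
  SwapABCD M M' a b c d =
    (M ⟨ a ⟩ ≡ b) × (M ⟨ c ⟩ ≡ d) ×
    (M' ⟨ b ⟩ ≡ c) × (M' ⟨ c ⟩ ≡ b) × (M' ⟨ d ⟩ ≡ a) × (M' ⟨ a ⟩ ≡ d)

  SwapDABC : PM → PM → Pt → Pt → Pt → Pt → Set
  SwapDABC M M' a b c d =
    (M ⟨ b ⟩ ≡ c) × (M ⟨ d ⟩ ≡ a) ×
    (M' ⟨ a ⟩ ≡ b) × (M' ⟨ b ⟩ ≡ a) × (M' ⟨ c ⟩ ≡ d) × (M' ⟨ d ⟩ ≡ c)

  CenteredFlip : PM → PM → Set
  CenteredFlip M M' =
    ∃[ a ] ∃[ b ] ∃[ c ] ∃[ d ]
      Increasing a b c d ×
      (SwapABCD M M' a b c d ⊎ SwapDABC M M' a b c d) ×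
      (∀ x → NotCorner x a b c d → M' ⟨ x ⟩ ≡ M ⟨ x ⟩) ×
      EmptyQuad M a b c d ×
      Centered a b c d

  Adj : PM → PM → Set
  Adj M M' = IsNCM M' × (CenteredFlip M M' ⊎ CenteredFlip M' M)

  Deg : PM → ℕ → Set
  Deg M k = HasCard (Adj M) k

  MinDegree : ℕ → Set
  MinDegree δ =
    (∀ M k → IsNCM M → Deg M k → δ ≤ k) × (∃[ M ] IsNCM M × Deg M δ)

  -- Edge lengths.  An edge of M is represented by its smaller endpoint i
  -- (toℕ i < toℕ (M⟨i⟩)).  For an edge e = {i, j}, the two open sides of
  -- the line through e contain the points strictly between i and j, resp.
  -- the points not in the closed interval [i, j].

  Side : Set₁
  Side = Pt → Set

  inside : Pt → Pt → Side
  inside i j x = Sep x i j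

  outside : Pt → Pt → Side
  outside i j x = (x ≢ i) × (x ≢ j) × ¬ Sep x i j

  private
    sepDec : ∀ (x a b : Pt) → Dec (Sep x a b)
    sepDec x a b = (_ ℕₚ.<? _) ×-dec (_ ℕₚ.<? _)

    neqDec : ∀ (x y : Pt) → Dec (x ≢ y)
    neqDec x y = ¬? (x Data.Fin.≟ y)

    insideDec : ∀ (i j x : Pt) → Dec (inside i j x)
    insideDec i j x = sepDec x i j

    outsideDec : ∀ (i j x : Pt) → Dec (outside i j x)
    outsideDec i j x = neqDec x i ×-dec (neqDec x j ×-dec ¬? (sepDec x i j))

  edgesInside : PM → Pt → Pt → ℕ
  edgesInside M i j =
    length (filter (λ y → (toℕ y ℕₚ.<? toℕ (M ⟨ y ⟩)) ×-dec
                          (insideDec i j y ×-dec insideDec i j (M ⟨ y ⟩)))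
                   (allFin _))

  edgesOutside : PM → Pt → Pt → ℕ
  edgesOutside M i j =
    length (filter (λ y → (toℕ y ℕₚ.<? toℕ (M ⟨ y ⟩)) ×-dec
                          (outsideDec i j y ×-dec outsideDec i j (M ⟨ y ⟩)))
                   (allFin _))

  len : PM → Pt → ℕ
  len M i = edgesInside M i (M ⟨ i ⟩) ⊓ edgesOutside M i (M ⟨ i ⟩)

  IsEdgeRep : PM → Pt → Set
  IsEdgeRep M i = toℕ i < toℕ (M ⟨ i ⟩)

  numEdgesOfLength : PM → ℕ → ℕ
  numEdgesOfLength M L =
    length (filter (λ y → (toℕ y ℕₚ.<? toℕ (M ⟨ y ⟩)) ×-dec (len M y ℕₚ.≟ L))
                   (allFin _))

  ThroughCenter : PM → Pt → Set
  ThroughCenter M i = toℕ (M ⟨ i ⟩) ≡ toℕ i + n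

  OddShape : PM → Set
  OddShape M =
    (∃[ i ] IsEdgeRep M i × ThroughCenter M i × len M i ≡ μ n) ×
    (∃[ j ] ∃[ k ] (j ≢ k) × IsEdgeRep M j × IsEdgeRep M k ×
       len M j ≡ μ n ∸ 1 × len M k ≡ μ n ∸ 1)

  EvenShape : PM → Set
  EvenShape M = numEdgesOfLength M (μ n) ≡ 2

{-# OPTIONS --safe #-}
module Submission where

-- Two edges span an empty quadrilateral iff they bound a common face of the matching, and the
-- flip is centred if some diameter of the circle meets both edges.  Rotate the points so that the
-- centre lies in the outer face, whose boundary edges cut the points into blocks.  If no edge is a diameter, every diameter {x , x + n} yields a centred flip of the two
-- blocks that contain its ends.  For even n a third block gives a second flip, so degree 1 forces
-- two blocks with n points each.  For odd n all blocks have even size, so the block J opposite to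
-- the origin is the partner of both blocks next to the origin, and the diameter through the point
-- before J gives a third flip that avoids J.  If an edge is a diameter, it can be flipped exactly
-- with the edges of the two faces next to it, so degree 2 forces one further edge in each of them.
-- The two remaining parts are arbitrary matchings; these correspond to binary trees, which are
-- counted by the ballot numbers.

open import Defs
open import Data.Empty using (⊥; ⊥-elim)
open import Data.Nat using (ℕ; zero; suc; _+_; _*_; _∸_; _^_; _≤_; _<_; z≤n; s≤s; _<?_; _≤?_; _/_; _%_)
open import Data.Nat.Properties
open import Data.Product using (Σ; ∃; ∃-syntax; _×_; _,_; proj₁; proj₂)
open import Data.Sum as Sum using (_⊎_; inj₁; inj₂; [_,_]′)
open import Data.Vec as Vec using (Vec; []; _∷_)
open import Function using (_∘_; id)
open import Function.Bundles using (_⇔_; mk⇔; Equivalence)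
open import Relation.Binary.Definitions using (Tri; tri<; tri≈; tri>)
open import Relation.Binary.PropositionalEquality using (_≡_; _≢_; refl; sym; trans; cong; cong₂; subst; subst₂; module ≡-Reasoning)
open import Relation.Nullary using (¬_; Dec; yes; no)

-- Labels cut the circle between `2n - 1` and `0`, and this obstacle shapes the proof: statements
-- that are symmetric on the circle split into cases on a line. Rotation by one step repairs this
-- once and for all; the remaining geometry is done in a position where the cut is convenient, and
-- is left to a decision procedure for linear inequalities. Everything rests on one dichotomy: a
-- matching either has more than `δ` neighbours, shown by an explicit list, or is a rotation of a
-- matching in standard position, for which all flips can be listed and there are exactly `δ`. The
-- minimum degree, the extremal matchings and their number all follow from it. The factor `n` in the
-- count is half of the `2n` rotations: a half turn preserves the standard position, and no smaller
-- rotation does. The Catalan index is what remains of one side, divided by two: a block of `n`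
-- points minus the two ends of its edge for even `n`, the `n - 1` points beside the diameter minus
-- two for odd `n`.

-- Linear arithmetic over the natural numbers by Fourier-Motzkin elimination

module LinearArithmetic where

  open import Data.Bool using (Bool; true; false; _∧_; T)
  open import Data.Bool.Properties using (T-∧)
  open import Data.Bool.ListAction using (any)
  open import Data.List using (List; []; _∷_; _++_; concatMap)
  open import Data.List.Relation.Unary.All as All using (All; []; _∷_)
  import Data.List.Relation.Unary.All.Properties as All
  open import Data.Nat using (_<ᵇ_; _≤ᵇ_)
  open import Data.Nat.Tactic.RingSolver using (solve-∀)
  open import Data.Unit using (tt)
  open import Relation.Nullary.Decidable using (_×-dec_; _⊎-dec_; _→-dec_; decidable-stable)

  infixl 6 _:+_
  infixr 6.5 1+_
  infixl 7 _:*_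
  infix  4 _:≤_ _:<_ _:≡_
  infixr 3 _:∧_
  infixr 2 _:∨_
  infixr 1 _:⇒_

  data Exp : Set where
    var  : ℕ → Exp
    con  : ℕ → Exp
    _:+_ : Exp → Exp → Exp
    _:*_ : ℕ → Exp → Exp

  data Form : Set where
    _:≤_ _:≡_      : Exp → Exp → Form
    _:∧_ _:∨_ _:⇒_ : Form → Form → Form
    :⊥             : Form

  1+_ : Exp → Exp
  1+ a = con 1 :+ a

  _:<_ : Exp → Exp → Form
  a :< b = 1+ a :≤ b

  :¬_ : Form → Form
  :¬ F = F :⇒ :⊥

  at : List ℕ → ℕ → ℕ
  at []      _       = 0
  at (x ∷ _) zero    = x
  at (_ ∷ ρ) (suc i) = at ρ i

  ⟦_⟧ₑ : Exp → List ℕ → ℕ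
  ⟦ var i ⟧ₑ  ρ = at ρ i
  ⟦ con c ⟧ₑ  ρ = c
  ⟦ a :+ b ⟧ₑ ρ = ⟦ a ⟧ₑ ρ + ⟦ b ⟧ₑ ρ
  ⟦ c :* a ⟧ₑ ρ = c * ⟦ a ⟧ₑ ρ

  ⟦_⟧ : Form → List ℕ → Set
  ⟦ a :≤ b ⟧ ρ = ⟦ a ⟧ₑ ρ ≤ ⟦ b ⟧ₑ ρ
  ⟦ a :≡ b ⟧ ρ = ⟦ a ⟧ₑ ρ ≡ ⟦ b ⟧ₑ ρ
  ⟦ F :∧ G ⟧ ρ = ⟦ F ⟧ ρ × ⟦ G ⟧ ρ
  ⟦ F :∨ G ⟧ ρ = ⟦ F ⟧ ρ ⊎ ⟦ G ⟧ ρ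
  ⟦ F :⇒ G ⟧ ρ = ⟦ F ⟧ ρ → ⟦ G ⟧ ρ
  ⟦ :⊥ ⟧     ρ = ⊥

  ⟦_⟧? : ∀ F ρ → Dec (⟦ F ⟧ ρ)
  ⟦ a :≤ b ⟧? ρ = _ ≤? _
  ⟦ a :≡ b ⟧? ρ = _ ≟ _
  ⟦ F :∧ G ⟧? ρ = ⟦ F ⟧? ρ ×-dec ⟦ G ⟧? ρ
  ⟦ F :∨ G ⟧? ρ = ⟦ F ⟧? ρ ⊎-dec ⟦ G ⟧? ρ
  ⟦ F :⇒ G ⟧? ρ = ⟦ F ⟧? ρ →-dec ⟦ G ⟧? ρ
  ⟦ :⊥ ⟧?     ρ = no λ ()

  -- A row (c , u , d , v) stands for the inequality c + u·x ≤ d + v·x.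

  Row : ℕ → Set
  Row k = ℕ × Vec ℕ k × ℕ × Vec ℕ k

  ev : ∀ {k} → Vec ℕ k → Vec ℕ k → ℕ
  ev []      []      = 0
  ev (c ∷ u) (x ∷ ρ) = c * x + ev u ρ

  Sat : ∀ {k} → Vec ℕ k → Row k → Set
  Sat ρ (c , u , d , v) = c + ev u ρ ≤ d + ev v ρ

  lincomb : ∀ {k} → ℕ → Vec ℕ k → ℕ → Vec ℕ k → Vec ℕ k
  lincomb p []      q []      = []
  lincomb p (c ∷ u) q (d ∷ v) = p * c + q * d ∷ lincomb p u q v

  ev-lincomb : ∀ {k} p (u : Vec ℕ k) q v ρ → ev (lincomb p u q v) ρ ≡ p * ev u ρ + q * ev v ρ
  ev-lincomb p []      q []      []      = sym (cong₂ _+_ (*-zeroʳ p) (*-zeroʳ q))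
  ev-lincomb p (c ∷ u) q (d ∷ v) (x ∷ ρ) rewrite ev-lincomb p u q v ρ =
    eq p c q d x (ev u ρ) (ev v ρ)
    where
    eq : ∀ p c q d x s t → (p * c + q * d) * x + (p * s + q * t) ≡ p * (c * x + s) + q * (d * x + t)
    eq = solve-∀

  cancel-common : ∀ c d {s t} x → c * x + s ≤ d * x + t → (c ∸ d) * x + s ≤ (d ∸ c) * x + t
  cancel-common zero    zero    x h = h
  cancel-common zero    (suc d) x h = h
  cancel-common (suc c) zero    x h = h
  cancel-common (suc c) (suc d) {s} {t} x h = cancel-common c d x
    (+-cancelˡ-≤ x _ _ (subst₂ _≤_ (+-assoc x (c * x) s) (+-assoc x (d * x) t) h))

  -- After cancellation each variable occurs on at most one side of a row, so a row bounds it either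
  -- from above or from below. `comb` only treats rows of this form.
  tidy : ∀ {k} → Vec ℕ k → Vec ℕ k → Vec ℕ k × Vec ℕ k
  tidy []      []      = [] , []
  tidy (c ∷ u) (d ∷ v) = let u′ , v′ = tidy u v in c ∸ d ∷ u′ , d ∸ c ∷ v′

  tidy-sound : ∀ {k} (u v ρ : Vec ℕ k) s t → s + ev u ρ ≤ t + ev v ρ →
               s + ev (proj₁ (tidy u v)) ρ ≤ t + ev (proj₂ (tidy u v)) ρ
  tidy-sound []      []      []      s t h = h
  tidy-sound (c ∷ u) (d ∷ v) (x ∷ ρ) s t h =
    subst₂ _≤_ (swap ((c ∸ d) * x) s _) (swap ((d ∸ c) * x) t _)
      (cancel-common c d x
        (subst₂ _≤_ (sym (swap (c * x) s _)) (sym (swap (d * x) t _))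
          (subst₂ _≤_ (+-assoc s (c * x) _) (+-assoc t (d * x) _)
            (tidy-sound u v ρ (s + c * x) (t + d * x)
              (subst₂ _≤_ (sym (+-assoc s (c * x) _)) (sym (+-assoc t (d * x) _)) h)))))
    where
    swap : ∀ a b r → a + (b + r) ≡ b + (a + r)
    swap = solve-∀

  -- The first row bounds the variable from above, the second from below; scaling each by the
  -- other's coefficient makes the occurrences cancel. `eliminate` tries all ordered pairs, so one
  -- order suffices.
  comb : ∀ {k} → Row (suc k) → Row (suc k) → List (Row k)
  comb (c₁ , suc p ∷ u₁ , d₁ , zero ∷ v₁) (c₂ , zero ∷ u₂ , d₂ , suc q ∷ v₂) =
    (suc q * c₁ + suc p * c₂ , proj₁ uv , suc q * d₁ + suc p * d₂ , proj₂ uv) ∷ []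
    where uv = tidy (lincomb (suc q) u₁ (suc p) u₂) (lincomb (suc q) v₁ (suc p) v₂)
  comb _ _ = []

  -- Variables are natural numbers: dropping one on the left combines the row with `0 ≤ x`. With the
  -- variable on the right the row is a lower bound and yields nothing on its own.
  keep : ∀ {k} → Row (suc k) → List (Row k)
  keep (c , _ ∷ u , d , zero ∷ v) = (c , u , d , v) ∷ []
  keep _                          = []

  -- Such a row holds for every assignment of natural numbers; discarding it curbs the growth of the
  -- elimination.
  trivial : ∀ {k} → Row k → Bool
  trivial (c , u , d , v) = (c ≤ᵇ d) ∧ zeros u
    where
    zeros : ∀ {k} → Vec ℕ k → Bool
    zeros []          = true
    zeros (zero ∷ u)  = zeros u
    zeros (suc _ ∷ u) = false

  prune : ∀ {k} → List (Row k) → List (Row k)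
  prune []       = []
  prune (r ∷ rs) with trivial r
  ... | true  = prune rs
  ... | false = r ∷ prune rs

  eliminate : ∀ {k} → List (Row (suc k)) → List (Row k)
  eliminate rs = prune (concatMap keep rs ++ concatMap (λ r → concatMap (comb r) rs) rs)

  -- Fourier–Motzkin elimination of the variables, first one first.
  unsat : ∀ {k} → List (Row k) → Bool
  unsat {zero}  rs = any (λ (c , _ , d , _) → d <ᵇ c) rs
  unsat {suc k} rs = unsat (eliminate rs)

  comb-sound : ∀ {k x} {ρ : Vec ℕ k} r₁ r₂ → Sat (x ∷ ρ) r₁ → Sat (x ∷ ρ) r₂ → All (Sat ρ) (comb r₁ r₂)
  comb-sound {x = x} {ρ} (c₁ , suc p ∷ u₁ , d₁ , zero ∷ v₁) (c₂ , zero ∷ u₂ , d₂ , suc q ∷ v₂) h₁ h₂ =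
    tidy-sound (lincomb (suc q) u₁ (suc p) u₂) (lincomb (suc q) v₁ (suc p) v₂) ρ _ _
      (subst₂ _≤_
        (cong (suc q * c₁ + suc p * c₂ +_) (sym (ev-lincomb (suc q) u₁ (suc p) u₂ ρ)))
        (cong (suc q * d₁ + suc p * d₂ +_) (sym (ev-lincomb (suc q) v₁ (suc p) v₂ ρ)))
        (+-cancelˡ-≤ (suc p * suc q * x) _ _
          (subst₂ _≤_ (left (suc p) (suc q) x c₁ c₂ (ev u₁ ρ) (ev u₂ ρ))
                      (right (suc p) (suc q) x d₁ d₂ (ev v₁ ρ) (ev v₂ ρ))
            (+-mono-≤ (*-monoʳ-≤ (suc q) h₁) (*-monoʳ-≤ (suc p) h₂))))) ∷ []
    where
    left : ∀ p q x c₁ c₂ s t → q * (c₁ + (p * x + s)) + p * (c₂ + (0 + t)) ≡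
           p * q * x + (q * c₁ + p * c₂ + (q * s + p * t))
    left = solve-∀
    right : ∀ p q x c₁ c₂ s t → q * (c₁ + (0 + s)) + p * (c₂ + (q * x + t)) ≡
            p * q * x + (q * c₁ + p * c₂ + (q * s + p * t))
    right = solve-∀
  comb-sound (_ , zero ∷ _ , _ , _ ∷ _)      _                               _ _ = []
  comb-sound (_ , suc _ ∷ _ , _ , suc _ ∷ _) _                               _ _ = []
  comb-sound (_ , suc _ ∷ _ , _ , zero ∷ _)  (_ , suc _ ∷ _ , _ , _ ∷ _)     _ _ = []
  comb-sound (_ , suc _ ∷ _ , _ , zero ∷ _)  (_ , zero ∷ _ , _ , zero ∷ _)   _ _ = []

  keep-sound : ∀ {k x} {ρ : Vec ℕ k} r → Sat (x ∷ ρ) r → All (Sat ρ) (keep r)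
  keep-sound {x = x} (c , p ∷ u , d , zero ∷ v) h =
    ≤-trans (+-monoʳ-≤ c (m≤n+m _ (p * x))) h ∷ []
  keep-sound (c , p ∷ u , d , suc _ ∷ v) h = []

  prune-sound : ∀ {k} {ρ : Vec ℕ k} rs → All (Sat ρ) rs → All (Sat ρ) (prune rs)
  prune-sound []       []       = []
  prune-sound (r ∷ rs) (h ∷ hs) with trivial r
  ... | true  = prune-sound rs hs
  ... | false = h ∷ prune-sound rs hs

  concatMap-All : ∀ {A B : Set} {P : A → Set} {Q : B → Set} {f : A → List B} →
                  (∀ a → P a → All Q (f a)) → ∀ {as} → All P as → All Q (concatMap f as)
  concatMap-All h []       = []
  concatMap-All h (p ∷ ps) = All.++⁺ (h _ p) (concatMap-All h ps)

  unsat-sound : ∀ {k} (ρ : Vec ℕ k) rs → T (unsat rs) → All (Sat ρ) rs → ⊥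
  unsat-sound [] ((c , [] , d , []) ∷ rs) t (h ∷ hs) with d <ᵇ c in eq
  ... | true  = <⇒≱ (<ᵇ⇒< d c (subst T (sym eq) tt)) (subst₂ _≤_ (+-identityʳ c) (+-identityʳ d) h)
  ... | false = unsat-sound [] rs t hs
  unsat-sound (x ∷ ρ) rs t hs = unsat-sound ρ (eliminate rs) t
    (prune-sound (concatMap keep rs ++ concatMap (λ r → concatMap (comb r) rs) rs)
      (All.++⁺ (concatMap-All keep-sound hs)
               (concatMap-All (λ r h → concatMap-All (λ r′ h′ → comb-sound r r′ h h′) hs) hs)))

  unit : ∀ {k} → ℕ → Vec ℕ k
  unit {zero}  _       = []
  unit {suc k} zero    = 1 ∷ Vec.replicate k 0
  unit {suc k} (suc i) = 0 ∷ unit i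

  module _ (k : ℕ) where

    compile : Exp → ℕ × Vec ℕ k
    compile (var i)  = 0 , unit i
    compile (con c)  = c , Vec.replicate k 0
    compile (a :+ b) = let c , u = compile a ; d , v = compile b in c + d , Vec.zipWith _+_ u v
    compile (c :* a) = let d , v = compile a in c * d , Vec.map (c *_) v

    le : ℕ → Exp → Exp → Row k
    le s a b = let c , u = compile a ; d , v = compile b ; u′ , v′ = tidy u v in s + c , u′ , d , v′

    -- refute b F κ asks whether assuming F (for b = true) or ¬ F (for b = false)
    -- leads κ to a contradiction on every branch of the tableau.
    refute : Bool → Form → (List (Row k) → Bool) → List (Row k) → Bool
    refute true  (a :≤ b) κ rs = κ (le 0 a b ∷ rs)
    refute false (a :≤ b) κ rs = κ (le 1 b a ∷ rs)
    refute true  (a :≡ b) κ rs = κ (le 0 a b ∷ le 0 b a ∷ rs)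
    refute false (a :≡ b) κ rs = κ (le 1 a b ∷ rs) ∧ κ (le 1 b a ∷ rs)
    refute true  (F :∧ G) κ rs = refute true F (refute true G κ) rs
    refute false (F :∧ G) κ rs = refute false F κ rs ∧ refute false G κ rs
    refute true  (F :∨ G) κ rs = refute true F κ rs ∧ refute true G κ rs
    refute false (F :∨ G) κ rs = refute false F (refute false G κ) rs
    refute true  (F :⇒ G) κ rs = refute false F κ rs ∧ refute true G κ rs
    refute false (F :⇒ G) κ rs = refute true F (refute false G κ) rs
    refute true  :⊥       κ rs = true
    refute false :⊥       κ rs = κ rs

  valid : ℕ → Form → Bool
  valid k F = refute k false F unsat []

  ev-zero : ∀ {k} (ρ : Vec ℕ k) → ev (Vec.replicate k 0) ρ ≡ 0
  ev-zero []      = refl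
  ev-zero (x ∷ ρ) = ev-zero ρ

  ev-unit : ∀ {k} (ρ : Vec ℕ k) i → ev (unit i) ρ ≡ at (Vec.toList ρ) i
  ev-unit []      i       = refl
  ev-unit (x ∷ ρ) zero    = trans (cong₂ _+_ (*-identityˡ x) (ev-zero ρ)) (+-identityʳ x)
  ev-unit (x ∷ ρ) (suc i) = ev-unit ρ i

  ev-+ : ∀ {k} (u v ρ : Vec ℕ k) → ev (Vec.zipWith _+_ u v) ρ ≡ ev u ρ + ev v ρ
  ev-+ []      []      []      = refl
  ev-+ (c ∷ u) (d ∷ v) (x ∷ ρ) rewrite ev-+ u v ρ = eq c d x (ev u ρ) (ev v ρ)
    where
    eq : ∀ c d x s t → (c + d) * x + (s + t) ≡ c * x + s + (d * x + t)
    eq = solve-∀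

  ev-* : ∀ {k} c (u ρ : Vec ℕ k) → ev (Vec.map (c *_) u) ρ ≡ c * ev u ρ
  ev-* c []      []      = sym (*-zeroʳ c)
  ev-* c (d ∷ u) (x ∷ ρ) rewrite ev-* c u ρ = eq c d x (ev u ρ)
    where
    eq : ∀ c d x s → c * d * x + c * s ≡ c * (d * x + s)
    eq = solve-∀

  module _ {k : ℕ} (ρ : Vec ℕ k) where

    value : ℕ × Vec ℕ k → ℕ
    value (c , u) = c + ev u ρ

    compile-sound : ∀ a → value (compile k a) ≡ ⟦ a ⟧ₑ (Vec.toList ρ)
    compile-sound (var i)  = ev-unit ρ i
    compile-sound (con c)  = trans (cong (c +_) (ev-zero ρ)) (+-identityʳ c)
    compile-sound (a :+ b) = let c , u = compile k a ; d , v = compile k b in begin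
      c + d + ev (Vec.zipWith _+_ u v) ρ  ≡⟨ cong (c + d +_) (ev-+ u v ρ) ⟩
      c + d + (ev u ρ + ev v ρ)           ≡⟨ eq c d (ev u ρ) (ev v ρ) ⟩
      (c + ev u ρ) + (d + ev v ρ)         ≡⟨ cong₂ _+_ (compile-sound a) (compile-sound b) ⟩
      ⟦ a :+ b ⟧ₑ (Vec.toList ρ)          ∎
      where
      open ≡-Reasoning
      eq : ∀ c d s t → c + d + (s + t) ≡ (c + s) + (d + t)
      eq = solve-∀
    compile-sound (c :* a) = let d , v = compile k a in begin
      c * d + ev (Vec.map (c *_) v) ρ  ≡⟨ cong (c * d +_) (ev-* c v ρ) ⟩
      c * d + c * ev v ρ               ≡⟨ *-distribˡ-+ c d _ ⟨
      c * (d + ev v ρ)                 ≡⟨ cong (c *_) (compile-sound a) ⟩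
      ⟦ c :* a ⟧ₑ (Vec.toList ρ)       ∎
      where open ≡-Reasoning

    le-sound : ∀ s a b → s + ⟦ a ⟧ₑ (Vec.toList ρ) ≤ ⟦ b ⟧ₑ (Vec.toList ρ) → Sat ρ (le k s a b)
    le-sound s a b h = let c , u = compile k a ; d , v = compile k b in
      tidy-sound u v ρ (s + c) d
        (subst₂ _≤_ (trans (cong (s +_) (sym (compile-sound a))) (sym (+-assoc s c _)))
                    (sym (compile-sound b)) h)

    Holds : Bool → Form → Set
    Holds true  F = ⟦ F ⟧ (Vec.toList ρ)
    Holds false F = ¬ ⟦ F ⟧ (Vec.toList ρ)

    Refutes : (List (Row k) → Bool) → Set
    Refutes κ = ∀ rs → T (κ rs) → All (Sat ρ) rs → ⊥

    ∧-split : ∀ {a b} → T (a ∧ b) → T a × T b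
    ∧-split = Equivalence.to T-∧

    refute-sound : ∀ b F {κ} → Refutes κ → ∀ rs → T (refute k b F κ rs) →
                   Holds b F → All (Sat ρ) rs → ⊥
    refute-sound true  (a :≤ b) κ! rs t h hs = κ! _ t (le-sound 0 a b h ∷ hs)
    refute-sound false (a :≤ b) κ! rs t h hs = κ! _ t (le-sound 1 b a (≰⇒> h) ∷ hs)
    refute-sound true  (a :≡ b) κ! rs t h hs =
      κ! _ t (le-sound 0 a b (≤-reflexive h) ∷ le-sound 0 b a (≤-reflexive (sym h)) ∷ hs)
    refute-sound false (a :≡ b) κ! rs t h hs with ∧-split t
    ... | t₁ , t₂ = h (≤-antisym
      (≮⇒≥ λ b<a → κ! _ t₂ (le-sound 1 b a b<a ∷ hs))
      (≮⇒≥ λ a<b → κ! _ t₁ (le-sound 1 a b a<b ∷ hs)))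
    refute-sound true  (F :∧ G) κ! rs t (f , g) hs =
      refute-sound true F (λ rs′ t′ → refute-sound true G κ! rs′ t′ g) rs t f hs
    refute-sound false (F :∧ G) κ! rs t h hs with ∧-split t
    ... | t₁ , t₂ = refute-sound false F κ! rs t₁
      (λ f → refute-sound false G κ! rs t₂ (λ g → h (f , g)) hs) hs
    refute-sound true  (F :∨ G) κ! rs t (inj₁ f) hs = refute-sound true F κ! rs (proj₁ (∧-split t)) f hs
    refute-sound true  (F :∨ G) κ! rs t (inj₂ g) hs = refute-sound true G κ! rs (proj₂ (∧-split t)) g hs
    refute-sound false (F :∨ G) κ! rs t h hs =
      refute-sound false F (λ rs′ t′ → refute-sound false G κ! rs′ t′ (h ∘ inj₂)) rs t (h ∘ inj₁) hs
    refute-sound true  (F :⇒ G) κ! rs t h hs with ∧-split t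
    ... | t₁ , t₂ = refute-sound false F κ! rs t₁ (λ f → refute-sound true G κ! rs t₂ (h f) hs) hs
    -- `F` cannot be extracted from `¬ (F → G)` directly; instead a proof of `F → G` is built whose
    -- body is refuted.
    refute-sound false (F :⇒ G) κ! rs t h hs = h impossible
      where
      impossible : ⟦ F ⟧ (Vec.toList ρ) → ⟦ G ⟧ (Vec.toList ρ)
      impossible f = ⊥-elim (refute-sound true F
        (λ rs′ t′ → refute-sound false G κ! rs′ t′ (λ g → h (λ _ → g))) rs t f hs)
    refute-sound false :⊥       κ! rs t h hs = κ! rs t hs

  Open : ℕ → Set
  Open zero    = Form
  Open (suc k) = Exp → Open k

  close : ∀ k → ℕ → Open k → Form
  close zero    i F = F
  close (suc k) i F = close k (suc i) (F (var i))

  abstract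
    -- Formulas are decidable, so it suffices to refute the negation. The test runs during type
    -- checking, its `T` argument is solved by unification, and `abstract` keeps the proof terms
    -- from unfolding. Variables are eliminated in the order of the list.
    linear : ∀ {k} (ρ : Vec ℕ k) (F : Open k) → {T (valid k (close k 0 F))} → ⟦ close k 0 F ⟧ (Vec.toList ρ)
    linear {k} ρ F {t} = decidable-stable (⟦ close k 0 F ⟧? _)
      λ h → refute-sound ρ false (close k 0 F) (λ rs → unsat-sound ρ rs) [] t h []

open LinearArithmetic

-- Counting by lists and counting sets of points

module Cardinality where

  open import Defs using (HasCard)
  open import Data.Fin using (Fin; toℕ; fromℕ<; inject≤)
  open import Data.Fin.Properties using (toℕ-injective; toℕ-fromℕ<; toℕ-inject≤; toℕ<n; inject≤-injective)
  open import Data.List using (List; []; _∷_; _++_; map; length; filter; allFin; tabulate)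
  open import Data.List.Membership.Propositional using (_∈_)
  open import Data.List.Membership.Propositional.Properties using (∈-∃++; ∈-++⁻; ∈-++⁺ˡ; ∈-++⁺ʳ; ∈-filter⁺; ∈-filter⁻; ∈-allFin; ∈-tabulate⁺; ∈-tabulate⁻)
  open import Data.List.Properties using (length-map; length-tabulate)
  open import Data.List.Relation.Binary.Subset.Propositional using (_⊆_)
  open import Data.List.Relation.Unary.All as All using (All; []; _∷_)
  import Data.List.Relation.Unary.All.Properties as All
  open import Data.List.Relation.Unary.AllPairs using ([]; _∷_)
  open import Data.List.Relation.Unary.Any using (here; there)
  open import Data.List.Relation.Unary.Unique.Propositional using (Unique)
  import Data.List.Relation.Unary.Unique.Propositional.Properties as Unique
  open import Level using (0ℓ)
  open import Relation.Nullary.Decidable using (_×-dec_)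
  open import Relation.Unary using (Pred; Decidable)

  -- Pigeonhole: the head of `xs` removes one occurrence from `ys`, and uniqueness keeps the tail
  -- inside what remains.
  length-⊆ : ∀ {A : Set} {xs ys : List A} → Unique xs → xs ⊆ ys → length xs ≤ length ys
  length-⊆ []       _ = z≤n
  length-⊆ {xs = x ∷ xs} (x∉xs ∷ u) s with ∈-∃++ (s (here refl))
  ... | as , bs , refl = ≤-trans (s≤s (length-⊆ u sub)) (≤-reflexive (eq as))
    where
    sub : xs ⊆ as ++ bs
    sub {y} y∈xs with ∈-++⁻ as (s (there y∈xs))
    ... | inj₁ y∈as         = ∈-++⁺ˡ y∈as
    ... | inj₂ (here refl)  = ⊥-elim (All.lookup x∉xs y∈xs refl)
    ... | inj₂ (there y∈bs) = ∈-++⁺ʳ as y∈bs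
    eq : ∀ {x bs} as → suc (length (as ++ bs)) ≡ length (as ++ x ∷ bs)
    eq []       = refl
    eq (_ ∷ as) = cong suc (eq as)

  map-Unique : ∀ {A B : Set} {f : A → B} {xs} → (∀ {x y} → x ∈ xs → y ∈ xs → f x ≡ f y → x ≡ y) →
               Unique xs → Unique (map f xs)
  map-Unique inj []       = []
  map-Unique {f = f} {x ∷ xs} inj (x∉ ∷ u) =
    All.map⁺ (All.tabulate λ {y} y∈ eq → All.lookup x∉ y∈ (inj (here refl) (there y∈) eq)) ∷
    map-Unique (λ p q → inj (there p) (there q)) u

  -- Lower bounds on degrees need only some neighbours; listing those avoids deciding adjacency.
  AtLeast : ∀ {A : Set} → (A → Set) → ℕ → Set
  AtLeast {A} P k = Σ (List A) λ L → Unique L × length L ≡ k × All P L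

  AtLeast⇒≤ : ∀ {A : Set} {P : A → Set} {j k} → AtLeast P j → HasCard P k → j ≤ k
  AtLeast⇒≤ (_ , u , refl , ps) (_ , _ , refl , iff) =
    length-⊆ u λ x∈ → Equivalence.from (iff _) (All.lookup ps x∈)

  HasCard-unique : ∀ {A : Set} {P : A → Set} {j k} → HasCard P j → HasCard P k → j ≡ k
  HasCard-unique c c′ = ≤-antisym (AtLeast⇒≤ (weaken c) c′) (AtLeast⇒≤ (weaken c′) c)
    where
    weaken : ∀ {A : Set} {P : A → Set} {k} → HasCard P k → AtLeast P k
    weaken (L , u , eq , iff) = L , u , eq , All.tabulate (Equivalence.to (iff _))

  AtLeast-map : ∀ {A B : Set} {P : A → Set} {Q : B → Set} {k} (f : A → B) →
                (∀ {x y} → f x ≡ f y → x ≡ y) → (∀ {x} → P x → Q (f x)) → AtLeast P k → AtLeast Q k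
  AtLeast-map f inj h (L , u , eq , ps) =
    map f L , Unique.map⁺ inj u , trans (length-map f L) eq , All.map⁺ (All.map h ps)

  -- The same expression as in `numEdgesOfLength`, `edgesInside` and `edgesOutside`, so these counts
  -- are instances by definition.
  #_ : ∀ {N} {P : Pred (Fin N) 0ℓ} → Decidable P → ℕ
  #_ {N} P? = length (filter P? (allFin N))

  module _ {N : ℕ} where

    private
      ∈-# : ∀ {P : Pred (Fin N) 0ℓ} (P? : Decidable P) {x} → P x → x ∈ filter P? (allFin N)
      ∈-# P? = ∈-filter⁺ P? (∈-allFin _)

      #-∈ : ∀ {P : Pred (Fin N) 0ℓ} (P? : Decidable P) {x} → x ∈ filter P? (allFin N) → P x
      #-∈ P? = proj₂ ∘ ∈-filter⁻ P? {xs = allFin N}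

    #-card : ∀ {P : Pred (Fin N) 0ℓ} (P? : Decidable P) → HasCard P (# P?)
    #-card P? = _ , Unique.filter⁺ P? (Unique.allFin⁺ N) , refl , λ x → mk⇔ (#-∈ P?) (∈-# P?)

    #-inj : ∀ {P Q : Pred (Fin N) 0ℓ} (P? : Decidable P) (Q? : Decidable Q) (g : Fin N → Fin N) →
            (∀ {x y} → g x ≡ g y → x ≡ y) → (∀ {x} → P x → Q (g x)) → # P? ≤ # Q?
    #-inj P? Q? g inj h = AtLeast⇒≤
      (AtLeast-map g inj h (_ , Unique.filter⁺ P? (Unique.allFin⁺ N) , refl , All.all-filter P? (allFin N)))
      (#-card Q?)

    #-split : ∀ {P Q R : Pred (Fin N) 0ℓ} (P? : Decidable P) (Q? : Decidable Q) (R? : Decidable R) →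
              (∀ {x} → P x → Q x ⊎ R x) → (∀ {x} → Q x → P x) → (∀ {x} → R x → P x) →
              (∀ {x} → Q x → R x → ⊥) → # P? ≡ # Q? + # R?
    #-split P? Q? R? f g h d = go (allFin N)
      where
      go : ∀ xs → length (filter P? xs) ≡ length (filter Q? xs) + length (filter R? xs)
      go []       = refl
      go (x ∷ xs) with P? x | Q? x | R? x
      ... | yes p | yes q | yes r = ⊥-elim (d q r)
      ... | yes p | yes q | no  _ = cong suc (go xs)
      ... | yes p | no  _ | yes r = trans (cong suc (go xs)) (sym (+-suc _ _))
      ... | yes p | no ¬q | no ¬r with f p
      ...   | inj₁ q = ⊥-elim (¬q q)
      ...   | inj₂ r = ⊥-elim (¬r r)
      go (x ∷ xs) | no ¬p | yes q | _     = ⊥-elim (¬p (g q))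
      go (x ∷ xs) | no ¬p | no  _ | yes r = ⊥-elim (¬p (h r))
      go (x ∷ xs) | no ¬p | no  _ | no  _ = go xs

    below : ∀ s → Decidable {A = Fin N} (λ x → toℕ x < s)
    below s x = toℕ x <? s

    between : ∀ s t → Decidable {A = Fin N} (λ x → s ≤ toℕ x × toℕ x < t)
    between s t x = (s ≤? toℕ x) ×-dec (toℕ x <? t)

    #-below : ∀ s → s ≤ N → # (below s) ≡ s
    #-below s s≤N = ≤-antisym
      (AtLeast⇒≤ {P = λ x → toℕ x < s}
         (_ , Unique.filter⁺ (below s) (Unique.allFin⁺ N) , refl , All.all-filter (below s) (allFin N))
         (L , Unique.tabulate⁺ (inject≤-injective s≤N s≤N _ _) , length-tabulate _ , λ x → mk⇔ to (from x)))
      (AtLeast⇒≤ {P = λ x → toℕ x < s}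
         (L , Unique.tabulate⁺ (inject≤-injective s≤N s≤N _ _) , length-tabulate _ , All.tabulate to)
         (#-card (below s)))
      where
      L : List (Fin N)
      L = tabulate (λ (i : Fin s) → inject≤ i s≤N)
      to : ∀ {x} → x ∈ L → toℕ x < s
      to x∈ with ∈-tabulate⁻ x∈
      ... | i , refl = subst (_< s) (sym (toℕ-inject≤ i s≤N)) (toℕ<n i)
      from : ∀ x → toℕ x < s → x ∈ L
      from x x<s = subst (_∈ L)
        (toℕ-injective (trans (toℕ-inject≤ _ s≤N) (toℕ-fromℕ< x<s))) (∈-tabulate⁺ (fromℕ< x<s))

    #-between : ∀ s t → s ≤ t → t ≤ N → s + # (between s t) ≡ t
    #-between s t s≤t t≤N = begin
      s + # (between s t)            ≡⟨ cong (_+ # (between s t)) (#-below s (≤-trans s≤t t≤N)) ⟨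
      # (below s) + # (between s t)  ≡⟨ #-split (below t) (below s) (between s t)
                                          (λ {x} x<t → split (toℕ x) x<t) (λ p → <-≤-trans p s≤t) proj₂
                                          (λ p (q , _) → <⇒≱ p q) ⟨
      # (below t)                    ≡⟨ #-below t t≤N ⟩
      t                              ∎
      where
      open ≡-Reasoning
      split : ∀ x → x < t → x < s ⊎ (s ≤ x × x < t)
      split x x<t with x <? s
      ... | yes p = inj₁ p
      ... | no ¬p = inj₂ (≮⇒≥ ¬p , x<t)

    -- Stated without subtraction; the points of `[s , t)` are added on both sides and cancelled.
    #-outside : ∀ {P : Pred (Fin N) 0ℓ} (P? : Decidable P) s t → s ≤ t → t ≤ N →
                (∀ {x} → P x → toℕ x < s ⊎ t ≤ toℕ x) → (∀ {x} → toℕ x < s ⊎ t ≤ toℕ x → P x) →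
                t + # P? ≡ s + N
    #-outside P? s t s≤t t≤N f g = +-cancelʳ-≡ (# (between s t)) _ _ (begin
      t + # P? + # (between s t)    ≡⟨ +-assoc t _ _ ⟩
      t + (# P? + # (between s t))  ≡⟨ cong (t +_) (#-split (below N) P? (between s t)
                                         (λ {x} _ → split x) (λ {x} _ → toℕ<n x) (λ {x} _ → toℕ<n x)
                                         (λ p (q , r) → disj (f p) q r)) ⟨
      t + # (below N)               ≡⟨ cong (t +_) (#-below N ≤-refl) ⟩
      t + N                         ≡⟨ cong (_+ N) (#-between s t s≤t t≤N) ⟨
      s + # (between s t) + N       ≡⟨ linear (s ∷ # (between s t) ∷ N ∷ [])
                                         (λ s c n → s :+ c :+ n :≡ s :+ n :+ c) ⟩
      s + N + # (between s t)       ∎)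
      where
      open ≡-Reasoning
      split : ∀ x → _ ⊎ _
      split x with toℕ x <? s | toℕ x <? t
      ... | yes p | _     = inj₁ (g (inj₁ p))
      ... | no ¬p | yes q = inj₂ (≮⇒≥ ¬p , q)
      ... | no ¬p | no ¬q = inj₁ (g (inj₂ (≮⇒≥ ¬q)))
      disj : ∀ {x} → x < s ⊎ t ≤ x → s ≤ x → x < t → ⊥
      disj (inj₁ p) q r = <⇒≱ p q
      disj (inj₂ p) q r = <⇒≱ r p

    -- In a union of edges of a fixed-point-free involution, the smaller and the larger endpoints are
    -- exchanged by the involution.
    #-matched : ∀ {S R : Pred (Fin N) 0ℓ} (S? : Decidable S) (R? : Decidable R) (g : Fin N → Fin N) →
                (∀ x → g (g x) ≡ x) → (∀ x → g x ≢ x) → (∀ {x} → S x → S (g x)) →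
                (∀ {x} → toℕ x < toℕ (g x) → S x → R x) →
                (∀ {x} → R x → toℕ x < toℕ (g x) × S x) → 2 * # R? ≡ # S?
    #-matched S? R? g inv nofix closed f h = begin
      2 * # R?     ≡⟨ cong (# R? +_) (+-identityʳ _) ⟩
      # R? + # R?  ≡⟨ cong (# R? +_) (≤-antisym
                        (#-inj R? Q? g g-inj λ r → proj₁ (upper r) , closed (proj₂ (h r)))
                        (#-inj Q? R? g g-inj λ {x} (p , s) →
                          f (subst (λ y → toℕ (g x) < toℕ y) (sym (inv x)) p) (closed s))) ⟩
      # R? + # Q?  ≡⟨ #-split S? R? Q? (λ {x} → split x) (proj₂ ∘ h) proj₂
                        (λ r (q , _) → <-asym (proj₁ (h r)) q) ⟨
      # S?         ∎
      where
      open ≡-Reasoning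
      Q? : Decidable (λ x → toℕ (g x) < toℕ x × _)
      Q? x = (toℕ (g x) <? toℕ x) ×-dec S? x
      g-inj : ∀ {x y} → g x ≡ g y → x ≡ y
      g-inj {x} {y} eq = trans (sym (inv x)) (trans (cong g eq) (inv y))
      upper : ∀ {x} → _ → toℕ (g (g x)) < toℕ (g x) × _
      upper {x} r = subst (λ y → toℕ y < toℕ (g x)) (sym (inv x)) (proj₁ (h r)) , r
      split : ∀ x → _ → _ ⊎ _
      split x s with toℕ x <? toℕ (g x)
      ... | yes p = inj₁ (f p s)
      ... | no ¬p = inj₂ (≤∧≢⇒< (≮⇒≥ ¬p) (nofix x ∘ toℕ-injective) , s)

open Cardinality

-- Matchings as involutions of the natural numbers; empty quadrilaterals

module Matchings where

  open import Data.Fin using (Fin; toℕ; fromℕ<)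
  open import Data.Fin.Properties using (toℕ-injective; toℕ-fromℕ<; fromℕ<-toℕ; toℕ<n)
  open import Data.Vec using (lookup; tabulate)
  open import Data.Vec.Properties using (lookup∘tabulate)
  import Data.Vec.Relation.Binary.Pointwise.Extensional as Ext
  open import Relation.Nullary.Decidable using (_×-dec_)

  -- The partner function, extended by the identity beyond the last point.
  opaque
    val : ∀ {N} → Vec (Fin N) N → ℕ → ℕ
    val {N} M k with k <? N
    ... | yes k<N = toℕ (lookup M (fromℕ< k<N))
    ... | no  _   = k

    val-toℕ : ∀ {N} (M : Vec (Fin N) N) x → val M (toℕ x) ≡ toℕ (lookup M x)
    val-toℕ {N} M x with toℕ x <? N
    ... | yes p = cong (toℕ ∘ lookup M) (fromℕ<-toℕ x p)
    ... | no ¬p = ⊥-elim (¬p (toℕ<n x))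

    val-out : ∀ {N} (M : Vec (Fin N) N) {k} → N ≤ k → val M k ≡ k
    val-out {N} M {k} N≤k with k <? N
    ... | yes k<N = ⊥-elim (<⇒≱ k<N N≤k)
    ... | no  _   = refl

  module _ {N : ℕ} (M : Vec (Fin N) N) where

    lookup⇒val : ∀ {x y} → lookup M x ≡ y → val M (toℕ x) ≡ toℕ y
    lookup⇒val eq = trans (val-toℕ M _) (cong toℕ eq)

    val⇒lookup : ∀ {x y} → val M (toℕ x) ≡ toℕ y → lookup M x ≡ y
    val⇒lookup eq = toℕ-injective (trans (sym (val-toℕ M _)) eq)

  -- Matching on `pt x` replaces a number `k < N` by `toℕ x` throughout the goal, which moves
  -- statements about `val` to `Fin`.
  data Point {N : ℕ} : ℕ → Set where
    pt : (x : Fin N) → Point (toℕ x)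

  point : ∀ {N k} → k < N → Point {N} k
  point k<N = subst Point (toℕ-fromℕ< k<N) (pt (fromℕ< k<N))

  lookup-ext : ∀ {A : Set} {N} {u v : Vec A N} → (∀ x → lookup u x ≡ lookup v x) → u ≡ v
  lookup-ext h = Ext.Pointwise-≡⇒≡ (Ext.ext h)

  val-ext : ∀ {N} {M M′ : Vec (Fin N) N} → (∀ {k} → k < N → val M k ≡ val M′ k) → M ≡ M′
  val-ext {M = M} {M′} h = lookup-ext λ x → val⇒lookup M (trans (h (toℕ<n x)) (val-toℕ M′ x))

  fromFun : ∀ {N} (f : ℕ → ℕ) → (∀ {x} → x < N → f x < N) → Vec (Fin N) N
  fromFun f dom = tabulate λ x → fromℕ< (dom (toℕ<n x))

  val-fromFun : ∀ {N} f (dom : ∀ {x} → x < N → f x < N) {k} → k < N → val (fromFun f dom) k ≡ f k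
  val-fromFun f dom k<N with point k<N
  ... | pt x = trans (val-toℕ (fromFun f dom) x)
    (trans (cong toℕ (lookup∘tabulate _ x)) (toℕ-fromℕ< _))

  -- Non-crossing is tested from the smaller end of an edge only: `nest` treats the points under the
  -- edge, and the involution supplies the other cases.
  record NC (N : ℕ) (f : ℕ → ℕ) : Set where
    field
      inv   : ∀ x → f (f x) ≡ x
      dom   : ∀ {x} → x < N → f x < N
      nofix : ∀ {x} → x < N → f x ≢ x
      nest  : ∀ {i j} → i < j → j < f i → i < f j × f j < f i

    adjoint : ∀ {x y} → f x ≡ y → f y ≡ x
    adjoint {x} refl = inv x

    injective : ∀ {x y} → f x ≡ f y → x ≡ y
    injective eq = trans (sym (inv _)) (adjoint (sym eq))

  Btw : ℕ → ℕ → ℕ → Set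
  Btw a b x = (a < x × x < b) ⊎ (b < x × x < a)

  module _ {n : ℕ} where

    sep⇒ : ∀ {x a b : Pt n} → Sep n x a b → Btw (toℕ a) (toℕ b) (toℕ x)
    sep⇒ {x} {a} {b} (p , q) with ≤-total (toℕ a) (toℕ b)
    ... | inj₁ a≤b = inj₁ (subst (_< toℕ x) (m≤n⇒m⊓n≡m a≤b) p , subst (toℕ x <_) (m≤n⇒m⊔n≡n a≤b) q)
    ... | inj₂ b≤a = inj₂ (subst (_< toℕ x) (m≥n⇒m⊓n≡n b≤a) p , subst (toℕ x <_) (m≥n⇒m⊔n≡m b≤a) q)

    ⇒sep : ∀ {x a b : Pt n} → Btw (toℕ a) (toℕ b) (toℕ x) → Sep n x a b
    ⇒sep {x} {a} {b} (inj₁ (p , q)) =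
      ≤-<-trans (m⊓n≤m (toℕ a) (toℕ b)) p , <-≤-trans q (m≤n⊔m (toℕ a) (toℕ b))
    ⇒sep {x} {a} {b} (inj₂ (p , q)) =
      ≤-<-trans (m⊓n≤n (toℕ a) (toℕ b)) p , <-≤-trans q (m≤m⊔n (toℕ a) (toℕ b))

    sep? : ∀ (x a b : Pt n) → Dec (Sep n x a b)
    sep? x a b = (_ <? _) ×-dec (_ <? _)

    ¬cross⇒ : ∀ {a b x y : Pt n} → ¬ Cross n a b x y →
              Btw (toℕ a) (toℕ b) (toℕ x) → Btw (toℕ a) (toℕ b) (toℕ y)
    ¬cross⇒ {a} {b} {x} {y} h p with sep? y a b
    ... | yes q = sep⇒ {y} {a} {b} q
    ... | no ¬q = ⊥-elim (h (inj₁ (⇒sep {x} {a} {b} p , ¬q)))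

    ⇒¬cross : ∀ {a b x y : Pt n} →
              (Btw (toℕ a) (toℕ b) (toℕ x) → Btw (toℕ a) (toℕ b) (toℕ y)) →
              (Btw (toℕ a) (toℕ b) (toℕ y) → Btw (toℕ a) (toℕ b) (toℕ x)) → ¬ Cross n a b x y
    ⇒¬cross {a} {b} {x} {y} f g (inj₁ (p , ¬q)) = ¬q (⇒sep {y} {a} {b} (f (sep⇒ {x} {a} {b} p)))
    ⇒¬cross {a} {b} {x} {y} f g (inj₂ (¬p , q)) = ¬p (⇒sep {x} {a} {b} (g (sep⇒ {y} {a} {b} q)))

    IsNCM⇒NC : ∀ {M} → IsNCM n M → NC (2 * n) (val M)
    IsNCM⇒NC {M} (pm , nc) = record
      { inv = inv ; dom = λ p → dom (point p) ; nofix = λ p → nofix (point p) ; nest = nest }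
      where
      inv : ∀ x → val M (val M x) ≡ x
      inv x with x <? 2 * n
      ... | no ¬p = trans (cong (val M) (val-out M (≮⇒≥ ¬p))) (val-out M (≮⇒≥ ¬p))
      ... | yes p with point p
      ...   | pt x = trans (cong (val M) (val-toℕ M x)) (lookup⇒val M (proj₁ (pm x)))
      dom : ∀ {x} → Point {2 * n} x → val M x < 2 * n
      dom (pt x) = subst (_< 2 * n) (sym (val-toℕ M x)) (toℕ<n _)
      nofix : ∀ {x} → Point {2 * n} x → val M x ≢ x
      nofix (pt x) eq = proj₂ (pm x) (val⇒lookup M eq)
      nest′ : ∀ {i j} → Point {2 * n} i → Point {2 * n} j → i < j → j < val M i → i < val M j × val M j < val M i
      nest′ (pt x) (pt y) p q rewrite val-toℕ M x | val-toℕ M y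
        with ¬cross⇒ {x} {lookup M x} {y} (nc x y (λ { refl → <-irrefl refl p }) (λ { refl → <-irrefl refl q }))
                     (inj₁ (p , q))
      ... | inj₁ r       = r
      ... | inj₂ (r , s) = ⊥-elim (<-asym (<-trans p q) (<-trans r s))
      nest : ∀ {i j} → i < j → j < val M i → i < val M j × val M j < val M i
      nest {i} {j} p q = nest′ (point i<N) (point (<-trans q (dom (point i<N)))) p q
        where
        i<N : i < 2 * n
        i<N = ≰⇒> λ N≤i → <-asym p (subst (j <_) (val-out M N≤i) q)

    NC⇒IsNCM : ∀ {M} → NC (2 * n) (val M) → IsNCM n M
    NC⇒IsNCM {M} R = pm , λ i j j≢i j≢Mi → ⇒¬cross {i} {lookup M i} {j}
        (sub i j) (λ p → subst (Btw _ _) (cong toℕ (proj₁ (pm j))) (sub i (lookup M j) p))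
      where
      open NC R
      pm : IsPerfectMatching n M
      pm x = val⇒lookup M (trans (cong (val M) (sym (val-toℕ M x))) (inv _)) ,
             λ eq → nofix (toℕ<n x) (trans (val-toℕ M x) (cong toℕ eq))
      sub : ∀ i j → Btw (toℕ i) (toℕ (lookup M i)) (toℕ j) →
            Btw (toℕ i) (toℕ (lookup M i)) (toℕ (lookup M j))
      sub i j (inj₁ (p , q)) rewrite sym (val-toℕ M i) | sym (val-toℕ M j) = inj₁ (nest p q)
      sub i j (inj₂ (p , q)) rewrite sym (val-toℕ M i) | sym (val-toℕ M j) =
        inj₂ (subst (λ z → val M (toℕ i) < val M (toℕ j) × val M (toℕ j) < z) (inv (toℕ i))
          (nest p (subst (toℕ j <_) (sym (inv (toℕ i))) q)))

  -- The quadrilateral a < b < c < d is not entered by any edge of f.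
  record Quad (N : ℕ) (f : ℕ → ℕ) (a b c d : ℕ) : Set where
    field
      a<b : a < b
      b<c : b < c
      c<d : c < d
      d<N : d < N
      ab  : ∀ {x} → a < x → x < b → a < f x × f x < b
      bc  : ∀ {x} → b < x → x < c → b < f x × f x < c
      cd  : ∀ {x} → c < x → x < d → c < f x × f x < d

  Off : (x a b c d : ℕ) → Set
  Off x a b c d = x ≢ a × x ≢ b × x ≢ c × x ≢ d

  data Sides (f : ℕ → ℕ) (a b c d : ℕ) : Set where
    sides : f a ≡ b → f b ≡ a → f c ≡ d → f d ≡ c → Sides f a b c d

  -- Reading the corners cyclically makes both pairings, `ab`, `cd` and `bc`, `da`, instances of
  -- `Sides`. The gap from `d` across the origin to `a` is `2n - d + a`, hence the bound
  -- `a + n ≤ d`.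
  record Flip (n : ℕ) (f g : ℕ → ℕ) (a b c d : ℕ) : Set where
    field
      quad  : Quad (2 * n) f a b c d
      swap  : (Sides f a b c d × Sides g b c d a) ⊎ (Sides f b c d a × Sides g a b c d)
      same  : ∀ {x} → Off x a b c d → g x ≡ f x
      ab≤   : b ≤ a + n
      bc≤   : c ≤ b + n
      cd≤   : d ≤ c + n
      da≤   : a + n ≤ d
    open Quad quad public

  -- A point strictly inside an arc is not a corner, so it has the same partner in `f` and `g` and
  -- the quadrilateral stays empty. Needed because `Adj` admits flips in both directions.
  flip-sym : ∀ {n f g a b c d} → Flip n f g a b c d → Flip n g f a b c d
  flip-sym {n} {f} {g} {a} {b} {c} {d} F = record
    { quad = record
      { a<b = a<b ; b<c = b<c ; c<d = c<d ; d<N = d<N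
      ; ab = λ p q → subst (λ y → a < y × y < b) (sym (same
          ((λ { refl → <-irrefl refl p }) , (λ { refl → <-irrefl refl q }) ,
           (λ { refl → <-asym q b<c }) , (λ { refl → <-asym q (<-trans b<c c<d) })))) (ab p q)
      ; bc = λ p q → subst (λ y → b < y × y < c) (sym (same
          ((λ { refl → <-asym p a<b }) , (λ { refl → <-irrefl refl p }) ,
           (λ { refl → <-irrefl refl q }) , (λ { refl → <-asym q c<d })))) (bc p q)
      ; cd = λ p q → subst (λ y → c < y × y < d) (sym (same
          ((λ { refl → <-asym p (<-trans a<b b<c) }) , (λ { refl → <-asym p b<c }) ,
           (λ { refl → <-irrefl refl p }) , (λ { refl → <-irrefl refl q })))) (cd p q) }
    ; swap = [ (λ (s , t) → inj₂ (t , s)) , (λ (s , t) → inj₁ (t , s)) ]′ swap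
    ; same = sym ∘ same
    ; ab≤ = ab≤ ; bc≤ = bc≤ ; cd≤ = cd≤ ; da≤ = da≤ }
    where open Flip F

  off-or-corner : ∀ x a b c d → Off x a b c d ⊎ x ≡ a ⊎ x ≡ b ⊎ x ≡ c ⊎ x ≡ d
  off-or-corner x a b c d with x ≟ a | x ≟ b | x ≟ c | x ≟ d
  ... | yes p | _     | _     | _     = inj₂ (inj₁ p)
  ... | no _  | yes p | _     | _     = inj₂ (inj₂ (inj₁ p))
  ... | no _  | no _  | yes p | _     = inj₂ (inj₂ (inj₂ (inj₁ p)))
  ... | no _  | no _  | no _  | yes p = inj₂ (inj₂ (inj₂ (inj₂ p)))
  ... | no p  | no q  | no r  | no s  = inj₁ (p , q , r , s)

  -- The syntactic copy of `SameArc`; their agreement by definition is what lets `linear` speak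
  -- about it.
  sameArc : (a b c d x y : Exp) → Form
  sameArc a b c d x y =
       (a :< x :∧ x :< b :∧ a :< y :∧ y :< b)
    :∨ (b :< x :∧ x :< c :∧ b :< y :∧ y :< c)
    :∨ (c :< x :∧ x :< d :∧ c :< y :∧ y :< d)
    :∨ ((x :< a :∨ d :< x) :∧ (y :< a :∨ d :< y))

  SameArc : (a b c d x y : ℕ) → Set
  SameArc a b c d x y =
      (a < x × x < b × a < y × y < b)
    ⊎ (b < x × x < c × b < y × y < c)
    ⊎ (c < x × x < d × c < y × y < d)
    ⊎ ((x < a ⊎ d < x) × (y < a ⊎ d < y))

  module _ {N f a b c d} (R : NC N f) (Q : Quad N f a b c d) where
    open NC R
    open Quad Q

    private
      data Arc (x : ℕ) : Set where
        in-ab : a < x → x < b → Arc x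
        in-bc : b < x → x < c → Arc x
        in-cd : c < x → x < d → Arc x
        out   : x < a ⊎ d < x → Arc x

      arc : ∀ {x} → Off x a b c d → Arc x
      arc {x} (x≢a , x≢b , x≢c , x≢d) with <-cmp x a | <-cmp x b | <-cmp x c | <-cmp x d
      ... | tri≈ _ p _ | _ | _ | _ = ⊥-elim (x≢a p)
      ... | _ | tri≈ _ p _ | _ | _ = ⊥-elim (x≢b p)
      ... | _ | _ | tri≈ _ p _ | _ = ⊥-elim (x≢c p)
      ... | _ | _ | _ | tri≈ _ p _ = ⊥-elim (x≢d p)
      ... | tri< p _ _ | _ | _ | _ = out (inj₁ p)
      ... | tri> _ _ p | tri< q _ _ | _ | _ = in-ab p q
      ... | tri> _ _ p | tri> _ _ q | tri< r _ _ | _ = in-bc q r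
      ... | tri> _ _ p | tri> _ _ q | tri> _ _ r | tri< s _ _ = in-cd r s
      ... | tri> _ _ p | tri> _ _ q | tri> _ _ r | tri> _ _ s = out (inj₂ s)

    -- `Quad` speaks of the three arcs between `a` and `d` only. For a point outside them, a partner
    -- inside one of these arcs would be sent back into that arc, although `f` is an involution.
    same-arc : ∀ {x} → Off x a b c d → Off (f x) a b c d → SameArc a b c d x (f x)
    same-arc {x} o o′ with arc o
    ... | in-ab p q = inj₁ (p , q , ab p q)
    ... | in-bc p q = inj₂ (inj₁ (p , q , bc p q))
    ... | in-cd p q = inj₂ (inj₂ (inj₁ (p , q , cd p q)))
    ... | out h with arc o′
    ...   | out h′ = inj₂ (inj₂ (inj₂ (h , h′)))
    ...   | in-ab p q = ⊥-elim (absurd h (subst (λ z → a < z × z < b) (inv x) (ab p q)))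
      where
      absurd : x < a ⊎ d < x → a < x × x < b → ⊥
      absurd = linear (a ∷ b ∷ c ∷ d ∷ x ∷ []) (λ a b c d x → b :< c :⇒ c :< d :⇒
        (x :< a :∨ d :< x) :⇒ a :< x :∧ x :< b :⇒ :⊥) b<c c<d
    ...   | in-bc p q = ⊥-elim (absurd h (subst (λ z → b < z × z < c) (inv x) (bc p q)))
      where
      absurd : x < a ⊎ d < x → b < x × x < c → ⊥
      absurd = linear (a ∷ b ∷ c ∷ d ∷ x ∷ []) (λ a b c d x → a :< b :⇒ c :< d :⇒
        (x :< a :∨ d :< x) :⇒ b :< x :∧ x :< c :⇒ :⊥) a<b c<d
    ...   | in-cd p q = ⊥-elim (absurd h (subst (λ z → c < z × z < d) (inv x) (cd p q)))
      where
      absurd : x < a ⊎ d < x → c < x × x < d → ⊥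
      absurd = linear (a ∷ b ∷ c ∷ d ∷ x ∷ []) (λ a b c d x → a :< b :⇒ b :< c :⇒
        (x :< a :∨ d :< x) :⇒ c :< x :∧ x :< d :⇒ :⊥) a<b b<c

open Matchings

-- Flips preserve non-crossing matchings; translation from and to `CenteredFlip`

module Flips where

  open import Data.Fin using (toℕ)
  open import Data.Fin.Properties using (toℕ-injective; toℕ<n)
  open import Data.Vec using (lookup)

  corner : (p q r s x y : Exp) → Form
  corner p q r s x y = (x :≡ p :∧ y :≡ q) :∨ (x :≡ q :∧ y :≡ p) :∨ (x :≡ r :∧ y :≡ s) :∨ (x :≡ s :∧ y :≡ r)

  Corner : (p q r s x y : ℕ) → Set
  Corner p q r s x y = (x ≡ p × y ≡ q) ⊎ (x ≡ q × y ≡ p) ⊎ (x ≡ r × y ≡ s) ⊎ (x ≡ s × y ≡ r)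

  Chain : (a b c d : ℕ) → Set
  Chain a b c d = a < b × b < c × c < d

  chain : (a b c d : Exp) → Form
  chain a b c d = a :< b :∧ b :< c :∧ c :< d

  off : (x a b c d : Exp) → Form
  off x a b c d = :¬ (x :≡ a) :∧ :¬ (x :≡ b) :∧ :¬ (x :≡ c) :∧ :¬ (x :≡ d)

  btw : (a b x : Exp) → Form
  btw a b x = (a :< x :∧ x :< b) :∨ (b :< x :∧ x :< a)

  Nests : (i i′ j j′ : ℕ) → Set
  Nests i i′ j j′ = i < j → j < i′ → i < j′ × j′ < i′

  nests : (i i′ j j′ : Exp) → Form
  nests i i′ j j′ = i :< j :⇒ j :< i′ :⇒ i :< j′ :∧ j′ :< i′

  module _ (a b c d i i′ j j′ : ℕ) where

    -- After a flip, two edges that are not both old fall into three cases: both join corners, or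
    -- only the first does, or only the second. Each is an order problem on `a < b < c < d`, posed
    -- for both pairings of the corners.
    corner-corner₁ : Chain a b c d → Corner a b c d i i′ → Corner a b c d j j′ → Nests i i′ j j′
    corner-corner₁ = linear (i ∷ i′ ∷ j ∷ j′ ∷ a ∷ b ∷ c ∷ d ∷ []) λ i i′ j j′ a b c d →
      chain a b c d :⇒ corner a b c d i i′ :⇒ corner a b c d j j′ :⇒ nests i i′ j j′

    corner-corner₂ : Chain a b c d → Corner b c d a i i′ → Corner b c d a j j′ → Nests i i′ j j′
    corner-corner₂ = linear (i ∷ i′ ∷ j ∷ j′ ∷ a ∷ b ∷ c ∷ d ∷ []) λ i i′ j j′ a b c d →
      chain a b c d :⇒ corner b c d a i i′ :⇒ corner b c d a j j′ :⇒ nests i i′ j j′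

    corner-off₁ : Chain a b c d → Corner a b c d i i′ → SameArc a b c d j j′ → Nests i i′ j j′
    corner-off₁ = linear (i ∷ i′ ∷ j ∷ j′ ∷ a ∷ b ∷ c ∷ d ∷ []) λ i i′ j j′ a b c d →
      chain a b c d :⇒ corner a b c d i i′ :⇒ sameArc a b c d j j′ :⇒ nests i i′ j j′

    corner-off₂ : Chain a b c d → Corner b c d a i i′ → SameArc a b c d j j′ → Nests i i′ j j′
    corner-off₂ = linear (i ∷ i′ ∷ j ∷ j′ ∷ a ∷ b ∷ c ∷ d ∷ []) λ i i′ j j′ a b c d →
      chain a b c d :⇒ corner b c d a i i′ :⇒ sameArc a b c d j j′ :⇒ nests i i′ j j′

    off-corner₁ : Chain a b c d → SameArc a b c d i i′ → Corner a b c d j j′ → Nests i i′ j j′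
    off-corner₁ = linear (i ∷ i′ ∷ j ∷ j′ ∷ a ∷ b ∷ c ∷ d ∷ []) λ i i′ j j′ a b c d →
      chain a b c d :⇒ sameArc a b c d i i′ :⇒ corner a b c d j j′ :⇒ nests i i′ j j′

    off-corner₂ : Chain a b c d → SameArc a b c d i i′ → Corner b c d a j j′ → Nests i i′ j j′
    off-corner₂ = linear (i ∷ i′ ∷ j ∷ j′ ∷ a ∷ b ∷ c ∷ d ∷ []) λ i i′ j j′ a b c d →
      chain a b c d :⇒ sameArc a b c d i i′ :⇒ corner b c d a j j′ :⇒ nests i i′ j j′

  Sides⇒off : ∀ {N f a b c d} → NC N f → Sides f a b c d ⊎ Sides f b c d a →
              ∀ {x} → Off x a b c d → Off (f x) a b c d
  Sides⇒off R (inj₁ (sides ab ba cd dc)) (p , q , r , s) =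
    q ∘ via ab , p ∘ via ba , s ∘ via cd , r ∘ via dc
    where
    via : ∀ {x y z} → _ ≡ z → _ ≡ y → x ≡ z
    via e e′ = trans (sym (NC.adjoint R e′)) e
  Sides⇒off R (inj₂ (sides bc cb da ad)) (p , q , r , s) =
    s ∘ via ad , r ∘ via bc , q ∘ via cb , p ∘ via da
    where
    via : ∀ {x y z} → _ ≡ z → _ ≡ y → x ≡ z
    via e e′ = trans (sym (NC.adjoint R e′)) e

  Sides⇒Corner : ∀ {f p q r s} → Sides f p q r s → ∀ {x} → x ≡ p ⊎ x ≡ q ⊎ x ≡ r ⊎ x ≡ s →
                 Corner p q r s x (f x)
  Sides⇒Corner (sides p q r s) (inj₁ refl)               = inj₁ (refl , p)
  Sides⇒Corner (sides p q r s) (inj₂ (inj₁ refl))        = inj₂ (inj₁ (refl , q))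
  Sides⇒Corner (sides p q r s) (inj₂ (inj₂ (inj₁ refl))) = inj₂ (inj₂ (inj₁ (refl , r)))
  Sides⇒Corner (sides p q r s) (inj₂ (inj₂ (inj₂ refl))) = inj₂ (inj₂ (inj₂ (refl , s)))

  Sides-inv : ∀ {f p q r s} → Sides f p q r s → ∀ {x y} → Corner p q r s x y → f y ≡ x
  Sides-inv (sides p q r s) (inj₁ (refl , refl))               = q
  Sides-inv (sides p q r s) (inj₂ (inj₁ (refl , refl)))        = p
  Sides-inv (sides p q r s) (inj₂ (inj₂ (inj₁ (refl , refl)))) = s
  Sides-inv (sides p q r s) (inj₂ (inj₂ (inj₂ (refl , refl)))) = r

  rotate-⊎ : ∀ {A B C D : Set} → A ⊎ B ⊎ C ⊎ D → B ⊎ C ⊎ D ⊎ A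
  rotate-⊎ (inj₁ a)               = inj₂ (inj₂ (inj₂ a))
  rotate-⊎ (inj₂ (inj₁ b))        = inj₁ b
  rotate-⊎ (inj₂ (inj₂ (inj₁ c))) = inj₂ (inj₁ c)
  rotate-⊎ (inj₂ (inj₂ (inj₂ d))) = inj₂ (inj₂ (inj₁ d))

  -- Edges away from the corners are those of `f` and stay within one arc, so an edge between
  -- corners cannot cross them. In `build`, `K` stands for either of the two pairings of the
  -- corners.
  flip-NC : ∀ {n f g a b c d} → NC (2 * n) f → Flip n f g a b c d → NC (2 * n) g
  flip-NC {n} {f} {g} {a} {b} {c} {d} R F = result swap
    where
    open NC R
    open Flip F
    ch : Chain a b c d
    ch = a<b , b<c , c<d
    f-off : ∀ {x} → Off x a b c d → Off (f x) a b c d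
    f-off = Sides⇒off R ([ inj₁ ∘ proj₁ , inj₂ ∘ proj₁ ]′ swap)
    arcs : ∀ {x} → Off x a b c d → SameArc a b c d x (g x)
    arcs o = subst (SameArc a b c d _) (sym (same o)) (same-arc R quad o (f-off o))

    build : (K : ℕ → ℕ → Set) → (∀ {x} → x ≡ a ⊎ x ≡ b ⊎ x ≡ c ⊎ x ≡ d → K x (g x)) →
            (∀ {x y} → K x y → g y ≡ x) → (∀ {x y} → K x y → y < 2 * n × y ≢ x) →
            (∀ {i i′ j j′} → K i i′ → K j j′ → Nests i i′ j j′) →
            (∀ {i i′ j j′} → K i i′ → SameArc a b c d j j′ → Nests i i′ j j′) →
            (∀ {i i′ j j′} → SameArc a b c d i i′ → K j j′ → Nests i i′ j j′) →
            NC (2 * n) g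
    build K at-corner K-inv K-ok cc co oc = record
      { inv = inv′ ; dom = dom′ ; nofix = nofix′ ; nest = λ {i} {j} → nest′ i j }
      where
      inv′ : ∀ x → g (g x) ≡ x
      inv′ x with off-or-corner x a b c d
      ... | inj₁ o = trans (cong g (same o)) (trans (same (f-off o)) (inv x))
      ... | inj₂ h = K-inv (at-corner h)
      dom′ : ∀ {x} → x < 2 * n → g x < 2 * n
      dom′ {x} x<N with off-or-corner x a b c d
      ... | inj₁ o = subst (_< 2 * n) (sym (same o)) (dom x<N)
      ... | inj₂ h = proj₁ (K-ok (at-corner h))
      nofix′ : ∀ {x} → x < 2 * n → g x ≢ x
      nofix′ {x} x<N with off-or-corner x a b c d
      ... | inj₁ o = nofix x<N ∘ trans (sym (same o))
      ... | inj₂ h = proj₂ (K-ok (at-corner h))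
      nest′ : ∀ i j → Nests i (g i) j (g j)
      nest′ i j with off-or-corner i a b c d | off-or-corner j a b c d
      ... | inj₁ o | inj₁ o′ = subst₂ (λ y z → Nests i y j z) (sym (same o)) (sym (same o′)) nest
      ... | inj₁ o | inj₂ h  = oc (arcs o) (at-corner h)
      ... | inj₂ h | inj₁ o  = co (at-corner h) (arcs o)
      ... | inj₂ h | inj₂ h′ = cc (at-corner h) (at-corner h′)

    result : (Sides f a b c d × Sides g b c d a) ⊎ (Sides f b c d a × Sides g a b c d) → NC (2 * n) g
    result (inj₁ (_ , S)) = build (Corner b c d a) (Sides⇒Corner S ∘ rotate-⊎) (Sides-inv S)
      (λ {x} {y} → linear (x ∷ y ∷ a ∷ b ∷ c ∷ d ∷ 2 * n ∷ []) (λ x y a b c d N →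
        chain a b c d :⇒ d :< N :⇒ corner b c d a x y :⇒ y :< N :∧ :¬ (y :≡ x)) ch d<N)
      (λ {i} {i′} {j} {j′} → corner-corner₂ a b c d i i′ j j′ ch)
      (λ {i} {i′} {j} {j′} → corner-off₂ a b c d i i′ j j′ ch)
      (λ {i} {i′} {j} {j′} → off-corner₂ a b c d i i′ j j′ ch)
    result (inj₂ (_ , S)) = build (Corner a b c d) (Sides⇒Corner S) (Sides-inv S)
      (λ {x} {y} → linear (x ∷ y ∷ a ∷ b ∷ c ∷ d ∷ 2 * n ∷ []) (λ x y a b c d N →
        chain a b c d :⇒ d :< N :⇒ corner a b c d x y :⇒ y :< N :∧ :¬ (y :≡ x)) ch d<N)
      (λ {i} {i′} {j} {j′} → corner-corner₁ a b c d i i′ j j′ ch)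
      (λ {i} {i′} {j} {j′} → corner-off₁ a b c d i i′ j j′ ch)
      (λ {i} {i′} {j} {j′} → off-corner₁ a b c d i i′ j j′ ch)

  swap-arc : ∀ {a b c d x y} → SameArc a b c d x y → SameArc a b c d y x
  swap-arc (inj₁ (p , q , r , s))               = inj₁ (r , s , p , q)
  swap-arc (inj₂ (inj₁ (p , q , r , s)))        = inj₂ (inj₁ (r , s , p , q))
  swap-arc (inj₂ (inj₂ (inj₁ (p , q , r , s)))) = inj₂ (inj₂ (inj₁ (r , s , p , q)))
  swap-arc (inj₂ (inj₂ (inj₂ (p , q))))         = inj₂ (inj₂ (inj₂ (q , p)))

  module _ (a b c d x y : ℕ) where

    arc-ab : Chain a b c d → SameArc a b c d x y → Btw a b x → Btw a b y
    arc-ab = linear (x ∷ y ∷ a ∷ b ∷ c ∷ d ∷ []) λ x y a b c d →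
      chain a b c d :⇒ sameArc a b c d x y :⇒ btw a b x :⇒ btw a b y

    arc-bc : Chain a b c d → SameArc a b c d x y → Btw b c x → Btw b c y
    arc-bc = linear (x ∷ y ∷ a ∷ b ∷ c ∷ d ∷ []) λ x y a b c d →
      chain a b c d :⇒ sameArc a b c d x y :⇒ btw b c x :⇒ btw b c y

    arc-cd : Chain a b c d → SameArc a b c d x y → Btw c d x → Btw c d y
    arc-cd = linear (x ∷ y ∷ a ∷ b ∷ c ∷ d ∷ []) λ x y a b c d →
      chain a b c d :⇒ sameArc a b c d x y :⇒ btw c d x :⇒ btw c d y

    arc-da : Chain a b c d → SameArc a b c d x y → Btw d a x → Btw d a y
    arc-da = linear (x ∷ y ∷ a ∷ b ∷ c ∷ d ∷ []) λ x y a b c d →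
      chain a b c d :⇒ sameArc a b c d x y :⇒ btw d a x :⇒ btw d a y

  module _ (a b c d x : ℕ) where

    off-ab : Chain a b c d → a < x → x < b → Off x a b c d
    off-ab = linear (a ∷ b ∷ c ∷ d ∷ x ∷ []) λ a b c d x →
      chain a b c d :⇒ a :< x :⇒ x :< b :⇒ off x a b c d

    off-bc : Chain a b c d → b < x → x < c → Off x a b c d
    off-bc = linear (a ∷ b ∷ c ∷ d ∷ x ∷ []) λ a b c d x →
      chain a b c d :⇒ b :< x :⇒ x :< c :⇒ off x a b c d

    off-cd : Chain a b c d → c < x → x < d → Off x a b c d
    off-cd = linear (a ∷ b ∷ c ∷ d ∷ x ∷ []) λ a b c d x →
      chain a b c d :⇒ c :< x :⇒ x :< d :⇒ off x a b c d

  module _ (n : ℕ) where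

    Gaps : (a b c d : ℕ) → Set
    Gaps a b c d = b ≤ a + n × c ≤ b + n × d ≤ c + n × a + n ≤ d

    Centered⇒Gaps : ∀ {a b c d} → Centered n a b c d → Gaps (toℕ a) (toℕ b) (toℕ c) (toℕ d)
    Centered⇒Gaps {a} {b} {c} {d} (ab , bc , cd , da) = add ab , add bc , add cd ,
      -- The truncated difference is treated as a variable `e`, which is pinned down by
      -- `e + d ≡ 2 * n`.
      linear (2 * n ∸ toℕ d ∷ toℕ d ∷ toℕ a ∷ n ∷ [])
        (λ e d a n → e :+ a :≤ n :⇒ e :+ d :≡ 2 :* n :⇒ a :+ n :≤ d) da (m∸n+n≡m (<⇒≤ (toℕ<n d)))
      where
      add : ∀ {m o k} → m ∸ o ≤ k → m ≤ o + k
      add {m} {o} h = ≤-trans (m≤n+m∸n m o) (+-monoʳ-≤ o h)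

    Gaps⇒Centered : ∀ {a b c d} → Gaps (toℕ a) (toℕ b) (toℕ c) (toℕ d) → Centered n a b c d
    Gaps⇒Centered {a} {b} {c} {d} (ab , bc , cd , da) =
      m≤n+o⇒m∸n≤o _ (toℕ a) ab , m≤n+o⇒m∸n≤o _ (toℕ b) bc , m≤n+o⇒m∸n≤o _ (toℕ c) cd ,
      linear (2 * n ∸ toℕ d ∷ toℕ d ∷ toℕ a ∷ n ∷ [])
        (λ e d a n → a :+ n :≤ d :⇒ e :+ d :≡ 2 :* n :⇒ e :+ a :≤ n) da (m∸n+n≡m (<⇒≤ (toℕ<n d)))

  module _ {n : ℕ} {M M′ : PM n} where

    private
      f = val M
      g = val M′

    CenteredFlip⇒Flip : CenteredFlip n M M′ → NC (2 * n) f → NC (2 * n) g → ∃[ a ] ∃[ b ] ∃[ c ] ∃[ d ] Flip n f g a b c d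
    CenteredFlip⇒Flip (a , b , c , d , (a<b , b<c , c<d) , swap , same , empty , cent) R R′ =
      toℕ a , toℕ b , toℕ c , toℕ d , record
        { quad = record
          { a<b = a<b ; b<c = b<c ; c<d = c<d ; d<N = toℕ<n d
          ; ab = λ {x} p q → within a b (λ y → proj₁ ∘ empty y) a<b x (<-trans q (toℕ<n b)) p q
              (off-ab _ _ _ _ _ (a<b , b<c , c<d) p q)
          ; bc = λ {x} p q → within b c (λ y → proj₁ ∘ proj₂ ∘ empty y) b<c x (<-trans q (toℕ<n c)) p q
              (off-bc _ _ _ _ _ (a<b , b<c , c<d) p q)
          ; cd = λ {x} p q → within c d (λ y → proj₁ ∘ proj₂ ∘ proj₂ ∘ empty y) c<d x (<-trans q (toℕ<n d)) p q
              (off-cd _ _ _ _ _ (a<b , b<c , c<d) p q)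
          }
        ; swap = swap′ swap
        ; same = same′
        ; ab≤ = proj₁ gaps
        ; bc≤ = proj₁ (proj₂ gaps)
        ; cd≤ = proj₁ (proj₂ (proj₂ gaps))
        ; da≤ = proj₂ (proj₂ (proj₂ gaps))
        }
      where
      gaps : Gaps n (toℕ a) (toℕ b) (toℕ c) (toℕ d)
      gaps = Centered⇒Gaps n {a} {b} {c} {d} cent
      notCorner : ∀ {x : Pt n} → Off (toℕ x) (toℕ a) (toℕ b) (toℕ c) (toℕ d) → NotCorner n x a b c d
      notCorner (p , q , r , s) = p ∘ cong toℕ , q ∘ cong toℕ , r ∘ cong toℕ , s ∘ cong toℕ
      within : ∀ (p q : Pt n) → (∀ x → NotCorner n x a b c d → ¬ Cross n p q x (lookup M x)) → toℕ p < toℕ q →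
               ∀ x → x < 2 * n → toℕ p < x → x < toℕ q → Off x (toℕ a) (toℕ b) (toℕ c) (toℕ d) →
               toℕ p < f x × f x < toℕ q
      within p q h p<q x x<N p<x x<q o with point x<N
      ... | pt y with ¬cross⇒ {n} {p} {q} (h y (notCorner o)) (inj₁ (p<x , x<q))
      ...   | inj₁ r       = subst (λ z → toℕ p < z × z < toℕ q) (sym (val-toℕ M y)) r
      ...   | inj₂ (r , s) = ⊥-elim (<-asym p<q (<-trans r s))
      swap′ : SwapABCD n M M′ a b c d ⊎ SwapDABC n M M′ a b c d →
              (Sides f (toℕ a) (toℕ b) (toℕ c) (toℕ d) × Sides g (toℕ b) (toℕ c) (toℕ d) (toℕ a)) ⊎
              (Sides f (toℕ b) (toℕ c) (toℕ d) (toℕ a) × Sides g (toℕ a) (toℕ b) (toℕ c) (toℕ d))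
      swap′ (inj₁ (ab , cd , bc , cb , da , ad)) = inj₁
        ( sides (lookup⇒val M ab) (NC.adjoint R (lookup⇒val M ab)) (lookup⇒val M cd) (NC.adjoint R (lookup⇒val M cd))
        , sides (lookup⇒val M′ bc) (lookup⇒val M′ cb) (lookup⇒val M′ da) (lookup⇒val M′ ad) )
      swap′ (inj₂ (bc , da , ab , ba , cd , dc)) = inj₂
        ( sides (lookup⇒val M bc) (NC.adjoint R (lookup⇒val M bc)) (lookup⇒val M da) (NC.adjoint R (lookup⇒val M da))
        , sides (lookup⇒val M′ ab) (lookup⇒val M′ ba) (lookup⇒val M′ cd) (lookup⇒val M′ dc) )
      same′ : ∀ {x} → Off x (toℕ a) (toℕ b) (toℕ c) (toℕ d) → g x ≡ f x
      same′ {x} o with x <? 2 * n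
      ... | no ¬p = trans (val-out M′ (≮⇒≥ ¬p)) (sym (val-out M (≮⇒≥ ¬p)))
      ... | yes p with point p
      ...   | pt y = trans (lookup⇒val M′ (same y (notCorner o))) (sym (val-toℕ M y))

    Flip⇒CenteredFlip : ∀ {a b c d} → NC (2 * n) f → Flip n f g a b c d → CenteredFlip n M M′
    Flip⇒CenteredFlip {a} {b} {c} {d} R F = let open Flip F in
      go (point (<-trans a<b (<-trans b<c (<-trans c<d d<N)))) (point (<-trans b<c (<-trans c<d d<N))) (point (<-trans c<d d<N)) (point d<N) F
      where
      go : ∀ {a b c d} → Point {2 * n} a → Point {2 * n} b → Point {2 * n} c → Point {2 * n} d → Flip n f g a b c d → CenteredFlip n M M′
      go (pt a) (pt b) (pt c) (pt d) F = a , b , c , d , (a<b , b<c , c<d) , swap′ swap ,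
        (λ x o → val⇒lookup M′ (trans (same (toOff o)) (val-toℕ M x))) ,
        (λ x o → let arcs = subst (SameArc _ _ _ _ _) (val-toℕ M x) (same-arc R quad (toOff o) (f-off (toOff o)))
                     arcs′ = swap-arc arcs in
          ⇒¬cross {n} {a} {b} (arc-ab _ _ _ _ _ _ ch arcs) (arc-ab _ _ _ _ _ _ ch arcs′) ,
          ⇒¬cross {n} {b} {c} (arc-bc _ _ _ _ _ _ ch arcs) (arc-bc _ _ _ _ _ _ ch arcs′) ,
          ⇒¬cross {n} {c} {d} (arc-cd _ _ _ _ _ _ ch arcs) (arc-cd _ _ _ _ _ _ ch arcs′) ,
          ⇒¬cross {n} {d} {a} (arc-da _ _ _ _ _ _ ch arcs) (arc-da _ _ _ _ _ _ ch arcs′)) ,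
        Gaps⇒Centered n {a} {b} {c} {d} (ab≤ , bc≤ , cd≤ , da≤)
        where
        open Flip F
        ch : Chain (toℕ a) (toℕ b) (toℕ c) (toℕ d)
        ch = a<b , b<c , c<d
        f-off : ∀ {x} → Off x (toℕ a) (toℕ b) (toℕ c) (toℕ d) → Off (f x) (toℕ a) (toℕ b) (toℕ c) (toℕ d)
        f-off = Sides⇒off R ([ inj₁ ∘ proj₁ , inj₂ ∘ proj₁ ]′ swap)
        toOff : ∀ {x : Pt n} → NotCorner n x a b c d → Off (toℕ x) (toℕ a) (toℕ b) (toℕ c) (toℕ d)
        toOff (p , q , r , s) = p ∘ toℕ-injective , q ∘ toℕ-injective , r ∘ toℕ-injective , s ∘ toℕ-injective
        swap′ : (Sides f (toℕ a) (toℕ b) (toℕ c) (toℕ d) × Sides g (toℕ b) (toℕ c) (toℕ d) (toℕ a)) ⊎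
                (Sides f (toℕ b) (toℕ c) (toℕ d) (toℕ a) × Sides g (toℕ a) (toℕ b) (toℕ c) (toℕ d)) →
                SwapABCD n M M′ a b c d ⊎ SwapDABC n M M′ a b c d
        swap′ (inj₁ (sides ab ba cd dc , sides p q r s)) = inj₁
          (val⇒lookup M ab , val⇒lookup M cd , val⇒lookup M′ p , val⇒lookup M′ q , val⇒lookup M′ r , val⇒lookup M′ s)
        swap′ (inj₂ (sides bc cb da ad , sides p q r s)) = inj₂
          (val⇒lookup M bc , val⇒lookup M da , val⇒lookup M′ p , val⇒lookup M′ q , val⇒lookup M′ r , val⇒lookup M′ s)

open Flips

-- Neighbours obtained from explicit flips

module Neighbours where

  open import Data.Fin using (toℕ)
  open import Data.List using ([]; _∷_)
  open import Data.List.Relation.Unary.All using ([]; _∷_)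
  open import Data.List.Relation.Unary.AllPairs using ([]; _∷_)
  open import Data.Vec using (lookup)
  open import Relation.Nullary.Decidable using (_×-dec_)

  recouple : (p q r s : ℕ) → (ℕ → ℕ) → ℕ → ℕ
  recouple p q r s f x with x ≟ p | x ≟ q | x ≟ r | x ≟ s
  ... | yes _ | _     | _     | _     = q
  ... | no  _ | yes _ | _     | _     = p
  ... | no  _ | no  _ | yes _ | _     = s
  ... | no  _ | no  _ | no  _ | yes _ = r
  ... | no  _ | no  _ | no  _ | no  _ = f x

  recouple-off : ∀ {p q r s f x} → Off x p q r s → recouple p q r s f x ≡ f x
  recouple-off {p} {q} {r} {s} {f} {x} (a , b , c , d) with x ≟ p | x ≟ q | x ≟ r | x ≟ s
  ... | yes e | _     | _     | _     = ⊥-elim (a e)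
  ... | no  _ | yes e | _     | _     = ⊥-elim (b e)
  ... | no  _ | no  _ | yes e | _     = ⊥-elim (c e)
  ... | no  _ | no  _ | no  _ | yes e = ⊥-elim (d e)
  ... | no  _ | no  _ | no  _ | no  _ = refl

  recouple-sides : ∀ {p q r s f} → p ≢ q → p ≢ r → p ≢ s → q ≢ r → q ≢ s → r ≢ s →
                   Sides (recouple p q r s f) p q r s
  recouple-sides {p} {q} {r} {s} {f} pq pr ps qr qs rs = sides at-p at-q at-r at-s
    where
    at-p : recouple p q r s f p ≡ q
    at-p with p ≟ p
    ... | yes _ = refl
    ... | no ¬e = ⊥-elim (¬e refl)
    at-q : recouple p q r s f q ≡ p
    at-q with q ≟ p | q ≟ q
    ... | yes e | _     = e
    ... | no _  | yes _ = refl
    ... | no _  | no ¬e = ⊥-elim (¬e refl)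
    at-r : recouple p q r s f r ≡ s
    at-r with r ≟ p | r ≟ q | r ≟ r
    ... | yes e | _     | _     = ⊥-elim (pr (sym e))
    ... | no _  | yes e | _     = ⊥-elim (qr (sym e))
    ... | no _  | no _  | yes _ = refl
    ... | no _  | no _  | no ¬e = ⊥-elim (¬e refl)
    at-s : recouple p q r s f s ≡ r
    at-s with s ≟ p | s ≟ q | s ≟ r | s ≟ s
    ... | yes e | _     | _     | _     = ⊥-elim (ps (sym e))
    ... | no _  | yes e | _     | _     = ⊥-elim (qs (sym e))
    ... | no _  | no _  | yes e | _     = e
    ... | no _  | no _  | no _  | yes _ = refl
    ... | no _  | no _  | no _  | no ¬e = ⊥-elim (¬e refl)

  Sides-cong : ∀ {f g p q r s} → (∀ x → f x ≡ g x) → Sides f p q r s → Sides g p q r s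
  Sides-cong h (sides p q r s) =
    sides (trans (sym (h _)) p) (trans (sym (h _)) q) (trans (sym (h _)) r) (trans (sym (h _)) s)

  -- The corners are kept as indices because neighbours are told apart by them.
  record Neighbour (n : ℕ) (M : PM n) (a b c d : ℕ) : Set where
    field
      {to}     : PM n
      adjacent : Adj n M to
      flip     : Flip n (val M) (val to) a b c d
    open Flip flip public

  module _ {n : ℕ} where

    neighbour : ∀ {M a b c d} → IsNCM n M → Quad (2 * n) (val M) a b c d →
                Sides (val M) a b c d ⊎ Sides (val M) b c d a →
                b ≤ a + n → c ≤ b + n → d ≤ c + n → a + n ≤ d → Neighbour n M a b c d
    neighbour {M} {a} {b} {c} {d} ncm Q S ab≤ bc≤ cd≤ da≤ = go S
      where
      f = val M
      R = IsNCM⇒NC {n} {M} ncm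
      open Quad Q
      build : ∀ {g} → (Sides f a b c d × Sides g b c d a) ⊎ (Sides f b c d a × Sides g a b c d) →
              (∀ {x} → Off x a b c d → g x ≡ f x) → Neighbour n M a b c d
      build {g} swap same = record { to = M′ ; adjacent = NC⇒IsNCM {n} {M′} (flip-NC R F′) , inj₁ (Flip⇒CenteredFlip {n} {M} {M′} R F′) ; flip = F′ }
        where
        F : Flip n f g a b c d
        F = record { quad = Q ; swap = swap ; same = same ; ab≤ = ab≤ ; bc≤ = bc≤ ; cd≤ = cd≤ ; da≤ = da≤ }
        R′ = flip-NC R F
        M′ : PM n
        M′ = fromFun g (NC.dom R′)
        g≗ : ∀ x → g x ≡ val M′ x
        g≗ x with x <? 2 * n
        ... | yes p = sym (val-fromFun g (NC.dom R′) p)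
        -- Beyond the last point `f` and `val M′` are the identity, and `g` agrees with `f` there
        -- since all corners are smaller.
        ... | no ¬p = trans (same o) (trans (val-out M (≮⇒≥ ¬p)) (sym (val-out M′ (≮⇒≥ ¬p))))
          where
          o : Off x a b c d
          o = linear (x ∷ a ∷ b ∷ c ∷ d ∷ 2 * n ∷ []) (λ x a b c d N →
                chain a b c d :⇒ d :< N :⇒ N :≤ x :⇒
                :¬ (x :≡ a) :∧ :¬ (x :≡ b) :∧ :¬ (x :≡ c) :∧ :¬ (x :≡ d)) (a<b , b<c , c<d) d<N (≮⇒≥ ¬p)
        F′ : Flip n f (val M′) a b c d
        F′ = record
          { quad = Q
          ; swap = [ (λ (s , t) → inj₁ (s , Sides-cong g≗ t)) , (λ (s , t) → inj₂ (s , Sides-cong g≗ t)) ]′ swap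
          ; same = λ o → trans (sym (g≗ _)) (same o)
          ; ab≤ = ab≤ ; bc≤ = bc≤ ; cd≤ = cd≤ ; da≤ = da≤ }
      a≢b = <⇒≢ a<b
      b≢c = <⇒≢ b<c
      c≢d = <⇒≢ c<d
      a≢c = <⇒≢ (<-trans a<b b<c)
      b≢d = <⇒≢ (<-trans b<c c<d)
      a≢d = <⇒≢ (<-trans a<b (<-trans b<c c<d))
      go : Sides f a b c d ⊎ Sides f b c d a → Neighbour n M a b c d
      go (inj₁ s) = build {recouple b c d a f}
        (inj₁ (s , recouple-sides b≢c b≢d (a≢b ∘ sym) c≢d (a≢c ∘ sym) (a≢d ∘ sym)))
        (λ (p , q , r , s) → recouple-off (q , r , s , p))
      go (inj₂ s) = build {recouple a b c d f}
        (inj₂ (s , recouple-sides a≢b a≢c a≢d b≢c b≢d c≢d)) recouple-off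

    Adj⇒Flip : ∀ {M M′} → IsNCM n M → Adj n M M′ → ∃[ a ] ∃[ b ] ∃[ c ] ∃[ d ] Flip n (val M) (val M′) a b c d
    Adj⇒Flip {M} {M′} ncm (ncm′ , inj₁ F) =
      CenteredFlip⇒Flip {n} {M} {M′} F (IsNCM⇒NC {n} {M} ncm) (IsNCM⇒NC {n} {M′} ncm′)
    Adj⇒Flip {M} {M′} ncm (ncm′ , inj₂ F) =
      let a , b , c , d , F′ = CenteredFlip⇒Flip {n} {M′} {M} F (IsNCM⇒NC {n} {M′} ncm′) (IsNCM⇒NC {n} {M} ncm)
      in a , b , c , d , flip-sym F′

    -- The partner of a corner changes from one adjacent corner to the other, and these differ
    -- because `b ≢ d` and `a ≢ c`.
    flip-moves : ∀ {f g a b c d z} → Flip n f g a b c d → z ≡ a ⊎ z ≡ b ⊎ z ≡ c ⊎ z ≡ d → g z ≢ f z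
    flip-moves {f} {g} {a} {b} {c} {d} F h eq = go (Flip.swap F) h
      where
      open Flip F using (a<b; b<c; c<d)
      a≢c = <⇒≢ (<-trans a<b b<c)
      b≢d = <⇒≢ (<-trans b<c c<d)
      go : (Sides f a b c d × Sides g b c d a) ⊎ (Sides f b c d a × Sides g a b c d) →
           _ ≡ a ⊎ _ ≡ b ⊎ _ ≡ c ⊎ _ ≡ d → ⊥
      go (inj₁ (sides p q r s , sides i j k l)) (inj₁ refl)               = b≢d (trans (sym p) (trans (sym eq) l))
      go (inj₁ (sides p q r s , sides i j k l)) (inj₂ (inj₁ refl))        = a≢c (trans (sym q) (trans (sym eq) i))
      go (inj₁ (sides p q r s , sides i j k l)) (inj₂ (inj₂ (inj₁ refl))) = b≢d (trans (sym j) (trans eq r))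
      go (inj₁ (sides p q r s , sides i j k l)) (inj₂ (inj₂ (inj₂ refl))) = a≢c (trans (sym k) (trans eq s))
      go (inj₂ (sides p q r s , sides i j k l)) (inj₁ refl)               = b≢d (trans (sym i) (trans eq s))
      go (inj₂ (sides p q r s , sides i j k l)) (inj₂ (inj₁ refl))        = a≢c (trans (sym j) (trans eq p))
      go (inj₂ (sides p q r s , sides i j k l)) (inj₂ (inj₂ (inj₁ refl))) = b≢d (trans (sym q) (trans (sym eq) k))
      go (inj₂ (sides p q r s , sides i j k l)) (inj₂ (inj₂ (inj₂ refl))) = a≢c (trans (sym r) (trans (sym eq) l))

    -- The old edges decide the pairing at the corners, since `f a` cannot be both `b` and `d`;
    -- elsewhere nothing changes.
    flip-unique : ∀ {M M₁ M₂ : PM n} {a b c d} → Flip n (val M) (val M₁) a b c d → Flip n (val M) (val M₂) a b c d → M₁ ≡ M₂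
    flip-unique {M} {M₁} {M₂} {a} {b} {c} {d} F G = val-ext λ {x} _ → go x
      where
      open Flip F using (a<b; b<c; c<d)
      agree : ∀ {g g′ p q r s} → Sides g p q r s → Sides g′ p q r s → ∀ {x} → x ≡ p ⊎ x ≡ q ⊎ x ≡ r ⊎ x ≡ s → g x ≡ g′ x
      agree (sides p q r s) (sides p′ q′ r′ s′) (inj₁ refl)               = trans p (sym p′)
      agree (sides p q r s) (sides p′ q′ r′ s′) (inj₂ (inj₁ refl))        = trans q (sym q′)
      agree (sides p q r s) (sides p′ q′ r′ s′) (inj₂ (inj₂ (inj₁ refl))) = trans r (sym r′)
      agree (sides p q r s) (sides p′ q′ r′ s′) (inj₂ (inj₂ (inj₂ refl))) = trans s (sym s′)
      clash : Sides (val M) a b c d → Sides (val M) b c d a → ⊥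
      clash (sides ab _ _ _) (sides _ _ _ ad) = <⇒≢ (<-trans b<c c<d) (trans (sym ab) ad)
      go : ∀ x → val M₁ x ≡ val M₂ x
      go x with off-or-corner x a b c d | Flip.swap F | Flip.swap G
      ... | inj₁ o | _            | _              = trans (Flip.same F o) (sym (Flip.same G o))
      ... | inj₂ h | inj₁ (s , t) | inj₁ (s′ , t′) = agree t t′ (rotate-⊎ h)
      ... | inj₂ h | inj₂ (s , t) | inj₂ (s′ , t′) = agree t t′ h
      ... | inj₂ h | inj₁ (s , t) | inj₂ (s′ , t′) = ⊥-elim (clash s s′)
      ... | inj₂ h | inj₂ (s , t) | inj₁ (s′ , t′) = ⊥-elim (clash s′ s)

    open Neighbour using (to; adjacent; flip; same)

    -- The point `z` changes its partner under one flip and keeps it under the other. This reduces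
    -- distinctness of matchings to order facts about corners.
    distinct : ∀ {M a b c d p q r s} (X : Neighbour n M a b c d) (Y : Neighbour n M p q r s) z →
               z ≡ a ⊎ z ≡ b ⊎ z ≡ c ⊎ z ≡ d → Off z p q r s → to X ≢ to Y
    distinct X Y z h o eq = flip-moves (flip X) h
      (trans (cong (λ M → val M z) eq) (same Y o))

    two : ∀ {M a b c d p q r s} (X : Neighbour n M a b c d) (Y : Neighbour n M p q r s) →
          to X ≢ to Y → AtLeast (Adj n M) 2
    two X Y x≢y = to X ∷ to Y ∷ [] , (x≢y ∷ []) ∷ [] ∷ [] , refl ,
      adjacent X ∷ adjacent Y ∷ []

    three : ∀ {M a b c d p q r s i j k l} (X : Neighbour n M a b c d) (Y : Neighbour n M p q r s)
            (Z : Neighbour n M i j k l) →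
            to X ≢ to Y → to X ≢ to Z → to Y ≢ to Z → AtLeast (Adj n M) 3
    three X Y Z xy xz yz = to X ∷ to Y ∷ to Z ∷ [] ,
      (xy ∷ xz ∷ []) ∷ (yz ∷ []) ∷ [] ∷ [] , refl ,
      adjacent X ∷ adjacent Y ∷ adjacent Z ∷ []

  -- Blocks: the boundary of the outer face

  module _ {N : ℕ} {f : ℕ → ℕ} (R : NC N f) where
    open NC R

    -- Equivalently, no edge separates the gap before `s` from the origin, so that this gap lies on
    -- the outer face.
    Closed : ℕ → Set
    Closed s = ∀ {x} → x < s → f x < s

    -- An edge on the boundary of the outer face: a closed prefix ends at its left end, so no edge
    -- encloses it.
    record Top (a b : ℕ) : Set where
      field
        partner : f a ≡ b
        a<b     : a < b
        b<N     : b < N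
        closed  : Closed a

      closed⁺ : Closed (suc b)
      closed⁺ {x} (s≤s x≤b) with <-cmp x a
      ... | tri< x<a _ _ = <-trans (closed x<a) (<-trans a<b ≤-refl)
      ... | tri≈ _ refl _ = s≤s (≤-reflexive partner)
      ... | tri> _ _ a<x with m≤n⇒m<n∨m≡n x≤b
      ...   | inj₁ x<b  = <-trans (proj₂ (nest a<x (subst (x <_) (sym partner) x<b))) (s≤s (≤-reflexive partner))
      ...   | inj₂ refl = subst (_< suc x) (sym (adjoint partner)) (<-trans a<x ≤-refl)

    record Block (x : ℕ) : Set where
      field
        {a} {b} : ℕ
        top     : Top a b
        a≤x     : a ≤ x
        x≤b     : x ≤ b
      open Top top public

    top-< : ∀ {a b c d} → Top a b → Top c d → a < c → b < c
    top-< t u a<c = subst (_< _) (Top.partner t) (Top.closed u a<c)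

    top-inside : ∀ {a b} → Top a b → ∀ {x} → a < x → x < b → a < f x × f x < b
    top-inside t p q = subst (λ z → _ < f _ × f _ < z) (Top.partner t)
      (nest p (subst (_ <_) (sym (Top.partner t)) q))

    -- Between the two blocks a partner cannot fall back to `b` or below, because `[0 , b]` is
    -- closed, nor reach `c`, because `[0 , c)` is.
    top-quad : ∀ {a b c d} → Top a b → Top c d → b < c → Quad (N) f a b c d
    top-quad t u b<c = record
      { a<b = Top.a<b t ; b<c = b<c ; c<d = Top.a<b u ; d<N = Top.b<N u
      ; ab = top-inside t
      ; bc = λ {x} p q → ≰⇒> (λ fx≤b → <⇒≱ p (≤-pred (subst (_< _) (inv x) (Top.closed⁺ t (s≤s fx≤b))))) , Top.closed u q
      ; cd = top-inside u }

    top-sides : ∀ {a b c d} → Top a b → Top c d → Sides f a b c d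
    top-sides t u = sides (Top.partner t) (adjoint (Top.partner t)) (Top.partner u) (adjoint (Top.partner u))

    closed⇒top : ∀ {s} → s < N → Closed s → Top s (f s)
    closed⇒top {s} s<N cl = record
      { partner = refl ; closed = cl ; b<N = dom s<N
      ; a<b = ≤∧≢⇒< (≮⇒≥ λ fs<s → <-irrefl (inv s) (cl fs<s)) (nofix s<N ∘ sym) }

    private
      block′ : ∀ {x} → x < N → Block x
      block′ {x} x<N = go x 0 (λ ()) z≤n ≤-refl
        where
        -- A walk from block to block; `k` is fuel that bounds the distance left from `s` to `x`.
        go : ∀ k s → Closed s → s ≤ x → x ≤ s + k → Block x
        go k s cl s≤x x≤s+k with closed⇒top (≤-<-trans s≤x x<N) cl | x ≤? f s
        ... | t | yes x≤b = record { top = t ; a≤x = s≤x ; x≤b = x≤b }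
        go zero s cl s≤x x≤s+k | t | no x≰b = ⊥-elim (linear (s ∷ f s ∷ x ∷ [])
          (λ s b x → s :< b :⇒ :¬ (x :≤ b) :⇒ x :≤ s :+ con 0 :⇒ :⊥) (Top.a<b t) x≰b x≤s+k)
        go (suc k) s cl s≤x x≤s+k | t | no x≰b = go k (suc (f s)) (Top.closed⁺ t) (≰⇒> x≰b)
          (linear (s ∷ f s ∷ x ∷ k ∷ []) (λ s b x k → s :< b :⇒ x :≤ s :+ (1+ k) :⇒ x :≤ 1+ b :+ k)
            (Top.a<b t) x≤s+k)

    opaque
      block : ∀ {x} → x < N → Block x
      block = block′

    -- A closed prefix cannot cut a block: if it contained `a`, it would contain `b`.
    last-block : ∀ {a b} → Top a b → ∀ {c} → Closed c → c ≤ b → c ≤ a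
    last-block t cl c≤b = ≮⇒≥ λ a<c → <⇒≱ (subst (_< _) (Top.partner t) (cl a<c)) c≤b

  module _ {n : ℕ} where

    -- A closed prefix is a union of edges, and each edge has exactly one smaller end.
    even : ∀ {M s} (ncm : IsNCM n M) → Closed (IsNCM⇒NC {n} {M} ncm) s → s ≤ 2 * n → ∃[ h ] s ≡ 2 * h
    even {M} {s} ncm cl s≤N = # R? , sym (trans
      (#-matched (below s) R? (lookup M) (proj₁ ∘ proj₁ ncm) (proj₂ ∘ proj₁ ncm)
        (λ {x} p → subst (_< s) (val-toℕ M x) (cl p)) _,_ id)
      (#-below s s≤N))
      where
      R? = λ (x : Pt n) → (toℕ x <? toℕ (lookup M x)) ×-dec below s x

    module Central {M : PM n} (ncm : IsNCM n M) where
      R = IsNCM⇒NC {n} {M} ncm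
      open NC R

      -- The centre lies strictly inside the outer face: it is on the outer side of every boundary
      -- edge, and none of them is a diameter.
      Short : Set
      Short = ∀ {a b} → Top R a b → b < a + n

      -- The convex hull of two edges contains the centre if a diameter meets both of them.
      diameter-flip : Short → ∀ {x y} → y ≡ x + n → x < n → (B : Block R x) (C : Block R y) →
                      Neighbour n M (Block.a B) (Block.b B) (Block.a C) (Block.b C)
      diameter-flip short {x} refl x<n B C =
        neighbour {n} {M} ncm (top-quad R B.top C.top b<c) (inj₁ (top-sides R B.top C.top))
          (<⇒≤ (short B.top))
          (linear (B.b ∷ C.a ∷ x ∷ n ∷ []) (λ b c x n → x :≤ b :⇒ c :≤ x :+ n :⇒ c :≤ b :+ n) B.x≤b C.a≤x)
          (<⇒≤ (short C.top))
          (linear (B.a ∷ C.b ∷ x ∷ n ∷ []) (λ a d x n → a :≤ x :⇒ x :+ n :≤ d :⇒ a :+ n :≤ d) B.a≤x C.x≤b)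
        where
        module B = Block B
        module C = Block C
        -- A short block cannot contain both `x` and `x + n`, so the two blocks differ.
        b<c : B.b < C.a
        b<c with <-cmp B.a C.a
        ... | tri< p _ _ = top-< R B.top C.top p
        ... | tri≈ _ p _ = ⊥-elim (linear (B.a ∷ B.b ∷ C.a ∷ C.b ∷ x ∷ n ∷ []) (λ a b c d x n →
                a :≡ c :⇒ a :≤ x :⇒ x :+ n :≤ d :⇒ d :< c :+ n :⇒ :⊥) p B.a≤x C.x≤b (short C.top))
        ... | tri> _ _ p = ⊥-elim (linear (B.a ∷ B.b ∷ C.a ∷ C.b ∷ x ∷ n ∷ []) (λ a b c d x n →
                a :≤ x :⇒ x :+ n :≤ d :⇒ d :< a :⇒ :⊥) B.a≤x C.x≤b (top-< R C.top B.top p))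

open Neighbours

-- Lower bounds for the degree

module LowerBounds where

  1+2*≢2* : ∀ i j → suc (2 * i) ≢ 2 * j
  1+2*≢2* zero    (suc j) eq with () ← trans eq (*-suc 2 j)
  1+2*≢2* (suc i) (suc j) eq = 1+2*≢2* i j (suc-injective (suc-injective
    (trans (cong suc (sym (*-suc 2 i))) (trans eq (*-suc 2 j)))))

  -- Standard positions: the edges `{0 , n - 1}` and `{n , 2n - 1}`, respectively the diameter
  -- `{0 , n}` with the edges `{1 , n - 1}` and `{n + 1 , 2n - 1}`. Written with `suc` to avoid
  -- subtraction.
  EvenBase OddBase : ℕ → (ℕ → ℕ) → Set
  EvenBase n f = suc (f 0) ≡ n × suc (f n) ≡ 2 * n
  OddBase  n f = f 0 ≡ n × suc (f 1) ≡ n × suc (f (suc n)) ≡ 2 * n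

  module _ {n : ℕ} {M : PM n} (ncm : IsNCM n M) where
    open Central {n} {M} ncm
    open NC R

    private
      f = val M

    short-odd : ∀ k → n ≡ suc (2 * k) → 1 ≤ k → Short → AtLeast (Adj n M) 3
    -- `0` is a corner of `F₁` but not of `F₂`, and `J.a` is a corner of both but not of `F₃`.
    short-odd k eq 1≤k short = three F₁ F₂ F₃
      (distinct F₁ F₂ 0 (inj₁ (sym B₀a≡0)) off₁₂)
      (distinct F₁ F₃ J.a (inj₂ (inj₂ (inj₁ refl))) off₃)
      (distinct F₂ F₃ J.a (inj₁ refl) off₃)
      where
      m = 2 * k
      B₀ : Block R 0
      B₀ = block R (linear (n ∷ m ∷ []) (λ n m → n :≡ 1+ m :⇒ con 0 :< 2 :* n) eq)
      J : Block R n
      J = block R (linear (n ∷ m ∷ []) (λ n m → n :≡ 1+ m :⇒ n :< 2 :* n) eq)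
      K : Block R (m + n)
      K = block R (linear (n ∷ m ∷ []) (λ n m → n :≡ 1+ m :⇒ m :+ n :< 2 :* n) eq)
      module B₀ = Block B₀
      module J = Block J
      module K = Block K
      B₀a≡0 : B₀.a ≡ 0
      B₀a≡0 = n≤0⇒n≡0 B₀.a≤x
      1≤J : 1 ≤ J.a
      1≤J = linear (n ∷ J.a ∷ J.b ∷ []) (λ n a b → n :≤ b :⇒ b :< a :+ n :⇒ con 1 :≤ a) J.x≤b (short J.top)
      -- Parity enters here: `J` starts at an even position and `n` is odd, so `J` also contains
      -- `n - 1` and meets the diameter `{n - 1 , 2n - 1}` as well.
      J≢n : J.a ≢ n
      J≢n p = let h , q = even {n} {M} ncm J.closed (≤-trans J.a≤x (m≤m+n n _)) in
        1+2*≢2* k h (trans (sym eq) (trans (sym p) q))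
      J′ : Block R m
      J′ = record
        { top = J.top
        ; a≤x = linear (n ∷ m ∷ J.a ∷ []) (λ n m a → n :≡ 1+ m :⇒ a :≤ n :⇒ :¬ (a :≡ n) :⇒ a :≤ m) eq J.a≤x J≢n
        ; x≤b = linear (n ∷ m ∷ J.b ∷ []) (λ n m b → n :≡ 1+ m :⇒ n :≤ b :⇒ m :≤ b) eq J.x≤b }
      -- The last point before `J`: one end of its diameter avoids `J` by choice, the other by
      -- parity.
      x = J.a ∸ 1
      J≡ : J.a ≡ suc x
      J≡ = sym (m+[n∸m]≡n 1≤J)
      x<n : x < n
      x<n = subst (_≤ n) J≡ J.a≤x
      P : Block R x
      P = block R (linear (x ∷ n ∷ []) (λ x n → x :< n :⇒ x :< 2 :* n) x<n)
      Q : Block R (x + n)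
      Q = block R (linear (x ∷ n ∷ []) (λ x n → x :< n :⇒ x :+ n :< 2 :* n) x<n)
      module P = Block P
      module Q = Block Q
      F₁ : Neighbour n M B₀.a B₀.b J.a J.b
      F₁ = diameter-flip short refl (subst (0 <_) (sym eq) (s≤s z≤n)) B₀ J
      F₂ : Neighbour n M J.a J.b K.a K.b
      F₂ = diameter-flip short refl (subst (m <_) (sym eq) ≤-refl) J′ K
      F₃ : Neighbour n M P.a P.b Q.a Q.b
      F₃ = diameter-flip short refl x<n P Q
      off₁₂ : Off 0 J.a J.b K.a K.b
      off₁₂ = linear (J.a ∷ J.b ∷ K.a ∷ K.b ∷ m ∷ n ∷ []) (λ a b c d m n →
        con 1 :≤ a :⇒ a :< b :⇒ m :+ n :≤ d :⇒ d :< c :+ n :⇒ c :< d :⇒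
        :¬ (con 0 :≡ a) :∧ :¬ (con 0 :≡ b) :∧ :¬ (con 0 :≡ c) :∧ :¬ (con 0 :≡ d))
        1≤J J.a<b K.x≤b (short K.top) K.a<b
      P<J : P.b < J.a
      P<J = top-< R P.top J.top (subst (P.a <_) (sym J≡) (s≤s P.a≤x))
      -- If `J` contained `x + n`, shortness would make it end there. It would then have exactly `n`
      -- points, an odd number, although the prefixes before and through it are both even.
      Q≢J : Q.a ≢ J.a
      Q≢J p = let h , q = even {n} {M} ncm J.closed (≤-trans J.a≤x (m≤m+n n _)); h′ , q′ = even {n} {M} ncm Q.closed⁺ Q.b<N in
        1+2*≢2* (h + k) h′ (linear (Q.a ∷ Q.b ∷ J.a ∷ x ∷ n ∷ k ∷ h ∷ h′ ∷ [])
        (λ Qa Qb Ja x n k h h′ → Qa :≡ Ja :⇒ Ja :≡ 1+ x :⇒ n :≡ 1+ 2 :* k :⇒ x :+ n :≤ Qb :⇒ Qb :< Qa :+ n :⇒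
          Ja :≡ 2 :* h :⇒ 1+ Qb :≡ 2 :* h′ :⇒ 1+ 2 :* (h :+ k) :≡ 2 :* h′)
        p J≡ eq Q.x≤b (short Q.top) q q′)
      off₃ : Off J.a P.a P.b Q.a Q.b
      off₃ =
        <⇒≢ (<-trans P.a<b P<J) ∘ sym , <⇒≢ P<J ∘ sym , Q≢J ∘ sym ,
        linear (J.a ∷ Q.b ∷ x ∷ n ∷ k ∷ []) (λ a d x n k → a :≡ 1+ x :⇒ n :≡ 1+ 2 :* k :⇒ con 1 :≤ k :⇒
          x :+ n :≤ d :⇒ :¬ (a :≡ d)) J≡ eq 1≤k Q.x≤b

    -- If there are only two blocks, shortness leaves `n` as the size of each. A third block lies
    -- between the blocks of `0` and `n` or behind the latter, and the diameter through its first
    -- point gives a flip with a new corner.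
    short-even : 1 ≤ n → Short → AtLeast (Adj n M) 2 ⊎ EvenBase n f
    short-even 1≤n short = go (suc B₀.b <? J.a) (suc J.b <? 2 * n)
      where
      B₀ : Block R 0
      B₀ = block R (linear (n ∷ []) (λ n → con 1 :≤ n :⇒ con 0 :< 2 :* n) 1≤n)
      J : Block R n
      J = block R (linear (n ∷ []) (λ n → con 1 :≤ n :⇒ n :< 2 :* n) 1≤n)
      module B₀ = Block B₀
      module J = Block J
      B₀a≡0 : B₀.a ≡ 0
      B₀a≡0 = n≤0⇒n≡0 B₀.a≤x
      F₁ : Neighbour n M B₀.a B₀.b J.a J.b
      F₁ = diameter-flip short refl 1≤n B₀ J
      open Neighbour F₁ using (b<c; c<d)
      third : ∀ {x y} → y ≡ x + n → x < n → (P : Block R x) (Q : Block R y) →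
              ∀ z → z ≡ Block.a P ⊎ z ≡ Block.a Q → Off z B₀.a B₀.b J.a J.b → AtLeast (Adj n M) 2
      third y≡ x<n P Q z h o = two F₂ F₁ (distinct F₂ F₁ z ([ inj₁ , inj₂ ∘ inj₂ ∘ inj₁ ]′ h) o)
        where F₂ = diameter-flip short y≡ x<n P Q
      go : Dec (suc B₀.b < J.a) → Dec (suc J.b < 2 * n) → AtLeast (Adj n M) 2 ⊎ EvenBase n f
      go (yes p) _ = inj₁ (third refl x<n P Q (suc B₀.b) (inj₁ z≡)
        (linear (B₀.a ∷ B₀.b ∷ J.a ∷ J.b ∷ []) (λ a b c d → a :< b :⇒ 1+ b :< c :⇒ c :< d :⇒
          :¬ (1+ b :≡ a) :∧ :¬ (1+ b :≡ b) :∧ :¬ (1+ b :≡ c) :∧ :¬ (1+ b :≡ d)) B₀.a<b p c<d))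
        where
        x<n : suc B₀.b < n
        x<n = ≤-trans p J.a≤x
        P : Block R (suc B₀.b)
        P = block R (≤-trans x<n (m≤m+n n _))
        Q : Block R (suc B₀.b + n)
        Q = block R (linear (B₀.b ∷ n ∷ []) (λ b n → 1+ b :< n :⇒ 1+ b :+ n :< 2 :* n) x<n)
        z≡ : suc B₀.b ≡ Block.a P
        z≡ = ≤-antisym (last-block R (Block.top P) B₀.closed⁺ (Block.x≤b P)) (Block.a≤x P)
      go (no _) (yes p) = inj₁ (third (sym (m∸n+n≡m n≤)) x<n P Q (suc J.b) (inj₂ z≡)
        (linear (B₀.a ∷ B₀.b ∷ J.a ∷ J.b ∷ []) (λ a b c d → a :< b :⇒ b :< c :⇒ c :< d :⇒
          :¬ (1+ d :≡ a) :∧ :¬ (1+ d :≡ b) :∧ :¬ (1+ d :≡ c) :∧ :¬ (1+ d :≡ d)) B₀.a<b b<c c<d))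
        where
        -- Here the new block contains the far end of the diameter, so `x` is the point opposite to
        -- its first point.
        x = suc J.b ∸ n
        n≤ : n ≤ suc J.b
        n≤ = ≤-trans J.x≤b (n≤1+n _)
        x<n : x < n
        x<n = linear (x ∷ n ∷ J.b ∷ []) (λ x n d → x :+ n :≡ 1+ d :⇒ 1+ d :< 2 :* n :⇒ x :< n) (m∸n+n≡m n≤) p
        P : Block R x
        P = block R (≤-trans x<n (m≤m+n n _))
        Q : Block R (suc J.b)
        Q = block R p
        z≡ : suc J.b ≡ Block.a Q
        z≡ = ≤-antisym (last-block R (Block.top Q) J.closed⁺ (Block.x≤b Q)) (Block.a≤x Q)
      go (no p) (no q) = inj₂ (trans (cong suc f0) (proj₁ sizes) , trans (cong suc fn) (proj₂ (proj₂ sizes)))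
        where
        sizes : suc B₀.b ≡ n × J.a ≡ n × suc J.b ≡ 2 * n
        sizes = linear (B₀.a ∷ B₀.b ∷ J.a ∷ J.b ∷ n ∷ []) (λ a b c d n → a :≡ con 0 :⇒ b :< a :+ n :⇒ d :< c :+ n :⇒
          b :< c :⇒ :¬ (1+ b :< c) :⇒ :¬ (1+ d :< 2 :* n) :⇒ d :< 2 :* n :⇒
          1+ b :≡ n :∧ c :≡ n :∧ 1+ d :≡ 2 :* n)
          B₀a≡0 (short B₀.top) (short J.top) b<c p q J.b<N
        f0 : f 0 ≡ B₀.b
        f0 = trans (cong f (sym B₀a≡0)) B₀.partner
        fn : f n ≡ J.b
        fn = trans (cong f (sym (proj₁ (proj₂ sizes)))) J.partner

    -- The diameter alone puts the centre into the quadrilateral, so it flips with every edge of its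
    -- two faces. `I` and `O` always exist, one on each side; a further edge on either face gives a
    -- third flip.
    diameter-odd : ∀ k → n ≡ suc (2 * k) → 1 ≤ k → f 0 ≡ n → AtLeast (Adj n M) 3 ⊎ OddBase n f
    diameter-odd k eq 1≤k f0 = go (suc (f 1) ≟ n) (suc (f (suc n)) ≟ 2 * n)
      where
      3≤n : 3 ≤ n
      3≤n = linear (n ∷ k ∷ []) (λ n k → n :≡ 1+ 2 :* k :⇒ con 1 :≤ k :⇒ con 3 :≤ n) eq 1≤k
      D : Top R 0 n
      D = record { partner = f0 ; a<b = linear (n ∷ []) (λ n → con 3 :≤ n :⇒ con 0 :< n) 3≤n
                 ; b<N = linear (n ∷ []) (λ n → con 3 :≤ n :⇒ n :< 2 :* n) 3≤n ; closed = λ () }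
      module D = Top D
      outer : ∀ {c d} → Top R c d → n < c → Neighbour n M 0 n c d
      outer {c} {d} t n<c = neighbour {n} {M} ncm (top-quad R D t n<c) (inj₁ (top-sides R D t)) ≤-refl
        (linear (c ∷ d ∷ n ∷ []) (λ c d n → c :< d :⇒ d :< 2 :* n :⇒ c :≤ n :+ n) (Top.a<b t) (Top.b<N t))
        (linear (c ∷ d ∷ n ∷ []) (λ c d n → n :< c :⇒ d :< 2 :* n :⇒ d :≤ c :+ n) n<c (Top.b<N t))
        (linear (c ∷ d ∷ n ∷ []) (λ c d n → n :< c :⇒ c :< d :⇒ n :≤ d) n<c (Top.a<b t))
      U : Top R (suc n) (f (suc n))
      U = closed⇒top R (linear (n ∷ []) (λ n → con 3 :≤ n :⇒ 1+ n :< 2 :* n) 3≤n) D.closed⁺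
      -- The edge {b , c} below the diameter is outermost there when no edge leaves (0 , b).
      inner : ∀ {b c} → 0 < b → b < c → c < n → f b ≡ c → (∀ {x} → 0 < x → x < b → f x < b) → Neighbour n M 0 b c n
      inner {b} {c} 0<b b<c c<n fb cl = neighbour {n} {M} ncm
        (record { a<b = 0<b ; b<c = b<c ; c<d = c<n ; d<N = D.b<N
                ; ab = λ p q → proj₁ (top-inside R D p (<-trans q (<-trans b<c c<n))) , cl p q
                ; bc = λ p q → subst (λ z → b < f _ × f _ < z) fb (nest p (subst (_ <_) (sym fb) q))
                ; cd = λ {x} p q → ≰⇒> (above p q) , proj₂ (top-inside R D (<-trans 0<b (<-trans b<c p)) q) })
        (inj₂ (sides fb (adjoint fb) (adjoint f0) f0))
        (linear (b ∷ c ∷ n ∷ []) (λ b c n → b :< c :⇒ c :< n :⇒ b :≤ n) b<c c<n)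
        (linear (b ∷ c ∷ n ∷ []) (λ b c n → b :< c :⇒ c :< n :⇒ c :≤ b :+ n) b<c c<n)
        (linear (b ∷ c ∷ n ∷ []) (λ b c n → n :≤ c :+ n)) ≤-refl
        where
        -- The partner of `x` cannot be below `b` by `cl`, cannot be `b` or `c`, which are matched
        -- to each other, and cannot lie between them by nesting.
        above : ∀ {x} → c < x → x < n → f x ≤ c → ⊥
        above {x} c<x x<n fx≤c with <-cmp (f x) b
        ... | tri< p _ _ = <-asym c<x (<-trans (subst (_< b) (inv x) (cl (proj₁ (top-inside R D (<-trans 0<b (<-trans b<c c<x)) x<n)) p)) b<c)
        ... | tri≈ _ p _ = <-irrefl (trans (sym fb) (adjoint p)) c<x
        ... | tri> _ _ p with m≤n⇒m<n∨m≡n fx≤c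
        ...   | inj₁ q = <-asym c<x (subst₂ _<_ (inv x) fb (proj₂ (nest p (subst (f x <_) (sym fb) q))))
        ...   | inj₂ q = <-asym c<x (subst (_< c) (trans (sym (adjoint fb)) (adjoint q)) b<c)
      1<n : 1 < n
      1<n = linear (n ∷ []) (λ n → con 3 :≤ n :⇒ con 1 :< n) 3≤n
      f1 : 0 < f 1 × f 1 < n
      f1 = top-inside R D (s≤s z≤n) 1<n
      1<f1 : 1 < f 1
      1<f1 = ≤∧≢⇒< (proj₁ f1) (nofix (<-trans 1<n D.b<N) ∘ sym)
      I : Neighbour n M 0 1 (f 1) n
      I = inner (s≤s z≤n) 1<f1 (proj₂ f1) refl (λ p q → ⊥-elim (<⇒≱ q p))
      O : Neighbour n M 0 n (suc n) (f (suc n))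
      O = outer U ≤-refl
      go : Dec (suc (f 1) ≡ n) → Dec (suc (f (suc n)) ≡ 2 * n) → AtLeast (Adj n M) 3 ⊎ OddBase n f
      go (yes p) (yes q) = inj₂ (f0 , p , q)
      go _ (no q) = inj₁ (three I O O′
        (distinct I O 1 (inj₂ (inj₁ refl)) (off-outer U ≤-refl))
        (distinct I O′ 1 (inj₂ (inj₁ refl)) (off-outer V.top n<V))
        (distinct O O′ (suc n) (inj₂ (inj₂ (inj₁ refl)))
          (linear (n ∷ V.a ∷ V.b ∷ []) (λ n c d → con 3 :≤ n :⇒ 1+ n :< c :⇒ c :< d :⇒
            :¬ (1+ n :≡ con 0) :∧ :¬ (1+ n :≡ n) :∧ :¬ (1+ n :≡ c) :∧ :¬ (1+ n :≡ d))
            3≤n 1+n<V V.a<b)))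
        where
        off-outer : ∀ {c d} → Top R c d → n < c → Off 1 0 n c d
        off-outer {c} {d} t n<c = linear (n ∷ c ∷ d ∷ []) (λ n c d → con 3 :≤ n :⇒ n :< c :⇒ c :< d :⇒
          :¬ (con 1 :≡ con 0) :∧ :¬ (con 1 :≡ n) :∧ :¬ (con 1 :≡ c) :∧ :¬ (con 1 :≡ d)) 3≤n n<c (Top.a<b t)
        V : Block R (suc (f (suc n)))
        V = block R (≤∧≢⇒< (Top.b<N U) q)
        module V = Block V
        1+n<V : suc n < V.a
        1+n<V = <-≤-trans (Top.a<b U) (≤-trans (n≤1+n _) (last-block R V.top (Top.closed⁺ U) V.x≤b))
        n<V : n < V.a
        n<V = <-trans ≤-refl 1+n<V
        O′ : Neighbour n M 0 n V.a V.b
        O′ = outer V.top n<V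
      go (no p) _ = inj₁ (three I I′ O
        (distinct I I′ 1 (inj₂ (inj₁ refl))
          ((λ ()) , <⇒≢ (<-trans 1<f1 ≤-refl) , <⇒≢ (<-trans 1<f1 (<-trans ≤-refl e<fe)) , <⇒≢ 1<n))
        (distinct I O 1 (inj₂ (inj₁ refl))
          ((λ ()) , <⇒≢ 1<n , <⇒≢ (<-trans 1<n ≤-refl) , <⇒≢ (<-trans 1<n (<-trans ≤-refl (Top.a<b U)))))
        (distinct I′ O e (inj₂ (inj₁ refl))
          ((λ ()) , <⇒≢ e<n , <⇒≢ (<-trans e<n ≤-refl) , <⇒≢ (<-trans e<n (<-trans ≤-refl (Top.a<b U))))))
        where
        -- The first point behind the edge at `1`; it starts the next edge of the inner face.
        e = suc (f 1)
        e<n : e < n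
        e<n = ≤∧≢⇒< (proj₂ f1) p
        cl : ∀ {x} → 0 < x → x < e → f x < e
        cl {x} 0<x (s≤s x≤) with m≤n⇒m<n∨m≡n 0<x | m≤n⇒m<n∨m≡n x≤
        ... | inj₁ 1<x  | inj₁ x<  = <-trans (proj₂ (nest 1<x x<)) ≤-refl
        ... | inj₂ refl | _        = ≤-refl
        ... | inj₁ 1<x  | inj₂ refl = subst (_< e) (sym (inv 1)) (<-trans 1<f1 ≤-refl)
        fe : 0 < f e × f e < n
        fe = top-inside R D (s≤s z≤n) e<n
        e<fe : e < f e
        e<fe = ≤∧≢⇒< (≮⇒≥ λ fe<e → <-irrefl (inv e) (cl (proj₁ fe) fe<e)) (nofix (<-trans e<n D.b<N) ∘ sym)
        I′ : Neighbour n M 0 e (f e) n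
        I′ = inner (s≤s z≤n) e<fe (proj₂ fe) refl cl

open LowerBounds

-- All centred flips of a matching in standard position

module UpperBounds where

  open import Data.List using ([]; _∷_)
  open import Data.List.Membership.Propositional using (_∈_)
  open import Data.List.Relation.Unary.All using ([]; _∷_)
  open import Data.List.Relation.Unary.AllPairs using ([]; _∷_)
  open import Data.List.Relation.Unary.Any using (here; there)

  module _ {n : ℕ} {M : PM n} (ncm : IsNCM n M) where

    private
      R = IsNCM⇒NC {n} {M} ncm
      f = val M
    open NC R

    flip-arc : ∀ {g a b c d x} → Flip n f g a b c d → Off x a b c d → SameArc a b c d x (f x)
    flip-arc F o = same-arc R (Flip.quad F) o (Sides⇒off R ([ inj₁ ∘ proj₁ , inj₂ ∘ proj₁ ]′ (Flip.swap F)) o)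

    pin : ∀ {g a b c d a′ b′ c′ d′} → a ≡ a′ → b ≡ b′ → c ≡ c′ → d ≡ d′ → Flip n f g a b c d → Flip n f g a′ b′ c′ d′
    pin refl refl refl refl F = F

    -- No edge joins the halves `[0 , n)` and `[n , 2n)`, so a centred flip takes one edge from
    -- each. An edge other than the outermost one of its half would be separated from the rest of
    -- the quadrilateral by that outermost edge.
    evenBase⇒Deg : 1 ≤ n → EvenBase n f → Deg n M 1
    evenBase⇒Deg 1≤n (f0 , fn) = Neighbour.to F₀ ∷ [] , [] ∷ [] , refl , λ M′ →
      mk⇔ (λ { (here refl) → Neighbour.adjacent F₀ })
          (λ A → let a , b , c , d , F = Adj⇒Flip {n} {M} {M′} ncm A in
             here (flip-unique {n} {M} {M′} {Neighbour.to F₀} (only F (Flip.swap F)) (Neighbour.flip F₀)))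
      where
      T₀ : Top R 0 (f 0)
      T₀ = closed⇒top R (≤-trans 1≤n (m≤m+n n _)) λ ()
      closedₙ : Closed R n
      closedₙ = subst (Closed R) f0 (Top.closed⁺ T₀)
      Tₙ : Top R n (f n)
      Tₙ = closed⇒top R (linear (n ∷ []) (λ n → con 1 :≤ n :⇒ n :< 2 :* n) 1≤n) closedₙ
      F₀ : Neighbour n M 0 (f 0) n (f n)
      F₀ = neighbour {n} {M} ncm (top-quad R T₀ Tₙ (≤-reflexive f0)) (inj₁ (top-sides R T₀ Tₙ))
        (<⇒≤ (≤-reflexive f0)) (m≤n+m n _)
        (linear (n ∷ f n ∷ []) (λ n d → 1+ d :≡ 2 :* n :⇒ d :≤ n :+ n) fn)
        (<⇒≤ (Top.a<b Tₙ))
      only : ∀ {g a b c d} → Flip n f g a b c d → (Sides f a b c d × Sides g b c d a) ⊎ (Sides f b c d a × Sides g a b c d) →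
             Flip n f g 0 (f 0) n (f n)
      only {g} {a} {b} {c} {d} F (inj₁ (sides ab ba cd dc , _)) =
        pin a≡0 (trans (sym ab) (cong f a≡0)) c≡n (trans (sym cd) (cong f c≡n)) F
        where
        open Flip F using (a<b; b<c; c<d; d<N; da≤)
        a<n : a < n
        a<n = linear (a ∷ d ∷ n ∷ []) (λ a d n → a :+ n :≤ d :⇒ d :< 2 :* n :⇒ a :< n) da≤ d<N
        b<n : b < n
        b<n = subst (_< n) ab (closedₙ a<n)
        n≤c : n ≤ c
        n≤c = ≮⇒≥ λ c<n → <⇒≱ (subst (_< n) cd (closedₙ c<n)) (≤-trans (m≤n+m n a) da≤)
        a≡0 : a ≡ 0
        a≡0 with a ≟ 0
        ... | yes p = p
        ... | no ¬p = ⊥-elim (linear (a ∷ b ∷ c ∷ d ∷ f 0 ∷ n ∷ []) (λ a b c d y n → b :< n :⇒ n :≤ c :⇒ c :< d :⇒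
                1+ y :≡ n :⇒ :¬ (a :≡ con 0) :⇒ a :< b :⇒ sameArc a b c d (con 0) y :⇒ :⊥) b<n n≤c c<d f0 ¬p a<b
                (flip-arc F (¬p ∘ sym , <⇒≢ (≤-<-trans z≤n a<b) , <⇒≢ (≤-<-trans z≤n b<c) , <⇒≢ (≤-<-trans z≤n c<d))))
        c≡n : c ≡ n
        c≡n with c ≟ n
        ... | yes p = p
        ... | no ¬p = ⊥-elim (linear (a ∷ b ∷ c ∷ d ∷ f n ∷ n ∷ []) (λ a b c d y n → a :< b :⇒ b :< n :⇒ n :≤ c :⇒ c :< d :⇒ d :< 2 :* n :⇒
                1+ y :≡ 2 :* n :⇒ :¬ (c :≡ n) :⇒ sameArc a b c d n y :⇒ :⊥) a<b b<n n≤c c<d d<N fn ¬p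
                (flip-arc F (<⇒≢ a<n ∘ sym , <⇒≢ b<n ∘ sym , ¬p ∘ sym , <⇒≢ (≤-<-trans n≤c c<d))))
      -- In this pairing `a < n` is matched to `d ≥ n`, but no edge leaves the first half.
      only {g} {a} {b} {c} {d} F (inj₂ (sides bc cb da ad , _)) =
        ⊥-elim (<⇒≱ (subst (_< n) ad (closedₙ a<n)) (≤-trans (m≤n+m n a) da≤))
        where
        open Flip F using (d<N; da≤)
        a<n : a < n
        a<n = linear (a ∷ d ∷ n ∷ []) (λ a d n → a :+ n :≤ d :⇒ d :< 2 :* n :⇒ a :< n) da≤ d<N

    -- The diameter cannot separate corners of an empty quadrilateral, so every centred flip uses
    -- it. The other edge is then the outermost one on its side: above the diameter for the pairing
    -- `ab`, `cd`, below it for `bc`, `da`.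
    oddBase⇒Deg : 3 ≤ n → OddBase n f → Deg n M 2
    oddBase⇒Deg 3≤n (f0 , f1 , f1+n) =
      Neighbour.to O ∷ Neighbour.to I ∷ [] , (O≢I ∷ []) ∷ [] ∷ [] , refl , λ M′ →
      mk⇔ (λ { (here refl) → Neighbour.adjacent O ; (there (here refl)) → Neighbour.adjacent I })
          (λ A → let a , b , c , d , F = Adj⇒Flip {n} {M} {M′} ncm A in found F (Flip.swap F))
      where
      1<n : 1 < n
      1<n = ≤-trans (n≤1+n 2) 3≤n
      D : Top R 0 n
      D = record { partner = f0 ; a<b = <⇒≤ 1<n ; closed = λ ()
                 ; b<N = linear (n ∷ []) (λ n → con 3 :≤ n :⇒ n :< 2 :* n) 3≤n }
      U : Top R (suc n) (f (suc n))
      U = closed⇒top R (linear (n ∷ []) (λ n → con 3 :≤ n :⇒ 1+ n :< 2 :* n) 3≤n) (Top.closed⁺ D)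
      O : Neighbour n M 0 n (suc n) (f (suc n))
      O = neighbour {n} {M} ncm (top-quad R D U ≤-refl) (inj₁ (top-sides R D U)) ≤-refl
        (linear (n ∷ []) (λ n → con 3 :≤ n :⇒ 1+ n :≤ n :+ n) 3≤n)
        (linear (n ∷ f (suc n) ∷ []) (λ n d → 1+ d :≡ 2 :* n :⇒ d :≤ 1+ n :+ n) f1+n)
        (linear (n ∷ f (suc n) ∷ []) (λ n d → con 3 :≤ n :⇒ 1+ d :≡ 2 :* n :⇒ n :≤ d) 3≤n f1+n)
      1<f1 : 1 < f 1
      1<f1 = linear (n ∷ f 1 ∷ []) (λ n y → con 3 :≤ n :⇒ 1+ y :≡ n :⇒ con 1 :< y) 3≤n f1
      I : Neighbour n M 0 1 (f 1) n
      I = neighbour {n} {M} ncm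
        (record { a<b = s≤s z≤n ; b<c = 1<f1 ; c<d = ≤-reflexive f1 ; d<N = Top.b<N D
                ; ab = λ p q → ⊥-elim (<⇒≱ q p) ; bc = nest
                ; cd = λ p q → ⊥-elim (<⇒≱ q (subst (_≤ _) f1 p)) })
        (inj₂ (sides refl (inv 1) (adjoint f0) f0)) (<⇒≤ 1<n)
        (linear (n ∷ f 1 ∷ []) (λ n y → 1+ y :≡ n :⇒ y :≤ 1+ n) f1) (m≤n+m n _) ≤-refl
      O≢I : Neighbour.to O ≢ Neighbour.to I
      O≢I = distinct O I (suc n) (inj₂ (inj₂ (inj₁ refl)))
        (linear (n ∷ f 1 ∷ []) (λ n y → con 3 :≤ n :⇒ 1+ y :≡ n :⇒ off (1+ n) (con 0) (con 1) y n) 3≤n f1)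
      within : ∀ {x} → 0 < x → x < n → 0 < f x × f x < n
      within = top-inside R D
      found : ∀ {M′ a b c d} → Flip n f (val M′) a b c d →
              (Sides f a b c d × Sides (val M′) b c d a) ⊎ (Sides f b c d a × Sides (val M′) a b c d) →
              M′ ∈ Neighbour.to O ∷ Neighbour.to I ∷ []
      found {M′} {a} {b} {c} {d} F (inj₁ (sides ab ba cd dc , _)) =
        here (flip-unique {n} {M} {M′} {Neighbour.to O}
          (pin a≡0 b≡n c≡1+n (trans (sym cd) (cong f c≡1+n)) F) (Neighbour.flip O))
        where
        open Flip F using (a<b; b<c; c<d; d<N; da≤)
        a<n : a < n
        a<n = linear (a ∷ d ∷ n ∷ []) (λ a d n → a :+ n :≤ d :⇒ d :< 2 :* n :⇒ a :< n) da≤ d<N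
        a≡0 : a ≡ 0
        a≡0 with a ≟ 0
        ... | yes p = p
        ... | no ¬p = ⊥-elim (linear (a ∷ b ∷ c ∷ d ∷ n ∷ []) (λ a b c d n → b :< n :⇒ n :< d :⇒ a :< b :⇒ b :< c :⇒ c :< d :⇒
                :¬ (a :≡ con 0) :⇒ sameArc a b c d (con 0) n :⇒ :⊥) b<n n<d a<b b<c c<d ¬p
                (subst (SameArc a b c d 0) f0
                  (flip-arc F (¬p ∘ sym , <⇒≢ (≤-<-trans z≤n a<b) , <⇒≢ (≤-<-trans z≤n b<c) , <⇒≢ (≤-<-trans z≤n c<d)))))
          where
          b<n : b < n
          b<n = subst (_< n) ab (proj₂ (within (n≢0⇒n>0 ¬p) a<n))
          n<d : n < d
          n<d = <-≤-trans (+-monoˡ-< n (n≢0⇒n>0 ¬p)) da≤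
        b≡n : b ≡ n
        b≡n = trans (sym ab) (trans (cong f a≡0) f0)
        c≡1+n : c ≡ suc n
        c≡1+n with c ≟ suc n
        ... | yes p = p
        ... | no ¬p = ⊥-elim (linear (a ∷ b ∷ c ∷ d ∷ f (suc n) ∷ n ∷ []) (λ a b c d y n →
                a :≡ con 0 :⇒ b :≡ n :⇒ b :< c :⇒ c :< d :⇒ d :< 2 :* n :⇒ :¬ (c :≡ 1+ n) :⇒ 1+ y :≡ 2 :* n :⇒
                sameArc a b c d (1+ n) y :⇒ :⊥) a≡0 b≡n b<c c<d d<N ¬p f1+n
                (flip-arc F (linear (a ∷ b ∷ c ∷ d ∷ n ∷ []) (λ a b c d n →
                  a :≡ con 0 :⇒ b :≡ n :⇒ b :< c :⇒ c :< d :⇒ :¬ (c :≡ 1+ n) :⇒ off (1+ n) a b c d)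
                  a≡0 b≡n b<c c<d ¬p)))
      found {M′} {a} {b} {c} {d} F (inj₂ (sides bc cb da ad , _)) =
        there (here (flip-unique {n} {M} {M′} {Neighbour.to I}
          (pin a≡0 b≡1 (trans (sym bc) (cong f b≡1)) d≡n F) (Neighbour.flip I)))
        where
        open Flip F using (a<b; b<c; c<d; d<N; da≤)
        a<n : a < n
        a<n = linear (a ∷ d ∷ n ∷ []) (λ a d n → a :+ n :≤ d :⇒ d :< 2 :* n :⇒ a :< n) da≤ d<N
        a≡0 : a ≡ 0
        a≡0 with a ≟ 0
        ... | yes p = p
        ... | no ¬p = ⊥-elim (<⇒≱ (subst (_< n) ad (proj₂ (within (n≢0⇒n>0 ¬p) a<n))) (≤-trans (m≤n+m n a) da≤))
        d≡n : d ≡ n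
        d≡n = trans (sym ad) (trans (cong f a≡0) f0)
        b≡1 : b ≡ 1
        b≡1 with b ≟ 1
        ... | yes p = p
        ... | no ¬p = ⊥-elim (linear (a ∷ b ∷ c ∷ d ∷ f 1 ∷ n ∷ []) (λ a b c d y n →
                a :≡ con 0 :⇒ d :≡ n :⇒ a :< b :⇒ b :< c :⇒ c :< d :⇒ :¬ (b :≡ con 1) :⇒ 1+ y :≡ n :⇒
                sameArc a b c d (con 1) y :⇒ :⊥) a≡0 d≡n a<b b<c c<d ¬p f1
                (flip-arc F (linear (a ∷ b ∷ c ∷ d ∷ []) (λ a b c d →
                  a :≡ con 0 :⇒ a :< b :⇒ b :< c :⇒ c :< d :⇒ :¬ (b :≡ con 1) :⇒ off (con 1) a b c d)
                  a≡0 a<b b<c c<d ¬p)))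

open UpperBounds

-- Rotation, and the reduction to an outer face that contains the centre

module Rotation where

  open import Data.List using (map)
  open import Data.List.Membership.Propositional using (_∈_)
  open import Data.List.Membership.Propositional.Properties using (∈-map⁺; ∈-map⁻)
  open import Data.List.Properties using (length-map)
  import Data.List.Relation.Unary.Unique.Propositional.Properties as Unique
  open import Data.Fin as Fin using (Fin; toℕ; fromℕ<; fromℕ; inject₁)
  open import Data.Fin.Properties using (toℕ-injective; toℕ-fromℕ<; toℕ<n; toℕ-fromℕ; toℕ-inject₁)
  open import Data.Vec using (lookup; tabulate)
  open import Data.Vec.Properties using (lookup∘tabulate)

  ρ : ∀ {N} → Fin N → Fin N
  ρ {suc k} x with suc (toℕ x) <? suc k
  ... | yes p = fromℕ< p
  ... | no  _ = Fin.zero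

  ρ⁻¹ : ∀ {N} → Fin N → Fin N
  ρ⁻¹ {suc k} Fin.zero    = fromℕ k
  ρ⁻¹ {suc k} (Fin.suc i) = inject₁ i

  -- Adding one modulo `N`, as a relation with two cases on which `linear` can split.
  Step : ℕ → ℕ → ℕ → Set
  Step N x x′ = (suc x < N × x′ ≡ suc x) ⊎ (suc x ≡ N × x′ ≡ 0)

  step : (N x x′ : Exp) → Form
  step N x x′ = (1+ x :< N :∧ x′ :≡ 1+ x) :∨ (1+ x :≡ N :∧ x′ :≡ con 0)

  ρ-step : ∀ {N} (x : Fin N) → Step N (toℕ x) (toℕ (ρ x))
  ρ-step {suc k} x with suc (toℕ x) <? suc k
  ... | yes p = inj₁ (p , toℕ-fromℕ< p)
  ... | no ¬p = inj₂ (≤-antisym (toℕ<n x) (≮⇒≥ ¬p) , refl)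

  ρ-injective : ∀ {N} {x y : Fin N} → ρ x ≡ ρ y → x ≡ y
  ρ-injective {N} {x} {y} eq = toℕ-injective (linear (N ∷ toℕ x ∷ toℕ y ∷ toℕ (ρ x) ∷ toℕ (ρ y) ∷ [])
    (λ N x y x′ y′ → step N x x′ :⇒ step N y y′ :⇒ x′ :≡ y′ :⇒ x :≡ y) (ρ-step x) (ρ-step y) (cong toℕ eq))

  ρ-ρ⁻¹ : ∀ {N} (x : Fin N) → ρ (ρ⁻¹ x) ≡ x
  ρ-ρ⁻¹ {suc k} Fin.zero = toℕ-injective (linear (k ∷ toℕ (fromℕ k) ∷ toℕ (ρ (fromℕ k)) ∷ [])
    (λ k x x′ → x :≡ k :⇒ step (1+ k) x x′ :⇒ x′ :≡ con 0) (toℕ-fromℕ k) (ρ-step (fromℕ k)))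
  ρ-ρ⁻¹ {suc k} (Fin.suc i) = toℕ-injective (linear (k ∷ toℕ i ∷ toℕ (inject₁ i) ∷ toℕ (ρ (inject₁ i)) ∷ [])
    (λ k i x x′ → x :≡ i :⇒ i :< k :⇒ step (1+ k) x x′ :⇒ x′ :≡ 1+ i)
    (toℕ-inject₁ i) (toℕ<n i) (ρ-step (inject₁ i)))

  -- With every point in the form `ρ x`, `rot-lookup` applies and `ρ⁻¹` disappears from later
  -- proofs.
  data Image {N : ℕ} : Fin N → Set where
    image : ∀ x → Image (ρ x)

  preimage : ∀ {N} (x : Fin N) → Image x
  preimage x = subst Image (ρ-ρ⁻¹ x) (image (ρ⁻¹ x))

  rot : ∀ {N} → Vec (Fin N) N → Vec (Fin N) N
  rot M = tabulate λ x → ρ (lookup M (ρ⁻¹ x))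

  rot-lookup : ∀ {N} (M : Vec (Fin N) N) x → lookup (rot M) (ρ x) ≡ ρ (lookup M x)
  rot-lookup M x = trans (lookup∘tabulate _ (ρ x)) (cong (ρ ∘ lookup M) (ρ-injective (ρ-ρ⁻¹ (ρ x))))

  rot-injective : ∀ {N} {M M′ : Vec (Fin N) N} → rot M ≡ rot M′ → M ≡ M′
  rot-injective {M = M} {M′} eq = lookup-ext λ x → ρ-injective
    (trans (sym (rot-lookup M x)) (trans (cong (λ V → lookup V (ρ x)) eq) (rot-lookup M′ x)))

  -- Rotating complements the open arc between a and b if one of them passes the origin and preserves
  -- it otherwise.
  module _ (N a b x a′ b′ x′ : ℕ) where

    btw-keep : suc a < N → suc b < N → a′ ≡ suc a → b′ ≡ suc b → Step N x x′ →
               (Btw a′ b′ x′ → Btw a b x) × (Btw a b x → Btw a′ b′ x′)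
    btw-keep = linear (a′ ∷ b′ ∷ x′ ∷ a ∷ b ∷ x ∷ N ∷ []) λ a′ b′ x′ a b x N →
      1+ a :< N :⇒ 1+ b :< N :⇒ a′ :≡ 1+ a :⇒ b′ :≡ 1+ b :⇒ step N x x′ :⇒
      (btw a′ b′ x′ :⇒ btw a b x) :∧ (btw a b x :⇒ btw a′ b′ x′)

    btw-flip : suc a ≡ N → suc b < N → a′ ≡ 0 → b′ ≡ suc b → Step N x x′ → x ≢ a → x ≢ b →
               (Btw a′ b′ x′ → ¬ Btw a b x) × (¬ Btw a b x → Btw a′ b′ x′)
    btw-flip = linear (a′ ∷ b′ ∷ x′ ∷ a ∷ b ∷ x ∷ N ∷ []) λ a′ b′ x′ a b x N →
      1+ a :≡ N :⇒ 1+ b :< N :⇒ a′ :≡ con 0 :⇒ b′ :≡ 1+ b :⇒ step N x x′ :⇒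
      :¬ (x :≡ a) :⇒ :¬ (x :≡ b) :⇒
      (btw a′ b′ x′ :⇒ :¬ (btw a b x)) :∧ (:¬ (btw a b x) :⇒ btw a′ b′ x′)

  btw-swap : ∀ {a b x} → Btw a b x → Btw b a x
  btw-swap = [ inj₂ , inj₁ ]′

  module _ {n : ℕ} where

    private
      _∉_ : Pt n → Pt n × Pt n → Set
      x ∉ (a , b) = x ≢ a × x ≢ b

    Btw-ρ : ∀ a b → a ≢ b →
            (∀ (x : Pt n) → x ∉ (a , b) → (Btw (toℕ (ρ a)) (toℕ (ρ b)) (toℕ (ρ x)) → Btw (toℕ a) (toℕ b) (toℕ x)) ×
                                          (Btw (toℕ a) (toℕ b) (toℕ x) → Btw (toℕ (ρ a)) (toℕ (ρ b)) (toℕ (ρ x)))) ⊎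
            (∀ (x : Pt n) → x ∉ (a , b) → (Btw (toℕ (ρ a)) (toℕ (ρ b)) (toℕ (ρ x)) → ¬ Btw (toℕ a) (toℕ b) (toℕ x)) ×
                                          (¬ Btw (toℕ a) (toℕ b) (toℕ x) → Btw (toℕ (ρ a)) (toℕ (ρ b)) (toℕ (ρ x))))
    Btw-ρ a b a≢b with ρ-step a | ρ-step b
    ... | inj₁ (p , q) | inj₁ (r , s) = inj₁ λ x _ → btw-keep _ _ _ _ _ _ _ p r q s (ρ-step x)
    ... | inj₂ (p , q) | inj₁ (r , s) = inj₂ λ x (x≢a , x≢b) →
      btw-flip _ _ _ _ _ _ _ p r q s (ρ-step x) (x≢a ∘ toℕ-injective) (x≢b ∘ toℕ-injective)
    ... | inj₁ (p , q) | inj₂ (r , s) = inj₂ λ x (x≢a , x≢b) →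
      let f , g = btw-flip _ _ _ _ _ _ _ r p s q (ρ-step x) (x≢b ∘ toℕ-injective) (x≢a ∘ toℕ-injective)
      in (λ h k → f (btw-swap h) (btw-swap k)) , (λ h → btw-swap (g (h ∘ btw-swap)))
    ... | inj₂ (p , q) | inj₂ (r , s) = ⊥-elim (a≢b (toℕ-injective (suc-injective (trans p (sym r)))))

    -- Crossing compares two points with the same arc, so it does not matter whether that arc is
    -- preserved or complemented. The ends of the chord are excluded because they lie in neither
    -- open arc.
    ¬cross-ρ : ∀ {a b x y : Pt n} → a ≢ b → x ∉ (a , b) → y ∉ (a , b) →
               ¬ Cross n a b x y → ¬ Cross n (ρ a) (ρ b) (ρ x) (ρ y)
    ¬cross-ρ {a} {b} {x} {y} a≢b x∉ y∉ h = ⇒¬cross {n} {ρ a} {ρ b} {ρ x} {ρ y} (go x∉ y∉ xy yx) (go y∉ x∉ yx xy)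
      where
      xy : Btw (toℕ a) (toℕ b) (toℕ x) → Btw (toℕ a) (toℕ b) (toℕ y)
      xy = ¬cross⇒ {n} {a} {b} {x} {y} h
      yx : Btw (toℕ a) (toℕ b) (toℕ y) → Btw (toℕ a) (toℕ b) (toℕ x)
      yx = ¬cross⇒ {n} {a} {b} {y} {x} λ { (inj₁ (p , q)) → h (inj₂ (q , p)) ; (inj₂ (p , q)) → h (inj₁ (q , p)) }
      go : ∀ {x y} → x ∉ (a , b) → y ∉ (a , b) → (Btw (toℕ a) (toℕ b) (toℕ x) → Btw (toℕ a) (toℕ b) (toℕ y)) →
           (Btw (toℕ a) (toℕ b) (toℕ y) → Btw (toℕ a) (toℕ b) (toℕ x)) →
           Btw (toℕ (ρ a)) (toℕ (ρ b)) (toℕ (ρ x)) → Btw (toℕ (ρ a)) (toℕ (ρ b)) (toℕ (ρ y))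
      go {x} {y} x∉ y∉ f g with Btw-ρ a b a≢b
      ... | inj₁ k = proj₂ (k y y∉) ∘ f ∘ proj₁ (k x x∉)
      ... | inj₂ k = λ h → proj₂ (k y y∉) (proj₁ (k x x∉) h ∘ g)

    rot-eq : ∀ {M : PM n} {x y} → lookup M x ≡ y → lookup (rot M) (ρ x) ≡ ρ y
    rot-eq {M} {x} refl = rot-lookup M x

    rot-NCM : ∀ {M} → IsNCM n M → IsNCM n (rot M)
    rot-NCM {M} (pm , nc) = pm′ , nc′
      where
      pm′ : IsPerfectMatching n (rot M)
      pm′ i with preimage i
      ... | image x =
        trans (cong (lookup (rot M)) (rot-lookup M x)) (rot-eq {M} (proj₁ (pm x))) ,
        λ eq → proj₂ (pm x) (ρ-injective (trans (sym (rot-lookup M x)) eq))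
      nc′ : NonCrossing n (rot M)
      nc′ i j with preimage i | preimage j
      ... | image x | image y rewrite rot-lookup M x | rot-lookup M y = λ j≢i j≢Mi →
        ¬cross-ρ (proj₂ (pm x) ∘ sym) (j≢i ∘ cong ρ , j≢Mi ∘ cong ρ)
          ((λ My≡x → j≢Mi (cong ρ (trans (sym (proj₁ (pm y))) (cong (lookup M) My≡x)))) ,
           (λ My≡Mx → j≢i (cong ρ (trans (sym (proj₁ (pm y))) (trans (cong (lookup M) My≡Mx) (proj₁ (pm x)))))))
          (nc x y (j≢i ∘ cong ρ) (j≢Mi ∘ cong ρ))

    rot-flip : ∀ {M M′} → IsNCM n M → CenteredFlip n M M′ → CenteredFlip n (rot M) (rot M′)
    rot-flip {M} {M′} (pm , _) (a , b , c , d , (a<b , b<c , c<d) , swap , same , empty , cent) = go (ρ-step d)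
      where
      up : ∀ {x : Pt n} → toℕ x < toℕ d → toℕ (ρ x) ≡ suc (toℕ x)
      up {x} x<d with ρ-step x
      ... | inj₁ (_ , q) = q
      ... | inj₂ (p , _) = ⊥-elim (<⇒≱ x<d (≤-pred (subst (toℕ d <_) (sym p) (toℕ<n d))))
      c↑ = up c<d
      b↑ = up (<-trans b<c c<d)
      a↑ = up (<-trans a<b (<-trans b<c c<d))
      gaps : Gaps n (toℕ a) (toℕ b) (toℕ c) (toℕ d)
      gaps = Centered⇒Gaps n {a} {b} {c} {d} cent
      a≢b = <⇒≢ a<b ∘ cong toℕ
      b≢c = <⇒≢ b<c ∘ cong toℕ
      c≢d = <⇒≢ c<d ∘ cong toℕ
      d≢a = <⇒≢ (<-trans a<b (<-trans b<c c<d)) ∘ cong toℕ ∘ sym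
      M-off : ∀ {x} → NotCorner n x a b c d → NotCorner n (lookup M x) a b c d
      M-off {x} (p , q , r , s) =
        [ (λ (ab , cd , _) → q ∘ via ab , p ∘ back ab , s ∘ via cd , r ∘ back cd)
        , (λ (bc , da , _) → s ∘ back da , r ∘ via bc , q ∘ back bc , p ∘ via da) ]′ swap
        where
        via : ∀ {u v} → lookup M u ≡ v → lookup M x ≡ u → x ≡ v
        via e e′ = trans (sym (proj₁ (pm x))) (trans (cong (lookup M) e′) e)
        back : ∀ {u v} → lookup M u ≡ v → lookup M x ≡ v → x ≡ u
        back e e′ = trans (sym (proj₁ (pm x))) (trans (cong (lookup M) (trans e′ (sym e))) (proj₁ (pm _)))
      Untouched : (p q r s : Pt n) → Set
      Untouched p q r s = ∀ x → NotCorner n x a b c d →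
        ¬ Cross n (ρ p) (ρ q) (ρ x) (ρ (lookup M x)) × ¬ Cross n (ρ q) (ρ r) (ρ x) (ρ (lookup M x)) ×
        ¬ Cross n (ρ r) (ρ s) (ρ x) (ρ (lookup M x)) × ¬ Cross n (ρ s) (ρ p) (ρ x) (ρ (lookup M x))
      untouched : Untouched a b c d
      untouched x o@(p , q , r , s) =
        let p′ , q′ , r′ , s′ = M-off o ; i , j , k , l = empty x o in
        ¬cross-ρ a≢b (p , q) (p′ , q′) i , ¬cross-ρ b≢c (q , r) (q′ , r′) j ,
        ¬cross-ρ c≢d (r , s) (r′ , s′) k , ¬cross-ρ d≢a (s , p) (s′ , p′) l
      go : Step (2 * n) (toℕ d) (toℕ (ρ d)) → CenteredFlip n (rot M) (rot M′)
      go (inj₁ (_ , d↑)) = ρ a , ρ b , ρ c , ρ d ,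
        (subst₂ _<_ (sym a↑) (sym b↑) (s≤s a<b) , subst₂ _<_ (sym b↑) (sym c↑) (s≤s b<c) , subst₂ _<_ (sym c↑) (sym d↑) (s≤s c<d)) ,
        [ (λ (p , q , r , s , t , u) → inj₁ (rot-eq {M} p , rot-eq {M} q , rot-eq {M′} r , rot-eq {M′} s , rot-eq {M′} t , rot-eq {M′} u)) ,
          (λ (p , q , r , s , t , u) → inj₂ (rot-eq {M} p , rot-eq {M} q , rot-eq {M′} r , rot-eq {M′} s , rot-eq {M′} t , rot-eq {M′} u)) ]′ swap ,
        same′ ,
        empty′ ,
        Gaps⇒Centered n {ρ a} {ρ b} {ρ c} {ρ d} (linear (toℕ (ρ a) ∷ toℕ (ρ b) ∷ toℕ (ρ c) ∷ toℕ (ρ d) ∷ toℕ a ∷ toℕ b ∷ toℕ c ∷ toℕ d ∷ n ∷ [])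
          (λ a′ b′ c′ d′ a b c d n → a′ :≡ 1+ a :⇒ b′ :≡ 1+ b :⇒ c′ :≡ 1+ c :⇒ d′ :≡ 1+ d :⇒
            b :≤ a :+ n :∧ c :≤ b :+ n :∧ d :≤ c :+ n :∧ a :+ n :≤ d :⇒
            b′ :≤ a′ :+ n :∧ c′ :≤ b′ :+ n :∧ d′ :≤ c′ :+ n :∧ a′ :+ n :≤ d′) a↑ b↑ c↑ d↑ gaps)
        where
        same′ : ∀ x → NotCorner n x (ρ a) (ρ b) (ρ c) (ρ d) → lookup (rot M′) x ≡ lookup (rot M) x
        same′ x with preimage x
        ... | image y = λ (p , q , r , s) → trans (rot-lookup M′ y)
          (trans (cong ρ (same y (p ∘ cong ρ , q ∘ cong ρ , r ∘ cong ρ , s ∘ cong ρ))) (sym (rot-lookup M y)))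
        empty′ : EmptyQuad n (rot M) (ρ a) (ρ b) (ρ c) (ρ d)
        empty′ x with preimage x
        ... | image y rewrite rot-lookup M y = λ (p , q , r , s) → untouched y (p ∘ cong ρ , q ∘ cong ρ , r ∘ cong ρ , s ∘ cong ρ)
      -- The last point `d` becomes `0`, the smallest corner; the corners shift cyclically and the
      -- two kinds of swap change places.
      go (inj₂ (d! , d↑)) = ρ d , ρ a , ρ b , ρ c ,
        (subst₂ _<_ (sym d↑) (sym a↑) (s≤s z≤n) , subst₂ _<_ (sym a↑) (sym b↑) (s≤s a<b) , subst₂ _<_ (sym b↑) (sym c↑) (s≤s b<c)) ,
        [ (λ (ab , cd , bc , cb , da , ad) → inj₂ (rot-eq {M} ab , rot-eq {M} cd , rot-eq {M′} da , rot-eq {M′} ad , rot-eq {M′} bc , rot-eq {M′} cb)) ,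
          (λ (bc , da , ab , ba , cd , dc) → inj₁ (rot-eq {M} da , rot-eq {M} bc , rot-eq {M′} ab , rot-eq {M′} ba , rot-eq {M′} cd , rot-eq {M′} dc)) ]′ swap ,
        same′ ,
        empty′ ,
        Gaps⇒Centered n {ρ d} {ρ a} {ρ b} {ρ c} (linear (toℕ (ρ a) ∷ toℕ (ρ b) ∷ toℕ (ρ c) ∷ toℕ (ρ d) ∷ toℕ a ∷ toℕ b ∷ toℕ c ∷ toℕ d ∷ n ∷ [])
          (λ a′ b′ c′ d′ a b c d n → a′ :≡ 1+ a :⇒ b′ :≡ 1+ b :⇒ c′ :≡ 1+ c :⇒ d′ :≡ con 0 :⇒ 1+ d :≡ 2 :* n :⇒
            b :≤ a :+ n :∧ c :≤ b :+ n :∧ d :≤ c :+ n :∧ a :+ n :≤ d :⇒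
            a′ :≤ d′ :+ n :∧ b′ :≤ a′ :+ n :∧ c′ :≤ b′ :+ n :∧ d′ :+ n :≤ c′) a↑ b↑ c↑ d↑ d! gaps)
        where
        same′ : ∀ x → NotCorner n x (ρ d) (ρ a) (ρ b) (ρ c) → lookup (rot M′) x ≡ lookup (rot M) x
        same′ x with preimage x
        ... | image y = λ (s , p , q , r) → trans (rot-lookup M′ y)
          (trans (cong ρ (same y (p ∘ cong ρ , q ∘ cong ρ , r ∘ cong ρ , s ∘ cong ρ))) (sym (rot-lookup M y)))
        empty′ : EmptyQuad n (rot M) (ρ d) (ρ a) (ρ b) (ρ c)
        empty′ x with preimage x
        ... | image y rewrite rot-lookup M y = λ (s , p , q , r) →
          let i , j , k , l = untouched y (p ∘ cong ρ , q ∘ cong ρ , r ∘ cong ρ , s ∘ cong ρ) in l , i , j , k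

    rot-Adj : ∀ {M M′} → IsNCM n M → Adj n M M′ → Adj n (rot M) (rot M′)
    rot-Adj {M} {M′} ncm (ncm′ , inj₁ F) = rot-NCM {M′} ncm′ , inj₁ (rot-flip {M} {M′} ncm F)
    rot-Adj {M} {M′} ncm (ncm′ , inj₂ F) = rot-NCM {M′} ncm′ , inj₂ (rot-flip {M′} {M} ncm′ F)

  ρs : ∀ {N} → ℕ → Fin N → Fin N
  ρs zero    x = x
  ρs (suc r) x = ρ (ρs r x)

  rots : ∀ {N} → ℕ → Vec (Fin N) N → Vec (Fin N) N
  rots zero    M = M
  rots (suc r) M = rot (rots r M)

  -- Adding `r` modulo `N`; for `r ≤ N` and `x < N` a single wrap suffices.
  Shift : (N r x x′ : ℕ) → Set
  Shift N r x x′ = (x + r < N × x′ ≡ x + r) ⊎ (N ≤ x + r × x′ + N ≡ x + r)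

  shift : (N r x x′ : Exp) → Form
  shift N r x x′ = (x :+ r :< N :∧ x′ :≡ x :+ r) :∨ (N :≤ x :+ r :∧ x′ :+ N :≡ x :+ r)

  shift-suc : ∀ N r x y y′ → x < N → r < N → Shift N r x y → Step N y y′ → Shift N (suc r) x y′
  shift-suc N r x y y′ = linear (y ∷ y′ ∷ x ∷ r ∷ N ∷ []) λ y y′ x r N →
    x :< N :⇒ r :< N :⇒ shift N r x y :⇒ step N y y′ :⇒ shift N (1+ r) x y′

  shift-unique : ∀ N r x y z → Shift N r x y → Shift N r x z → y ≡ z
  shift-unique N r x y z = linear (y ∷ z ∷ x ∷ r ∷ N ∷ []) λ y z x r N →
    shift N r x y :⇒ shift N r x z :⇒ y :≡ z

  module _ {N : ℕ} where

    ρs-shift : ∀ r (x : Fin N) → r ≤ N → Shift N r (toℕ x) (toℕ (ρs r x))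
    ρs-shift zero    x _   = inj₁ (subst (_< N) (sym (+-identityʳ _)) (toℕ<n x) , sym (+-identityʳ _))
    ρs-shift (suc r) x r<N = shift-suc N r _ _ _ (toℕ<n x) r<N (ρs-shift r x (<⇒≤ r<N)) (ρ-step (ρs r x))

    ρs-cycle : ∀ (x : Fin N) → ρs N x ≡ x
    ρs-cycle x = toℕ-injective (shift-unique N N (toℕ x) _ _ (ρs-shift N x ≤-refl) (inj₂ (m≤n+m N _ , refl)))

    rots-lookup : ∀ r (M : Vec (Fin N) N) x → lookup (rots r M) (ρs r x) ≡ ρs r (lookup M x)
    rots-lookup zero    M x = refl
    rots-lookup (suc r) M x = trans (rot-lookup (rots r M) (ρs r x)) (cong ρ (rots-lookup r M x))

    rots-cycle : ∀ (M : Vec (Fin N) N) → rots N M ≡ M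
    rots-cycle M = lookup-ext λ x → begin
      lookup (rots N M) x         ≡⟨ cong (lookup (rots N M)) (ρs-cycle x) ⟨
      lookup (rots N M) (ρs N x)  ≡⟨ rots-lookup N M x ⟩
      ρs N (lookup M x)           ≡⟨ ρs-cycle (lookup M x) ⟩
      lookup M x                  ∎
      where open ≡-Reasoning

    rots-+ : ∀ r s (M : Vec (Fin N) N) → rots (r + s) M ≡ rots r (rots s M)
    rots-+ zero    s M = refl
    rots-+ (suc r) s M = cong rot (rots-+ r s M)

    rots-inverse : ∀ {r} (M : Vec (Fin N) N) → r ≤ N → rots (N ∸ r) (rots r M) ≡ M
    rots-inverse {r} M r≤N = trans (sym (rots-+ (N ∸ r) r M)) (trans (cong (λ k → rots k M) (m∸n+n≡m r≤N)) (rots-cycle M))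

    rots-injective : ∀ r {M M′ : Vec (Fin N) N} → rots r M ≡ rots r M′ → M ≡ M′
    rots-injective zero    eq = eq
    rots-injective (suc r) eq = rots-injective r (rot-injective eq)

    -- Transports a single edge. Each end comes with its own `Shift`, so every use states whether
    -- that end passes the origin.
    rots-val : ∀ {r x y x′ y′} (M : Vec (Fin N) N) → r ≤ N → x < N → y < N → val M x ≡ y →
               Shift N r x x′ → Shift N r y y′ → val (rots r M) x′ ≡ y′
    rots-val {r} M r≤N x<N y<N eq sx sy with point x<N | point y<N
    ... | pt x | pt y = begin
      val (rots r M) _              ≡⟨ cong (val (rots r M)) (shift-unique N r (toℕ x) _ _ sx (ρs-shift r x r≤N)) ⟩
      val (rots r M) (toℕ (ρs r x)) ≡⟨ lookup⇒val (rots r M) (trans (rots-lookup r M x) (cong (ρs r) (val⇒lookup M eq))) ⟩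
      toℕ (ρs r y)                  ≡⟨ shift-unique N r (toℕ y) _ _ (ρs-shift r y r≤N) sy ⟩
      _                             ∎
      where open ≡-Reasoning

  module _ {n : ℕ} where

    rots-NCM : ∀ r {M} → IsNCM n M → IsNCM n (rots r M)
    rots-NCM zero    ncm = ncm
    rots-NCM (suc r) {M} ncm = rot-NCM {n} {rots r M} (rots-NCM r {M} ncm)

    -- One step forward is enough to move backward too, because the full turn of `2 * n` steps is
    -- the identity.
    record RotationStable (P : PM n → Set) : Set where
      field stable : ∀ M → IsNCM n M → P M → P (rot M)

      stable* : ∀ r M → IsNCM n M → P M → P (rots r M)
      stable* zero    M ncm p = p
      stable* (suc r) M ncm p = stable (rots r M) (rots-NCM r {M} ncm) (stable* r M ncm p)

      unrotate : ∀ {r} M → r ≤ 2 * n → IsNCM n M → P (rots r M) → P M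
      unrotate {r} M r≤N ncm p = subst P (rots-inverse M r≤N)
        (stable* (2 * n ∸ r) (rots r M) (rots-NCM r {M} ncm) p)

    open RotationStable public

    Adj-stable : ∀ k → RotationStable λ M → AtLeast (Adj n M) k
    Adj-stable k = record { stable = λ M ncm → AtLeast-map rot rot-injective (λ {M′} → rot-Adj {n} {M} {M′} ncm) }

    rots-Adj : ∀ r {M M′} → IsNCM n M → Adj n M M′ → Adj n (rots r M) (rots r M′)
    rots-Adj zero    ncm A = A
    rots-Adj (suc r) {M} {M′} ncm A =
      rot-Adj {n} {rots r M} {rots r M′} (rots-NCM r {M} ncm) (rots-Adj r {M} {M′} ncm A)

    -- Every neighbour of the rotated matching is hit: rotating it by `2 * n ∸ 1` further steps
    -- undoes the rotation and gives a neighbour of `M`.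
    Deg-stable : 1 ≤ 2 * n → ∀ k → RotationStable λ M → Deg n M k
    Deg-stable 1≤N k = record { stable = go }
      where
      go : ∀ M → IsNCM n M → Deg n M k → Deg n (rot M) k
      go M ncm (L , u , len , iff) =
        map rot L , Unique.map⁺ rot-injective u , trans (length-map rot L) len , λ M′ → mk⇔ to (from M′)
        where
        to : ∀ {M′} → M′ ∈ map rot L → Adj n (rot M) M′
        to M′∈ with ∈-map⁻ rot M′∈
        ... | M″ , M″∈ , refl = rot-Adj {n} {M} {M″} ncm (Equivalence.to (iff M″) M″∈)
        from : ∀ M′ → Adj n (rot M) M′ → M′ ∈ map rot L
        from M′ A = subst (_∈ map rot L) rot-back (∈-map⁺ rot (Equivalence.from (iff back)
          (subst (λ V → Adj n V back) (rots-inverse M 1≤N)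
            (rots-Adj (2 * n ∸ 1) {rot M} {M′} (rot-NCM {n} {M} ncm) A))))
          where
          back = rots (2 * n ∸ 1) M′
          rot-back : rot back ≡ M′
          rot-back = trans (cong (λ r → rots r M′) (m+[n∸m]≡n 1≤N)) (rots-cycle M′)

    module _ {P : PM n → Set} (stab : RotationStable P)
             (short : ∀ {M} (ncm : IsNCM n M) → Central.Short {n} {M} ncm → P M)
             (diam  : ∀ {M} → IsNCM n M → val M 0 ≡ n → P M) (0<n : 0 < n) where

      private
        -- As long as the face at the origin does not contain the centre, move the origin across the
        -- edge that separates them; the longest edge seen from the origin gets shorter.
        go : ∀ k M (ncm : IsNCM n M) → (∀ {a b} → Top (Central.R {n} {M} ncm) a b → b < a + k) → P M
        go k M ncm bound = cases (<-cmp B.b (B.a + n))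
          where
          open Central {n} {M} ncm
          B : Block R n
          B = block R (linear (n ∷ []) (λ n → con 0 :< n :⇒ n :< 2 :* n) 0<n)
          module B = Block B
          -- A block that spans at least `n` steps must contain the point `n`, so only `B` has to be
          -- compared with `n`.
          isShort : B.b < B.a + n → Short
          isShort p {a} {b} t with b <? a + n
          ... | yes q = q
          ... | no ¬q with <-cmp B.a a
          ...   | tri< r _ _ = ⊥-elim (linear (B.a ∷ B.b ∷ a ∷ b ∷ n ∷ []) (λ a b a′ b′ n →
                    :¬ (b′ :< a′ :+ n) :⇒ b′ :< 2 :* n :⇒ n :≤ b :⇒ b :< a′ :⇒ :⊥)
                    ¬q (Top.b<N t) B.x≤b (top-< R B.top t r))
          ...   | tri> _ _ r = ⊥-elim (linear (B.a ∷ B.b ∷ a ∷ b ∷ n ∷ []) (λ a b a′ b′ n →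
                    :¬ (b′ :< a′ :+ n) :⇒ a :≤ n :⇒ b′ :< a :⇒ :⊥)
                    ¬q B.a≤x (top-< R t B.top r))
          ...   | tri≈ _ r _ = ⊥-elim (¬q (subst₂ (λ x y → y < x + n) r
                    (trans (sym B.partner) (trans (cong (val M) r) (Top.partner t))) p))
          a<N : B.a < 2 * n
          a<N = <-trans B.a<b B.b<N
          cases : Tri (B.b < B.a + n) (B.b ≡ B.a + n) (B.a + n < B.b) → P M
          cases (tri< p _ _) = short ncm (isShort p)
          -- The rotation moves `B.a` to `0`, and with it the diameter to `{0 , n}`.
          cases (tri≈ _ p _) = unrotate stab M (m∸n≤m _ B.a) ncm (diam (rots-NCM r {M} ncm)
            (rots-val M (m∸n≤m _ B.a) a<N B.b<N B.partner (inj₂ (≤-reflexive (sym a+r) , sym a+r))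
              (inj₂ (linear (B.a ∷ B.b ∷ r ∷ n ∷ []) (λ a b r n → a :+ r :≡ 2 :* n :⇒ b :≡ a :+ n :⇒
                2 :* n :≤ b :+ r :∧ n :+ 2 :* n :≡ b :+ r) a+r p))))
            where
            r = 2 * n ∸ B.a
            a+r : B.a + r ≡ 2 * n
            a+r = m+[n∸m]≡n (<⇒≤ a<N)
          cases (tri> _ _ p) = further k bound
            where
            -- `B.b` moves to `0`: the origin is now on the other side of the edge, and `B.a` is the
            -- right end of the first block.
            r = 2 * n ∸ B.b
            b+r : B.b + r ≡ 2 * n
            b+r = m+[n∸m]≡n (<⇒≤ B.b<N)
            s = B.a + r
            ncm′ = rots-NCM r {M} ncm
            R′ = IsNCM⇒NC {n} {rots r M} ncm′
            val-0 : val (rots r M) 0 ≡ s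
            val-0 = rots-val M (m∸n≤m _ B.b) B.b<N a<N (NC.adjoint R B.partner) (inj₂ (≤-reflexive (sym b+r) , sym b+r))
              (inj₁ (subst (B.a + r <_) b+r (+-monoˡ-< r B.a<b) , refl))
            further : ∀ k → (∀ {a b} → Top R a b → b < a + k) → P M
            further zero    bound = ⊥-elim (<⇒≱ (bound B.top) (subst (_≤ B.b) (sym (+-identityʳ _)) (<⇒≤ B.a<b)))
            further (suc k) bound = unrotate stab M (m∸n≤m _ B.b) ncm (go k (rots r M) ncm′ bound′)
              where
              -- The first block is the old edge seen from the other side and spans
              -- `2n - (B.b - B.a) < n` steps; all further blocks lie behind it and span less than
              -- `B.b - B.a`.
              bound′ : ∀ {a b} → Top R′ a b → b < a + k
              bound′ {zero}  {b} t = linear (B.a ∷ B.b ∷ r ∷ b ∷ n ∷ k ∷ []) (λ a b r b′ n k →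
                a :+ n :< b :⇒ b :< a :+ (1+ k) :⇒ b :+ r :≡ 2 :* n :⇒ b′ :≡ a :+ r :⇒ b′ :< con 0 :+ k)
                p (bound B.top) b+r (trans (sym (Top.partner t)) val-0)
              bound′ {suc a} {b} t = linear (B.a ∷ B.b ∷ r ∷ a ∷ b ∷ n ∷ k ∷ []) (λ a b r a′ b′ n k →
                a :+ n :< b :⇒ b :< a :+ (1+ k) :⇒ b :+ r :≡ 2 :* n :⇒ b′ :< 2 :* n :⇒ a :+ r :< 1+ a′ :⇒
                b′ :< (1+ a′) :+ k)
                p (bound B.top) b+r (Top.b<N t) (subst (_< suc a) val-0 (Top.closed t (s≤s z≤n)))

      centre-induction : ∀ M → IsNCM n M → P M
      centre-induction M ncm = go (2 * n) M ncm λ {a} t → <-≤-trans (Top.b<N t) (m≤n+m _ a)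

open Rotation

-- Counting binary trees by ballot numbers

module CountingTrees where

  open import Data.List using (List; []; _∷_; _++_; map; length)
  open import Data.List.Membership.Propositional using (_∈_)
  open import Data.List.Membership.Propositional.Properties using (∈-map⁺; ∈-map⁻; ∈-++⁺ˡ; ∈-++⁺ʳ; ∈-++⁻)
  open import Data.List.Properties using (length-map; length-++)
  open import Data.List.Relation.Unary.All using ([]; _∷_)
  open import Data.List.Relation.Unary.AllPairs using ([]; _∷_)
  open import Data.List.Relation.Unary.Any using (here)
  open import Data.List.Relation.Unary.Unique.Propositional using (Unique)
  import Data.List.Relation.Unary.Unique.Propositional.Properties as Unique
  open import Data.Nat.Combinatorics using (_C_; nCk+nC[k+1]≡[n+1]C[k+1]; nCk≡nC[n∸k])
  open import Data.Nat.DivMod using (m*n/n≡m)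

  data Tree : Set where
    leaf : Tree
    node : Tree → Tree → Tree

  ∥_∥ : Tree → ℕ
  ∥ leaf ∥     = 0
  ∥ node l r ∥ = suc (∥ l ∥ + ∥ r ∥)

  total : ∀ {s} → Vec Tree s → ℕ
  total []      = 0
  total (t ∷ v) = ∥ t ∥ + total v

  join : ∀ {s} → Vec Tree (2 + s) → Vec Tree (1 + s)
  join (l ∷ r ∷ v) = node l r ∷ v

  -- The first tree of a forest is a leaf, or splits into two trees with one node less.
  forests : ∀ (k s : ℕ) → List (Vec Tree s)
  forests zero    zero    = [] ∷ []
  forests (suc k) zero    = []
  forests zero    (suc s) = map (leaf ∷_) (forests zero s)
  forests (suc k) (suc s) = map (leaf ∷_) (forests (suc k) s) ++ map join (forests k (2 + s))

  forests-sound : ∀ k s {v} → v ∈ forests k s → total v ≡ k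
  forests-sound zero    zero    (here refl) = refl
  forests-sound zero    (suc s) v∈ = leaf-sound (forests-sound zero s) (∈-map⁻ (leaf ∷_) v∈)
    where
    leaf-sound : ∀ {v : Vec Tree (suc s)} → (∀ {w} → w ∈ forests zero s → total w ≡ zero) →
                 ∃[ w ] (w ∈ forests zero s × v ≡ leaf ∷ w) → total v ≡ zero
    leaf-sound ih (_ , w∈ , refl) = ih w∈
  forests-sound (suc k) (suc s) v∈ =
    [ leaf-sound (forests-sound (suc k) s) ∘ ∈-map⁻ (leaf ∷_) , join-sound (forests-sound k (2 + s)) ∘ ∈-map⁻ join ]′
      (∈-++⁻ (map (leaf ∷_) (forests (suc k) s)) v∈)
    where
    leaf-sound : ∀ {v : Vec Tree (suc s)} → (∀ {w} → w ∈ forests (suc k) s → total w ≡ suc k) →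
                 ∃[ w ] (w ∈ forests (suc k) s × v ≡ leaf ∷ w) → total v ≡ suc k
    leaf-sound ih (_ , w∈ , refl) = ih w∈
    join-sound : ∀ {v : Vec Tree (suc s)} → (∀ {w} → w ∈ forests k (2 + s) → total w ≡ k) →
                 ∃[ w ] (w ∈ forests k (2 + s) × v ≡ join w) → total v ≡ suc k
    join-sound ih (l ∷ r ∷ w , w∈ , refl) = cong suc (trans (+-assoc ∥ l ∥ ∥ r ∥ (total w)) (ih w∈))

  forests-complete : ∀ k s (v : Vec Tree s) → total v ≡ k → v ∈ forests k s
  forests-complete zero    zero    []               eq = here refl
  forests-complete zero    (suc s) (leaf ∷ v)       eq = ∈-map⁺ _ (forests-complete zero s v eq)
  forests-complete (suc k) (suc s) (leaf ∷ v)       eq = ∈-++⁺ˡ (∈-map⁺ _ (forests-complete (suc k) s v eq))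
  forests-complete (suc k) (suc s) (node l r ∷ v)   eq = ∈-++⁺ʳ _ (∈-map⁺ join
    (forests-complete k (2 + s) (l ∷ r ∷ v) (trans (sym (+-assoc ∥ l ∥ ∥ r ∥ (total v))) (suc-injective eq))))

  join-injective : ∀ {s} {v w : Vec Tree (2 + s)} → join v ≡ join w → v ≡ w
  join-injective {v = _ ∷ _ ∷ _} {_ ∷ _ ∷ _} refl = refl

  leaf∷-injective : ∀ {s} {v w : Vec Tree s} → leaf ∷ v ≡ leaf ∷ w → v ≡ w
  leaf∷-injective refl = refl

  forests-unique : ∀ k s → Unique (forests k s)
  forests-unique zero    zero    = [] ∷ []
  forests-unique (suc k) zero    = []
  forests-unique zero    (suc s) = Unique.map⁺ leaf∷-injective (forests-unique zero s)
  forests-unique (suc k) (suc s) = Unique.++⁺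
    (Unique.map⁺ leaf∷-injective (forests-unique (suc k) s))
    (Unique.map⁺ join-injective (forests-unique k (2 + s)))
    λ (p , q) → disjoint (∈-map⁻ (leaf ∷_) p) (∈-map⁻ join q)
    where
    disjoint : ∀ {v} → ∃[ w ] (w ∈ forests (suc k) s × v ≡ leaf ∷ w) →
               ∃[ w ] (w ∈ forests k (2 + s) × v ≡ join w) → ⊥
    disjoint (_ , _ , refl) (_ ∷ _ ∷ _ , _ , ())

  pascal : ∀ n k → suc n C suc k ≡ n C k + n C suc k
  pascal n k = sym (nCk+nC[k+1]≡[n+1]C[k+1] n k)

  length-forests₀ : ∀ s → length (forests 0 s) ≡ 1
  length-forests₀ zero    = refl
  length-forests₀ (suc s) = trans (length-map _ (forests 0 s)) (length-forests₀ s)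

  length-forests-suc : ∀ k s → length (forests (suc k) (suc s)) ≡ length (forests (suc k) s) + length (forests k (2 + s))
  length-forests-suc k s = trans (length-++ (map (leaf ∷_) (forests (suc k) s)))
    (cong₂ _+_ (length-map _ (forests (suc k) s)) (length-map _ (forests k (2 + s))))

  C-sym : ∀ k → (3 + 2 * k) C (2 + k) ≡ (3 + 2 * k) C (1 + k)
  C-sym k = trans (nCk≡nC[n∸k] (linear (k ∷ []) (λ k → con 2 :+ k :≤ con 3 :+ 2 :* k)))
    (cong ((3 + 2 * k) C_) (trans (cong (_∸ (2 + k)) (linear (k ∷ []) (λ k → con 3 :+ 2 :* k :≡ 1+ k :+ (con 2 :+ k))))
      (m+n∸n≡m (1 + k) (2 + k))))

  -- For `K = k + 1` nodes and `S = s + 1` trees this is the ballot number `C(2K + S - 1 , K) - C(2K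
  -- + S - 1 , K - 1)`, written as a sum to avoid subtraction.
  Ballot : ℕ → ℕ → Set
  Ballot k s = length (forests (suc k) (suc s)) + (2 + 2 * k + s) C k ≡ (2 + 2 * k + s) C suc k

  -- For a single tree the recursion has one summand only; what Pascal's rule leaves over vanishes
  -- because the two middle coefficients of an odd row agree, which is `C-sym`.
  ballot-zero : ∀ k → Ballot k 1 → Ballot (suc k) 0
  ballot-zero k ih
    rewrite length-forests-suc (suc k) 0 | +-identityʳ (2 * suc k) | *-suc 2 k
          | pascal (3 + 2 * k) k | pascal (3 + 2 * k) (suc k) | C-sym k =
    linear (length (forests (suc k) 2) ∷ (3 + 2 * k) C k ∷ (3 + 2 * k) C suc k ∷ [])
      (λ B c₀ c₁ → B :+ c₀ :≡ c₁ :⇒ B :+ (c₀ :+ c₁) :≡ c₁ :+ c₁)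
      (subst (λ m → length (forests (suc k) 2) + m C k ≡ m C suc k)
        (linear (k ∷ []) (λ k → con 2 :+ 2 :* k :+ con 1 :≡ con 3 :+ 2 :* k)) ih)

  ballot-one : ∀ s → Ballot 0 s → Ballot 0 (suc s)
  ballot-one s ih
    rewrite length-forests-suc 0 (suc s) | length-forests₀ (3 + s) | pascal (2 + s) 0 =
    linear (length (forests 1 (suc s)) ∷ (2 + s) C 1 ∷ []) (λ B c → B :+ con 1 :≡ c :⇒ B :+ con 1 :+ con 1 :≡ 1+ c) ih

  -- Pascal's rule splits the coefficients in the same way as the recursion splits the forests.
  ballot-suc : ∀ k s → Ballot (suc k) s → Ballot k (2 + s) → Ballot (suc k) (suc s)
  ballot-suc k s ih ih′
    rewrite length-forests-suc (suc k) (suc s) | +-suc (2 * suc k) s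
          | pascal (2 + 2 * suc k + s) k | pascal (2 + 2 * suc k + s) (suc k) =
    linear (length (forests (2 + k) (suc s)) ∷ length (forests (suc k) (3 + s)) ∷ m C k ∷ m C suc k ∷ m C (2 + k) ∷ [])
      (λ B₁ B₂ c₀ c₁ c₂ → B₁ :+ c₁ :≡ c₂ :⇒ B₂ :+ c₀ :≡ c₁ :⇒ B₁ :+ B₂ :+ (c₀ :+ c₁) :≡ c₁ :+ c₂) ih
      (subst (λ m → length (forests (suc k) (3 + s)) + m C k ≡ m C suc k)
        (linear (k ∷ s ∷ []) (λ k s → con 2 :+ 2 :* k :+ (con 2 :+ s) :≡ con 2 :+ 2 :* (1+ k) :+ s)) ih′)
    where m = 2 + 2 * suc k + s

  ballot : ∀ k s → Ballot k s
  ballot zero    zero    = refl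
  ballot (suc k) zero    = ballot-zero k (ballot k 1)
  ballot zero    (suc s) = ballot-one s (ballot zero s)
  ballot (suc k) (suc s) = ballot-suc k s (ballot (suc k) s) (ballot k (2 + s))

  -- Relates neighbouring coefficients without division; this turns the ballot difference into the
  -- quotient in `Catalan`.
  absorption : ∀ n k → suc k * (suc n C suc k) ≡ suc n * (n C k)
  absorption zero    zero    = refl
  absorption zero    (suc k) = *-zeroʳ (2 + k)
  absorption (suc n) zero    rewrite pascal (suc n) 0 | +-identityʳ (1 + suc n C 1)
                                   | *-identityʳ (2 + n) = cong suc (trans (sym (+-identityʳ _)) (trans (absorption n 0) (*-identityʳ _)))
  absorption (suc n) (suc k) = begin
    suc (suc k) * (suc (suc n) C suc (suc k))
      ≡⟨ cong (suc (suc k) *_) (pascal (suc n) (suc k)) ⟩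
    suc (suc k) * (suc n C suc k + suc n C suc (suc k))
      ≡⟨ *-distribˡ-+ (suc (suc k)) (suc n C suc k) _ ⟩
    suc n C suc k + suc k * (suc n C suc k) + suc (suc k) * (suc n C suc (suc k))
      ≡⟨ cong₂ (λ p q → suc n C suc k + p + q) (absorption n k) (absorption n (suc k)) ⟩
    suc n C suc k + suc n * (n C k) + suc n * (n C suc k)
      ≡⟨ +-assoc (suc n C suc k) _ _ ⟩
    suc n C suc k + (suc n * (n C k) + suc n * (n C suc k))
      ≡⟨ cong (suc n C suc k +_) (*-distribˡ-+ (suc n) (n C k) _) ⟨
    suc n C suc k + suc n * (n C k + n C suc k)
      ≡⟨ cong (λ c → suc n C suc k + suc n * c) (pascal n k) ⟨
    suc (suc n) * (suc n C suc k) ∎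
    where open ≡-Reasoning

  length-forests₁ : ∀ k → length (forests k 1) ≡ Catalan k
  length-forests₁ zero = refl
  length-forests₁ (suc k) = sym (trans (cong (_/ suc (suc k)) (trans central (*-comm (suc (suc k)) B))) (m*n/n≡m B (suc (suc k))))
    where
    open ≡-Reasoning
    B = length (forests (suc k) 1)
    N = 2 * suc k
    X = N C suc k
    Y = N C k
    B+Y : B + Y ≡ X
    B+Y = subst (λ m → B + m C k ≡ m C suc k)
      (linear (k ∷ []) (λ k → con 2 :+ 2 :* k :+ con 0 :≡ 2 :* (1+ k))) (ballot k 0)
    absorbed : suc k * Y + suc k * X ≡ suc N * Y
    absorbed = trans (sym (*-distribˡ-+ (suc k) Y X)) (trans (cong (suc k *_) (sym (pascal N k))) (absorption N k))
    expand : suc N * Y ≡ Y + (suc k * Y + suc k * Y)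
    expand = cong (Y +_) (trans (*-distribʳ-+ Y (suc k) (suc k + 0)) (cong (λ m → suc k * Y + m * Y) (+-identityʳ (suc k))))
    -- Since `B = X - Y` and `(k + 1) X = (k + 2) Y`, the product `(k + 2) B` equals
    -- `(k + 2) X - (k + 1) X = X`. The products enter `linear` as variables.
    central : X ≡ suc (suc k) * B
    central = linear (suc k * X ∷ suc k * Y ∷ suc k * B ∷ X ∷ Y ∷ B ∷ [])
      (λ p q r X Y B → q :+ p :≡ Y :+ (q :+ q) :⇒ r :+ q :≡ p :⇒ B :+ Y :≡ X :⇒ X :≡ B :+ r)
      (trans absorbed expand) (trans (sym (*-distribˡ-+ (suc k) B Y)) (cong (suc k *_) B+Y)) B+Y

  root : Vec Tree 1 → Tree
  root (t ∷ []) = t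

  trees : ℕ → List Tree
  trees k = map root (forests k 1)

  trees-sound : ∀ {k t} → t ∈ trees k → ∥ t ∥ ≡ k
  trees-sound {k} t∈ with ∈-map⁻ root t∈
  ... | t ∷ [] , v∈ , refl = trans (sym (+-identityʳ ∥ t ∥)) (forests-sound k 1 v∈)

  trees-complete : ∀ t → t ∈ trees ∥ t ∥
  trees-complete t = ∈-map⁺ root (forests-complete ∥ t ∥ 1 (t ∷ []) (+-identityʳ ∥ t ∥))

  trees-unique : ∀ k → Unique (trees k)
  trees-unique k = Unique.map⁺ (λ { {_ ∷ []} {_ ∷ []} refl → refl }) (forests-unique k 1)

  length-trees : ∀ k → length (trees k) ≡ Catalan k
  length-trees k = trans (length-map root (forests k 1)) (length-forests₁ k)

open CountingTrees

-- The correspondence between binary trees and matchings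

module Encoding where

  closing : Tree → ℕ → ℕ
  closing l o = suc o + 2 * ∥ l ∥

  -- node l r is an edge from the first point of the interval that encloses the matching of l and is
  -- followed by the matching of r; outside of the interval at o the function is the identity.
  enc : Tree → ℕ → ℕ → ℕ
  enc leaf       o x = x
  enc (node l r) o x with x ≟ o | <-cmp x (closing l o)
  ... | yes _ | _          = closing l o
  ... | no  _ | tri< _ _ _ = enc l (suc o) x
  ... | no  _ | tri≈ _ _ _ = o
  ... | no  _ | tri> _ _ _ = enc r (suc (closing l o)) x

  module _ (l r : Tree) (o : ℕ) where

    private m = closing l o

    o<closing : o < m
    o<closing = s≤s (m≤m+n o _)

    enc-open : enc (node l r) o o ≡ m
    enc-open with o ≟ o | <-cmp o m
    ... | yes _ | _ = refl
    ... | no ¬p | _ = ⊥-elim (¬p refl)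

    enc-close : enc (node l r) o m ≡ o
    enc-close with m ≟ o | <-cmp m m
    ... | yes p | _ = p
    ... | no  _ | tri< _ p _ = ⊥-elim (p refl)
    ... | no  _ | tri≈ _ _ _ = refl
    ... | no  _ | tri> _ p _ = ⊥-elim (p refl)

    enc-left : ∀ {x} → x ≢ o → x < m → enc (node l r) o x ≡ enc l (suc o) x
    enc-left {x} p q with x ≟ o | <-cmp x m
    ... | yes e | _          = ⊥-elim (p e)
    ... | no  _ | tri< _ _ _ = refl
    ... | no  _ | tri≈ e _ _ = ⊥-elim (e q)
    ... | no  _ | tri> e _ _ = ⊥-elim (e q)

    enc-right : ∀ {x} → m < x → enc (node l r) o x ≡ enc r (suc m) x
    enc-right {x} q with x ≟ o | <-cmp x m
    ... | yes refl | _       = ⊥-elim (<-asym q o<closing)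
    ... | no  _ | tri< e _ _ = ⊥-elim (<-asym q e)
    ... | no  _ | tri≈ _ e _ = ⊥-elim (<-irrefl (sym e) q)
    ... | no  _ | tri> _ _ _ = refl

  -- `NC` for the interval `[o , e)`; the clause `out` matches the convention that `val` is the
  -- identity beyond the last point.
  record IntervalNC (o e : ℕ) (f : ℕ → ℕ) : Set where
    field
      out   : ∀ {x} → x < o ⊎ e ≤ x → f x ≡ x
      inv   : ∀ x → f (f x) ≡ x
      range : ∀ {x} → o ≤ x → x < e → o ≤ f x × f x < e
      nofix : ∀ {x} → o ≤ x → x < e → f x ≢ x
      nest  : ∀ {i j} → i < j → j < f i → i < f j × f j < f i

  end : Tree → ℕ → ℕ
  end t o = o + 2 * ∥ t ∥

  end-node : ∀ l r o → end r (suc (closing l o)) ≡ end (node l r) o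
  end-node l r o = linear (o ∷ ∥ l ∥ ∷ ∥ r ∥ ∷ [])
    (λ o l r → 1+ (1+ o :+ 2 :* l) :+ 2 :* r :≡ o :+ 2 :* (1+ (l :+ r)))

  enc-NC : ∀ t o → IntervalNC o (end t o) (enc t o)
  enc-NC leaf o = record
    { out = λ _ → refl ; inv = λ _ → refl
    ; range = λ p q → ⊥-elim (empty p q)
    ; nofix = λ p q _ → empty p q
    ; nest = λ p q → ⊥-elim (<-asym p q) }
    where
    empty : ∀ {x} → o ≤ x → x < o + 0 → ⊥
    empty p q = <⇒≱ q (subst (_≤ _) (sym (+-identityʳ o)) p)
  enc-NC (node l r) o = record
    { out = out ; inv = λ x → inv x (view x) ; range = λ {x} p q → range (view x) p q
    ; nofix = λ {x} p q → nofix (view x) p q ; nest = λ {i} p q → nest (view i) p q }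
    where
    module L = IntervalNC (enc-NC l (suc o))
    module R = IntervalNC (enc-NC r (suc (closing l o)))
    f = enc (node l r) o
    m = closing l o
    e = end (node l r) o
    e≡ : end r (suc m) ≡ e
    e≡ = end-node l r o
    o<m : o < m
    o<m = o<closing l r o
    m<e : m < e
    m<e = subst (m <_) e≡ (m≤m+n (suc m) _)
    data View (x : ℕ) : Set where
      opens  : x ≡ o → View x
      closes : x ≡ m → View x
      left   : o < x → x < m → View x
      right  : m < x → x < e → View x
      away    : x < o ⊎ e ≤ x → View x
    view : ∀ x → View x
    view x with <-cmp x o | <-cmp x m | x <? e
    ... | tri< p _ _ | _          | _     = away (inj₁ p)
    ... | tri≈ _ p _ | _          | _     = opens p
    ... | tri> _ _ p | tri< q _ _ | _     = left p q
    ... | tri> _ _ p | tri≈ _ q _ | _     = closes q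
    ... | tri> _ _ p | tri> _ _ q | yes s = right q s
    ... | tri> _ _ p | tri> _ _ q | no ¬s = away (inj₂ (≮⇒≥ ¬s))
    out : ∀ {x} → x < o ⊎ e ≤ x → f x ≡ x
    out (inj₁ p) = trans (enc-left l r o (<⇒≢ p) (<-trans p o<m)) (L.out (inj₁ (<-trans p ≤-refl)))
    out {x} (inj₂ p) = trans (enc-right l r o (<-≤-trans m<e p)) (R.out (inj₂ (subst (_≤ x) (sym e≡) p)))
    f-left : ∀ {x} → o < x → x < m → f x ≡ enc l (suc o) x
    f-left p q = enc-left l r o (<⇒≢ p ∘ sym) q
    f-right : ∀ {x} → m < x → f x ≡ enc r (suc m) x
    f-right = enc-right l r o
    in-left : ∀ {x} → o < x → x < m → o < f x × f x < m
    in-left p q = subst (λ y → o < y × y < m) (sym (f-left p q)) (L.range p q)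
    in-right : ∀ {x} → m < x → x < e → m < f x × f x < e
    in-right {x} p q = subst (λ y → m < y × y < e) (sym (f-right p))
      (subst (λ e → m < enc r (suc m) x × enc r (suc m) x < e) e≡ (R.range p (subst (x <_) (sym e≡) q)))
    inv : ∀ x → View x → f (f x) ≡ x
    inv x (opens refl)  = trans (cong f (enc-open l r o)) (enc-close l r o)
    inv x (closes refl) = trans (cong f (enc-close l r o)) (enc-open l r o)
    inv x (left p q)    = let p′ , q′ = in-left p q in
      trans (f-left p′ q′) (trans (cong (enc l (suc o)) (f-left p q)) (L.inv x))
    inv x (right p q)   = trans (f-right (proj₁ (in-right p q))) (trans (cong (enc r (suc m)) (f-right p)) (R.inv x))
    inv x (away h)       = trans (cong f (out h)) (out h)
    range : ∀ {x} → View x → o ≤ x → x < e → o ≤ f x × f x < e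
    range (opens refl)  _ _ = subst (λ y → o ≤ y × y < e) (sym (enc-open l r o)) (<⇒≤ o<m , m<e)
    range (closes refl) _ _ = subst (λ y → o ≤ y × y < e) (sym (enc-close l r o)) (≤-refl , <-trans o<m m<e)
    range (left p q)    _ _ = let p′ , q′ = in-left p q in <⇒≤ p′ , <-trans q′ m<e
    range (right p q)   _ _ = let p′ , q′ = in-right p q in <⇒≤ (<-trans o<m p′) , q′
    range (away (inj₁ h)) p _ = ⊥-elim (<⇒≱ h p)
    range (away (inj₂ h)) _ q = ⊥-elim (<⇒≱ q h)
    nofix : ∀ {x} → View x → o ≤ x → x < e → f x ≢ x
    nofix (opens refl)  _ _ eq = <⇒≢ o<m (trans (sym eq) (enc-open l r o))
    nofix (closes refl) _ _ eq = <⇒≢ o<m (trans (sym (enc-close l r o)) eq)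
    nofix (left p q)    _ _ eq = L.nofix p q (trans (sym (f-left p q)) eq)
    nofix {x} (right p q) _ _ eq = R.nofix p (subst (x <_) (sym e≡) q) (trans (sym (f-right p)) eq)
    nofix (away (inj₁ h)) p _ = ⊥-elim (<⇒≱ h p)
    nofix (away (inj₂ h)) _ q = ⊥-elim (<⇒≱ q h)
    nest : ∀ {i j} → View i → i < j → j < f i → i < f j × f j < f i
    nest {j = j} (opens refl) p q = subst (λ y → o < f j × f j < y) (sym (enc-open l r o))
      (in-left p (subst (j <_) (enc-open l r o) q))
    nest {j = j} (closes refl) p q = ⊥-elim (<-asym (<-trans o<m p) (subst (j <_) (enc-close l r o) q))
    nest {i} {j} (left o<i i<m) p q = subst₂ (λ x y → i < x × x < y) (sym j≡) (sym i≡) (L.nest p (subst (j <_) i≡ q))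
      where
      i≡ = f-left o<i i<m
      j≡ = f-left (<-trans o<i p) (<-trans q (proj₂ (in-left o<i i<m)))
    nest {i} {j} (right m<i i<e) p q = subst₂ (λ x y → i < x × x < y) (sym j≡) (sym i≡) (R.nest p (subst (j <_) i≡ q))
      where
      i≡ = f-right m<i
      j≡ = f-right (<-trans m<i p)
    nest {j = j} (away h) p q = ⊥-elim (<-asym p (subst (j <_) (out h) q))

  -- The partner of the first point fixes the size of the left subtree and thus the interval of each
  -- subtree, on which the encodings agree again.
  enc-injective : ∀ t t′ o → ∥ t ∥ ≡ ∥ t′ ∥ → (∀ {x} → o ≤ x → x < end t o → enc t o x ≡ enc t′ o x) → t ≡ t′
  enc-injective leaf       leaf         o _  _ = refl
  enc-injective (node l r) (node l′ r′) o eq h = cong₂ node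
    (enc-injective l l′ (suc o) l≡ (λ {x} p q → trans (sym (enc-left l r o (<⇒≢ p ∘ sym) q))
      (trans (h (<⇒≤ p) (<-trans q m<e)) (enc-left l′ r′ o (<⇒≢ p ∘ sym) (subst (x <_) m≡ q)))))
    (enc-injective r r′ (suc (closing l o)) r≡ (λ {x} p q → trans (sym (enc-right l r o p))
      (trans (h (<⇒≤ (<-trans (o<closing l r o) p)) (subst (x <_) (end-node l r o) q))
        (trans (enc-right l′ r′ o (subst (_< x) m≡ p)) (cong (λ m → enc r′ (suc m) x) (sym m≡))))))
    where
    m<e : closing l o < end (node l r) o
    m<e = subst (closing l o <_) (end-node l r o) (m≤m+n (suc (closing l o)) _)
    m≡ : closing l o ≡ closing l′ o
    m≡ = trans (sym (enc-open l r o)) (trans (h ≤-refl (<-trans (o<closing l r o) m<e)) (enc-open l′ r′ o))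
    l≡ : ∥ l ∥ ≡ ∥ l′ ∥
    l≡ = linear (o ∷ ∥ l ∥ ∷ ∥ l′ ∥ ∷ []) (λ o l l′ → 1+ o :+ 2 :* l :≡ 1+ o :+ 2 :* l′ :⇒ l :≡ l′) m≡
    r≡ : ∥ r ∥ ≡ ∥ r′ ∥
    r≡ = +-cancelˡ-≡ ∥ l ∥ _ _ (trans (suc-injective eq) (cong (_+ ∥ r′ ∥) (sym l≡)))

  module _ {N f} (R : NC N f) where
    open NC R

    -- The edge at the first point splits a closed interval into the part under it and the part
    -- behind it, both closed. Their lengths arise by subtraction, so the recursion runs on `fuel`.
    decode : ∀ fuel o k → k ≤ fuel → o + k ≤ N → (∀ {x} → o ≤ x → x < o + k → o ≤ f x × f x < o + k) →
             ∃[ t ] 2 * ∥ t ∥ ≡ k × (∀ {x} → o ≤ x → x < o + k → f x ≡ enc t o x)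
    decode fuel o zero _ _ _ = leaf , refl , λ p q → ⊥-elim (<⇒≱ q (subst (_≤ _) (sym (+-identityʳ o)) p))
    decode (suc fuel) o (suc k) (s≤s k≤) e≤N cl =
      let l , l≡ , hl = decode fuel (suc o) kl kl≤ (≤-trans (≤-reflexive l-end) (<⇒≤ (<-≤-trans b<e e≤N))) cl-l
          r , r≡ , hr = decode fuel (suc b) kr kr≤ (≤-trans (≤-reflexive r-end) e≤N) cl-r
          b≡ : b ≡ closing l o
          b≡ = trans (sym l-end) (cong (suc o +_) (sym l≡))
      in node l r , size l r l≡ r≡ , λ {x} p q → agree l r b≡ hl hr p q (<-cmp x o) (<-cmp x b)
      where
      b = f o
      e = o + suc k
      o<e : o < e
      o<e = m<m+n o (s≤s z≤n)
      b<e : b < e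
      b<e = proj₂ (cl ≤-refl o<e)
      o<b : o < b
      o<b = ≤∧≢⇒< (proj₁ (cl ≤-refl o<e)) (nofix (<-≤-trans o<e e≤N) ∘ sym)
      kl = b ∸ suc o
      kr = e ∸ suc b
      l-end : suc o + kl ≡ b
      l-end = m+[n∸m]≡n o<b
      r-end : suc b + kr ≡ e
      r-end = m+[n∸m]≡n b<e
      kl≤ : kl ≤ fuel
      kl≤ = linear (kl ∷ b ∷ o ∷ k ∷ fuel ∷ []) (λ l b o k u → 1+ o :+ l :≡ b :⇒ b :< o :+ (1+ k) :⇒ k :≤ u :⇒ l :≤ u) l-end b<e k≤
      kr≤ : kr ≤ fuel
      kr≤ = linear (kr ∷ b ∷ o ∷ k ∷ fuel ∷ []) (λ r b o k u → 1+ b :+ r :≡ o :+ (1+ k) :⇒ o :< b :⇒ k :≤ u :⇒ r :≤ u) r-end o<b k≤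
      cl-l : ∀ {x} → suc o ≤ x → x < suc o + kl → suc o ≤ f x × f x < suc o + kl
      cl-l {x} p q = subst (λ b → o < f x × f x < b) (sym l-end) (nest p (subst (x <_) l-end q))
      cl-r : ∀ {x} → suc b ≤ x → x < suc b + kr → suc b ≤ f x × f x < suc b + kr
      cl-r {x} p q = subst (λ e → b < f x × f x < e) (sym r-end) (above (<-cmp (f x) o) (<-cmp (f x) b) , proj₂ fx)
        where
        fx : o ≤ f x × f x < e
        fx = cl (<⇒≤ (<-trans o<b p)) (subst (x <_) r-end q)
        -- A point behind `b` is not matched to an end of the edge `{o , b}`, nor to a point under
        -- it, since those are matched among themselves.
        above : Tri (f x < o) (f x ≡ o) (o < f x) → Tri (f x < b) (f x ≡ b) (b < f x) → b < f x
        above _ (tri> _ _ b<fx) = b<fx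
        above (tri< fx<o _ _) _ = ⊥-elim (<⇒≱ fx<o (proj₁ fx))
        above (tri≈ _ fx≡o _) _ = ⊥-elim (<-irrefl (adjoint fx≡o) p)
        above _ (tri≈ _ fx≡b _) = ⊥-elim (<-asym o<b (subst (b <_) (injective fx≡b) p))
        above (tri> _ _ o<fx) (tri< fx<b _ _) = ⊥-elim (<-asym p (subst (_< b) (inv x) (proj₂ (nest o<fx fx<b))))
      size : ∀ l r → 2 * ∥ l ∥ ≡ kl → 2 * ∥ r ∥ ≡ kr → 2 * ∥ node l r ∥ ≡ suc k
      size l r l≡ r≡ = linear (∥ l ∥ ∷ ∥ r ∥ ∷ kl ∷ kr ∷ b ∷ o ∷ k ∷ []) (λ l r kl kr b o k →
        2 :* l :≡ kl :⇒ 2 :* r :≡ kr :⇒ 1+ o :+ kl :≡ b :⇒ 1+ b :+ kr :≡ o :+ (1+ k) :⇒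
        2 :* (1+ (l :+ r)) :≡ 1+ k) l≡ r≡ l-end r-end
      agree : ∀ l r → b ≡ closing l o → (∀ {x} → suc o ≤ x → x < suc o + kl → f x ≡ enc l (suc o) x) →
              (∀ {x} → suc b ≤ x → x < suc b + kr → f x ≡ enc r (suc b) x) →
              ∀ {x} → o ≤ x → x < e → Tri (x < o) (x ≡ o) (o < x) → Tri (x < b) (x ≡ b) (b < x) →
              f x ≡ enc (node l r) o x
      agree l r b≡ hl hr p q (tri< x<o _ _) _ = ⊥-elim (<⇒≱ x<o p)
      agree l r b≡ hl hr p q (tri≈ _ refl _) _ = trans b≡ (sym (enc-open l r o))
      agree l r b≡ hl hr {x} p q (tri> _ _ o<x) (tri< x<b _ _) =
        trans (hl o<x (subst (x <_) (sym l-end) x<b)) (sym (enc-left l r o (<⇒≢ o<x ∘ sym) (subst (x <_) b≡ x<b)))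
      agree l r b≡ hl hr {x} p q _ (tri≈ _ x≡b _) =
        trans (cong f x≡b) (trans (inv o) (sym (trans (cong (enc (node l r) o) (trans x≡b b≡)) (enc-close l r o))))
      agree l r b≡ hl hr {x} p q _ (tri> _ _ b<x) = trans (hr b<x (subst (x <_) (sym r-end) q))
        (trans (cong (λ b → enc r (suc b) x) b≡) (sym (enc-right l r o (subst (_< x) b≡ b<x))))

  NC-cong : ∀ {N f g} → (∀ x → f x ≡ g x) → NC N f → NC N g
  NC-cong {N} {f} {g} h R = record
    { inv   = λ x → trans (sym (h (g x))) (trans (cong f (sym (h x))) (inv x))
    ; dom   = λ p → subst (_< N) (h _) (dom p)
    ; nofix = λ p eq → nofix p (trans (h _) eq)
    ; nest  = λ {i} {j} p q → subst₂ (λ x y → i < x × x < y) (h j) (h i) (nest p (subst (j <_) (sym (h i)) q)) }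
    where open NC R

  enc-dom : ∀ t {x} → x < 2 * ∥ t ∥ → enc t 0 x < 2 * ∥ t ∥
  enc-dom t p = proj₂ (IntervalNC.range (enc-NC t 0) z≤n p)

  module _ {n : ℕ} where

    encode : (t : Tree) → ∥ t ∥ ≡ n → PM n
    encode t refl = fromFun (enc t 0) (enc-dom t)

    val-encode : ∀ t (eq : ∥ t ∥ ≡ n) x → enc t 0 x ≡ val (encode t eq) x
    val-encode t refl x with x <? 2 * n
    ... | yes p = sym (val-fromFun (enc t 0) (enc-dom t) p)
    ... | no ¬p = trans (IntervalNC.out (enc-NC t 0) (inj₂ (≮⇒≥ ¬p))) (sym (val-out (encode t refl) (≮⇒≥ ¬p)))

    encode-NCM : ∀ t eq → IsNCM n (encode t eq)
    encode-NCM t refl = NC⇒IsNCM {n} {encode t refl} (NC-cong (val-encode t refl) record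
      { inv = E.inv ; dom = λ p → proj₂ (E.range z≤n p) ; nofix = λ p → E.nofix z≤n p ; nest = E.nest })
      where module E = IntervalNC (enc-NC t 0)

    encode-injective : ∀ {t t′} eq eq′ → encode t eq ≡ encode t′ eq′ → t ≡ t′
    encode-injective {t} {t′} refl eq′ e = enc-injective t t′ 0 (sym eq′) λ {x} _ _ →
      trans (val-encode t refl x) (trans (cong (λ M → val M x) e) (sym (val-encode t′ eq′ x)))

    encode-surjective : ∀ {M} → IsNCM n M → ∃[ t ] Σ (∥ t ∥ ≡ n) λ eq → encode t eq ≡ M
    encode-surjective {M} ncm =
      let t , size , h = decode R (2 * n) 0 (2 * n) ≤-refl ≤-refl (λ _ p → z≤n , NC.dom R p)
          eq = *-cancelˡ-≡ ∥ t ∥ n 2 size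
      in t , eq , val-ext (λ {x} p → trans (sym (val-encode t eq x)) (sym (h z≤n p)))
      where R = IsNCM⇒NC {n} {M} ncm

open Encoding

-- Edge lengths and the extremal shapes

module Shapes where

  open import Data.Fin using (toℕ)
  open import Data.Fin.Properties using (toℕ-injective; toℕ<n)
  open import Data.List using ([]; _∷_)
  open import Data.List.Relation.Unary.All using ([]; _∷_)
  open import Data.List.Relation.Unary.AllPairs using ([]; _∷_)
  open import Data.List.Relation.Unary.Any using (here; there)
  open import Data.Vec using (lookup)
  open import Relation.Nullary.Decidable using (_⊎-dec_)

  module _ {n : ℕ} {M : PM n} (ncm : IsNCM n M) where

    private
      R = IsNCM⇒NC {n} {M} ncm
      f = val M
      N = 2 * n
      pm = proj₁ ncm
    open NC R

    module _ {x : Pt n} (rep : toℕ x < toℕ (lookup M x)) where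
      private
        i = toℕ x
        j = toℕ (lookup M x)
        fi : f i ≡ j
        fi = val-toℕ M x

        nest-ij : ∀ {y : Pt n} → i < toℕ y → toℕ y < j → i < toℕ (lookup M y) × toℕ (lookup M y) < j
        nest-ij {y} p q = subst₂ (λ u v → i < u × u < v) (val-toℕ M y) fi (nest p (subst (toℕ y <_) (sym fi) q))

        i<⇒btw : ∀ {y} → Btw i j y → i < y × y < j
        i<⇒btw (inj₁ p)       = p
        i<⇒btw (inj₂ (p , q)) = ⊥-elim (<-asym rep (<-trans p q))

      -- By non-crossing the points under an edge are matched among themselves, so their number is
      -- even. Together with `edgesOutside-span` this turns lengths into positions.
      edgesInside-span : suc i + 2 * edgesInside n M x (lookup M x) ≡ j
      edgesInside-span = trans (cong (suc i +_)
        (#-matched (between (suc i) j) _ (lookup M) (proj₁ ∘ pm) (proj₂ ∘ pm) (λ (p , q) → nest-ij p q)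
          (λ {y} y<My (p , q) → y<My , ⇒sep {n} {y} {x} {lookup M x} (inj₁ (p , q)) ,
             ⇒sep {n} {lookup M y} {x} {lookup M x} (inj₁ (nest-ij p q)))
          (λ {y} (y<My , s , _) → y<My , i<⇒btw (sep⇒ {n} {y} {x} {lookup M x} s))))
        (#-between (suc i) j rep (<⇒≤ (toℕ<n (lookup M x))))

      private
        Beyond : Pt n → Set
        Beyond y = toℕ y < i ⊎ suc j ≤ toℕ y

        beyond⇒outside : ∀ {y} → Beyond y → outside n x (lookup M x) y
        beyond⇒outside {y} h = (λ { refl → absurd₁ h }) , (λ { refl → absurd₂ h }) , λ s → absurd₃ h (i<⇒btw (sep⇒ {n} {y} {x} {lookup M x} s))
          where
          absurd₁ : i < i ⊎ suc j ≤ i → ⊥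
          absurd₁ = linear (i ∷ j ∷ []) (λ i j → i :< j :⇒ (i :< i :∨ 1+ j :≤ i) :⇒ :⊥) rep
          absurd₂ : j < i ⊎ suc j ≤ j → ⊥
          absurd₂ = linear (i ∷ j ∷ []) (λ i j → i :< j :⇒ (j :< i :∨ 1+ j :≤ j) :⇒ :⊥) rep
          absurd₃ : ∀ {y} → y < i ⊎ suc j ≤ y → i < y × y < j → ⊥
          absurd₃ {y} = linear (i ∷ j ∷ y ∷ []) (λ i j y → (y :< i :∨ 1+ j :≤ y) :⇒ i :< y :∧ y :< j :⇒ :⊥)

        outside⇒beyond : ∀ {y} → outside n x (lookup M x) y → Beyond y
        outside⇒beyond {y} (p , q , r) with <-cmp (toℕ y) i | <-cmp (toℕ y) j
        ... | tri< y<i _ _ | _            = inj₁ y<i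
        ... | tri≈ _ y≡i _ | _            = ⊥-elim (p (toℕ-injective y≡i))
        ... | _            | tri> _ _ j<y = inj₂ j<y
        ... | _            | tri≈ _ y≡j _ = ⊥-elim (q (toℕ-injective y≡j))
        ... | tri> _ _ i<y | tri< y<j _ _ = ⊥-elim (r (⇒sep {n} {y} {x} {lookup M x} (inj₁ (i<y , y<j))))

        M-outside : ∀ {y} → outside n x (lookup M x) y → outside n x (lookup M x) (lookup M y)
        M-outside {y} (p , q , r) =
          (λ My≡x → q (trans (sym (proj₁ (pm y))) (cong (lookup M) My≡x))) ,
          (λ My≡Mx → p (trans (sym (proj₁ (pm y))) (trans (cong (lookup M) My≡Mx) (proj₁ (pm x))))) ,
          λ s → let a , b = i<⇒btw (sep⇒ {n} {lookup M y} {x} {lookup M x} s) in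
            r (⇒sep {n} {y} {x} {lookup M x} (inj₁ (subst (λ z → i < toℕ z × toℕ z < j) (proj₁ (pm y)) (nest-ij a b))))

        beyond? : ∀ y → Dec (Beyond y)
        beyond? y = (toℕ y <? i) ⊎-dec (suc j ≤? toℕ y)

      edgesOutside-span : suc j + 2 * edgesOutside n M x (lookup M x) ≡ i + N
      edgesOutside-span = trans (cong (suc j +_)
        (#-matched beyond? _ (lookup M) (proj₁ ∘ pm) (proj₂ ∘ pm) (outside⇒beyond ∘ M-outside ∘ beyond⇒outside)
          (λ y<My s → y<My , beyond⇒outside s , M-outside (beyond⇒outside s))
          (λ (y<My , o , _) → y<My , outside⇒beyond o)))
        (#-outside beyond? i (suc j) (<⇒≤ (<-trans rep ≤-refl)) (toℕ<n (lookup M x)) id id)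

      len≡⇒ : ∀ {l} → len n M x ≡ l → suc i + 2 * l ≡ j ⊎ suc j + 2 * l ≡ i + N
      len≡⇒ refl with ⊓-sel (edgesInside n M x (lookup M x)) (edgesOutside n M x (lookup M x))
      ... | inj₁ e = inj₁ (trans (cong (λ l → suc i + 2 * l) e) edgesInside-span)
      ... | inj₂ e = inj₂ (trans (cong (λ l → suc j + 2 * l) e) edgesOutside-span)

      -- The two sides carry `n - 1` edges together, so a side with `l` edges is the smaller one as
      -- soon as `2 * l < n`.
      ⇒len≡ : ∀ {l} → 2 * l < n → suc i + 2 * l ≡ j ⊎ suc j + 2 * l ≡ i + N → len n M x ≡ l
      ⇒len≡ {l} small (inj₁ e) = trans (m≤n⇒m⊓n≡m (linear (a ∷ b ∷ l ∷ i ∷ j ∷ n ∷ []) (λ a b l i j n →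
          1+ i :+ 2 :* a :≡ j :⇒ 1+ j :+ 2 :* b :≡ i :+ 2 :* n :⇒ 1+ i :+ 2 :* l :≡ j :⇒ 2 :* l :< n :⇒ a :≤ b)
          edgesInside-span edgesOutside-span e small))
        (linear (a ∷ l ∷ i ∷ j ∷ []) (λ a l i j → 1+ i :+ 2 :* a :≡ j :⇒ 1+ i :+ 2 :* l :≡ j :⇒ a :≡ l) edgesInside-span e)
        where
        a = edgesInside n M x (lookup M x)
        b = edgesOutside n M x (lookup M x)
      ⇒len≡ {l} small (inj₂ e) = trans (m≥n⇒m⊓n≡n (linear (a ∷ b ∷ l ∷ i ∷ j ∷ n ∷ []) (λ a b l i j n →
          1+ i :+ 2 :* a :≡ j :⇒ 1+ j :+ 2 :* b :≡ i :+ 2 :* n :⇒ 1+ j :+ 2 :* l :≡ i :+ 2 :* n :⇒ 2 :* l :< n :⇒ b :≤ a)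
          edgesInside-span edgesOutside-span e small))
        (linear (b ∷ l ∷ i ∷ j ∷ n ∷ []) (λ b l i j n → 1+ j :+ 2 :* b :≡ i :+ 2 :* n :⇒ 1+ j :+ 2 :* l :≡ i :+ 2 :* n :⇒ b :≡ l) edgesOutside-span e)
        where
        a = edgesInside n M x (lookup M x)
        b = edgesOutside n M x (lookup M x)

    private
      Rep : ℕ → ℕ → Set
      Rep i l = Σ (Pt n) λ x → toℕ x ≡ i × IsEdgeRep n M x × len n M x ≡ l

      Spans : ℕ → ℕ → Set
      Spans i l = i < f i × (suc i + 2 * l ≡ f i ⊎ suc (f i) + 2 * l ≡ i + N)

      rep⇒spans : ∀ {x l} → IsEdgeRep n M x → len n M x ≡ l → Spans (toℕ x) l
      rep⇒spans {x} rep eq rewrite val-toℕ M x = rep , len≡⇒ rep eq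

      spans⇒rep : ∀ {i l} → 2 * l < n → i < N → Spans i l → Rep i l
      spans⇒rep small i<N s with point i<N
      ... | pt x rewrite val-toℕ M x = x , refl , proj₁ s , ⇒len≡ (proj₁ s) small (proj₂ s)

      spans : (n i y l : Exp) → Form
      spans n i y l = i :< y :∧ (1+ i :+ 2 :* l :≡ y :∨ 1+ y :+ 2 :* l :≡ i :+ 2 :* n)

      disjoint : ∀ {i j} → i < f i → j < f j → i ≢ f j
      disjoint p q i≡fj = <-asym q (subst₂ _<_ i≡fj (trans (cong f i≡fj) (inv _)) p)

    -- `EvenBase` rotated by `p`: the edges `{p , p + n - 1}` and `{p + n , p - 1}` modulo `2n`. For
    -- `p = 0` the point `p - 1` is `2n - 1`.
    EvenAt : ℕ → Set
    EvenAt p = p < n × suc (f p) ≡ p + n × ((p ≡ 0 × suc (f n) ≡ N) ⊎ (∃[ q ] p ≡ suc q × f q ≡ p + n))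

    module _ (h : ℕ) (n≡ : n ≡ 2 + 2 * h) where

      private
        Pair : ℕ → ℕ → Set
        Pair i j = (i ≡ 0 × j ≡ n × suc (f i) ≡ n × suc (f j) ≡ N) ⊎ (j ≡ suc i × j < n × suc (f j) ≡ j + n × f i ≡ j + n)

        -- Labels of an edge of length `h` differ by `n - 1` or `n + 1`. Two such edges avoid
        -- crossing in two ways only: side by side with difference `n - 1` each, or the shorter
        -- directly under the longer.
        even-pair : ∀ {i j} → i < j → j < N → Spans i h → Spans j h → Pair i j
        even-pair {i} {j} i<j j<N (p , inj₁ s) (q , inj₁ t) = inj₁ (linear (f i ∷ f j ∷ i ∷ j ∷ h ∷ n ∷ []) (λ fi fj i j h n →
          n :≡ con 2 :+ 2 :* h :⇒ i :< j :⇒ :¬ (j :≡ fi) :⇒ fj :< 2 :* n :⇒ 1+ i :+ 2 :* h :≡ fi :⇒ 1+ j :+ 2 :* h :≡ fj :⇒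
          nests i fi j fj :⇒ i :≡ con 0 :∧ j :≡ n :∧ 1+ fi :≡ n :∧ 1+ fj :≡ 2 :* n)
          n≡ i<j (disjoint q p) (dom j<N) s t nest)
        even-pair {i} {j} i<j j<N (p , inj₁ s) (q , inj₂ t) = ⊥-elim (linear (f i ∷ f j ∷ i ∷ j ∷ h ∷ n ∷ []) (λ fi fj i j h n →
          n :≡ con 2 :+ 2 :* h :⇒ i :< j :⇒ :¬ (j :≡ fi) :⇒ fj :< 2 :* n :⇒ 1+ i :+ 2 :* h :≡ fi :⇒ 1+ fj :+ 2 :* h :≡ j :+ 2 :* n :⇒
          nests i fi j fj :⇒ :⊥) n≡ i<j (disjoint q p) (dom j<N) s t nest)
        even-pair {i} {j} i<j j<N (p , inj₂ s) (q , inj₁ t) = inj₂ (linear (f i ∷ f j ∷ i ∷ j ∷ h ∷ n ∷ []) (λ fi fj i j h n →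
          n :≡ con 2 :+ 2 :* h :⇒ i :< j :⇒ :¬ (j :≡ fi) :⇒ fi :< 2 :* n :⇒ fj :< 2 :* n :⇒ 1+ fi :+ 2 :* h :≡ i :+ 2 :* n :⇒ 1+ j :+ 2 :* h :≡ fj :⇒
          nests i fi j fj :⇒ j :≡ 1+ i :∧ j :< n :∧ 1+ fj :≡ j :+ n :∧ fi :≡ j :+ n)
          n≡ i<j (disjoint q p) (dom (<-trans i<j j<N)) (dom j<N) s t nest)
        even-pair {i} {j} i<j j<N (p , inj₂ s) (q , inj₂ t) = ⊥-elim (linear (f i ∷ f j ∷ i ∷ j ∷ h ∷ n ∷ []) (λ fi fj i j h n →
          n :≡ con 2 :+ 2 :* h :⇒ i :< j :⇒ :¬ (j :≡ fi) :⇒ fj :< 2 :* n :⇒ 1+ fi :+ 2 :* h :≡ i :+ 2 :* n :⇒ 1+ fj :+ 2 :* h :≡ j :+ 2 :* n :⇒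
          nests i fi j fj :⇒ :⊥) n≡ i<j (disjoint q p) (dom j<N) s t nest)

        0<n : 0 < n
        0<n = subst (0 <_) (sym n≡) (s≤s z≤n)

        pair⇒EvenAt : ∀ {i j} → Pair i j → ∃[ p ] EvenAt p
        pair⇒EvenAt (inj₁ (refl , refl , s , t)) = 0 , 0<n , s , inj₁ (refl , t)
        pair⇒EvenAt (inj₂ (refl , p , s , t))    = _ , p , s , inj₂ (_ , refl , t)

        Long : Pt n → Set
        Long y = IsEdgeRep n M y × len n M y ≡ h

        long-card : HasCard Long (numEdgesOfLength n M h)
        long-card = #-card _

      shape⇒EvenAt : numEdgesOfLength n M h ≡ 2 → ∃[ p ] EvenAt p
      shape⇒EvenAt eq = go (subst (HasCard Long) eq long-card)
        where
        go : HasCard Long 2 → ∃[ p ] EvenAt p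
        go (x ∷ y ∷ [] , (x≢y ∷ []) ∷ _ , _ , iff) =
          let r , l = Equivalence.to (iff x) (here refl) ; r′ , l′ = Equivalence.to (iff y) (there (here refl))
              s = rep⇒spans r l ; s′ = rep⇒spans r′ l′
          in order s s′ (<-cmp (toℕ x) (toℕ y))
          where
          order : Spans (toℕ x) h → Spans (toℕ y) h → Tri (toℕ x < toℕ y) (toℕ x ≡ toℕ y) (toℕ y < toℕ x) → ∃[ p ] EvenAt p
          order s s′ (tri< p _ _) = pair⇒EvenAt (even-pair p (toℕ<n y) s s′)
          order s s′ (tri≈ _ p _) = ⊥-elim (x≢y (toℕ-injective p))
          order s s′ (tri> _ _ p) = pair⇒EvenAt (even-pair p (toℕ<n x) s′ s)

      -- The shape asks for exactly two edges: any further edge of length `h` would form a pair with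
      -- a known one, and `even-pair` then determines it.
      EvenAt⇒shape : ∀ {p} → EvenAt p → numEdgesOfLength n M h ≡ 2
      EvenAt⇒shape {p} (p<n , fp , other) = go other
        where
        small : 2 * h < n
        small = linear (h ∷ n ∷ []) (λ h n → n :≡ con 2 :+ 2 :* h :⇒ 2 :* h :< n) n≡
        p<N : p < N
        p<N = <-≤-trans p<n (m≤m+n n _)
        spans-p : Spans p h
        spans-p = linear (h ∷ n ∷ p ∷ f p ∷ []) (λ h n p y →
          n :≡ con 2 :+ 2 :* h :⇒ 1+ y :≡ p :+ n :⇒ spans n p y h) n≡ fp
        count : ∀ {q} → p ≢ q → Rep p h → Rep q h → (∀ {z} → z < N → Spans z h → z ≡ p ⊎ z ≡ q) → numEdgesOfLength n M h ≡ 2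
        count p≢q (x , refl , r , l) (y , refl , r′ , l′) only = HasCard-unique long-card
          (x ∷ y ∷ [] , ((p≢q ∘ cong toℕ) ∷ []) ∷ [] ∷ [] , refl , λ z → mk⇔
            (λ { (here refl) → r , l ; (there (here refl)) → r′ , l′ })
            (λ (r″ , l″) → [ here ∘ toℕ-injective , there ∘ here ∘ toℕ-injective ]′ (only (toℕ<n z) (rep⇒spans r″ l″))))
        go : (p ≡ 0 × suc (f n) ≡ N) ⊎ (∃[ q ] p ≡ suc q × f q ≡ p + n) → numEdgesOfLength n M h ≡ 2
        go (inj₁ (refl , fn)) = count (<⇒≢ 0<n) (spans⇒rep small p<N spans-p) (spans⇒rep small n<N spans-n) only
          where
          n<N : n < N
          n<N = linear (n ∷ []) (λ n → con 0 :< n :⇒ n :< 2 :* n) 0<n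
          spans-n : Spans n h
          spans-n = linear (h ∷ n ∷ f n ∷ []) (λ h n y →
            n :≡ con 2 :+ 2 :* h :⇒ 1+ y :≡ 2 :* n :⇒ spans n n y h) n≡ fn
          only : ∀ {z} → z < N → Spans z h → z ≡ 0 ⊎ z ≡ n
          only {zero}  _   _ = inj₁ refl
          only {suc z} z<N s with even-pair (s≤s z≤n) z<N spans-p s
          ... | inj₁ (_ , e , _)       = inj₂ e
          ... | inj₂ (_ , _ , _ , f0) = ⊥-elim (linear (n ∷ f 0 ∷ z ∷ []) (λ n f0 z → 1+ f0 :≡ n :⇒ f0 :≡ 1+ z :+ n :⇒ :⊥) fp f0)
        go (inj₂ (q , refl , fq)) = count (<⇒≢ ≤-refl ∘ sym) (spans⇒rep small p<N spans-p) (spans⇒rep small (<-trans ≤-refl p<N) spans-q) only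
          where
          spans-q : Spans q h
          spans-q = linear (h ∷ n ∷ q ∷ f q ∷ []) (λ h n q y →
            n :≡ con 2 :+ 2 :* h :⇒ y :≡ 1+ q :+ n :⇒ spans n q y h) n≡ fq
          only : ∀ {z} → z < N → Spans z h → z ≡ suc q ⊎ z ≡ q
          only {z} z<N s with <-cmp z q
          ... | tri≈ _ e _ = inj₂ e
          ... | tri< z<q _ _ with even-pair z<q (<-trans ≤-refl p<N) s spans-q
          ...   | inj₁ (_ , e , _)     = ⊥-elim (<⇒≢ (<-trans ≤-refl p<n) e)
          ...   | inj₂ (_ , _ , e , _) = ⊥-elim (linear (n ∷ q ∷ f q ∷ []) (λ n q fq → 1+ fq :≡ q :+ n :⇒ fq :≡ 1+ q :+ n :⇒ :⊥) e fq)
          only {z} z<N s | tri> _ _ q<z with even-pair q<z z<N spans-q s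
          ...   | inj₁ (e , _ , e′ , _) = ⊥-elim (linear (n ∷ q ∷ f q ∷ []) (λ n q fq → 1+ fq :≡ n :⇒ fq :≡ 1+ q :+ n :⇒ :⊥) e′ fq)
          ...   | inj₂ (e , _)          = inj₁ e

    -- The edge `{p + n + 1 , p - 1}` modulo `2n`, with smaller end `q`. The cases are `p = 0`,
    -- where `p - 1` is `2n - 1`, the generic one, and `p = n - 1`, where `p + n + 1` wraps to `0`.
    OuterEdge : ℕ → ℕ → Set
    OuterEdge p q = (p ≡ 0 × q ≡ suc n × suc (f q) ≡ N) ⊎ (p ≡ suc q × suc p < n × f q ≡ suc (p + n)) ⊎
                    (q ≡ 0 × suc p ≡ n × suc (f q) ≡ p)

    OddAt : ℕ → Set
    OddAt p = p < n × f p ≡ p + n × suc (f (suc p)) ≡ p + n × ∃ (OuterEdge p)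

    module _ (h : ℕ) (n≡ : n ≡ 3 + 2 * h) where

      private
        Beside : ℕ → ℕ → Set
        Beside i j = (j ≡ suc i × suc (f j) ≡ i + n) ⊎ OuterEdge i j

        -- Each side of the diameter has `n - 1 = 2 * h + 2` points, and an edge of length `h` needs
        -- all of them: its two ends and those of the `h` edges that it cuts off.
        beside : ∀ {i j} → i < n → f i ≡ i + n → j < N → Spans j h → Beside i j
        beside {i} {j} i<n fi j<N (q , s) = go s (<-cmp i j)
          where
          p : i < f i
          p = subst (i <_) (sym fi) (m<m+n i (≤-<-trans z≤n i<n))
          go : suc j + 2 * h ≡ f j ⊎ suc (f j) + 2 * h ≡ j + N → Tri (i < j) (i ≡ j) (j < i) → Beside i j
          go (inj₁ s) (tri< i<j _ _) with j <? f i
          ... | yes j<fi = inj₁ (linear (f i ∷ f j ∷ i ∷ j ∷ h ∷ n ∷ []) (λ fi fj i j h n →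
                  n :≡ con 3 :+ 2 :* h :⇒ fi :≡ i :+ n :⇒ 1+ j :+ 2 :* h :≡ fj :⇒ i :< j :⇒ i :< fj :∧ fj :< fi :⇒
                  j :≡ 1+ i :∧ 1+ fj :≡ i :+ n) n≡ fi s i<j (nest i<j j<fi))
          ... | no ¬j<fi = inj₂ (inj₁ (linear (f i ∷ f j ∷ i ∷ j ∷ h ∷ n ∷ []) (λ fi fj i j h n →
                  n :≡ con 3 :+ 2 :* h :⇒ fi :≡ i :+ n :⇒ 1+ j :+ 2 :* h :≡ fj :⇒ :¬ (j :< fi) :⇒ :¬ (j :≡ fi) :⇒ fj :< 2 :* n :⇒
                  i :≡ con 0 :∧ j :≡ 1+ n :∧ 1+ fj :≡ 2 :* n) n≡ fi s ¬j<fi (disjoint q p) (dom j<N)))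
          go (inj₁ s) (tri> _ _ j<i) with i <? f j
          ... | yes i<fj = ⊥-elim (linear (f i ∷ f j ∷ i ∷ j ∷ h ∷ n ∷ []) (λ fi fj i j h n →
                  n :≡ con 3 :+ 2 :* h :⇒ fi :≡ i :+ n :⇒ 1+ j :+ 2 :* h :≡ fj :⇒ j :< i :⇒ fi :< fj :⇒ :⊥)
                  n≡ fi s j<i (proj₂ (nest j<i i<fj)))
          ... | no ¬i<fj = inj₂ (inj₂ (inj₂ (linear (f i ∷ f j ∷ i ∷ j ∷ h ∷ n ∷ []) (λ fi fj i j h n →
                  n :≡ con 3 :+ 2 :* h :⇒ 1+ j :+ 2 :* h :≡ fj :⇒ :¬ (i :< fj) :⇒ :¬ (i :≡ fj) :⇒ i :< n :⇒
                  j :≡ con 0 :∧ 1+ i :≡ n :∧ 1+ fj :≡ i) n≡ s ¬i<fj (disjoint p q) i<n)))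
          go (inj₁ s) (tri≈ _ i≡j _) = ⊥-elim (linear (f i ∷ i ∷ h ∷ n ∷ []) (λ fi i h n →
                  n :≡ con 3 :+ 2 :* h :⇒ fi :≡ i :+ n :⇒ 1+ i :+ 2 :* h :≡ fi :⇒ :⊥)
                  n≡ fi (subst (λ j → suc j + 2 * h ≡ f j) (sym i≡j) s))
          go (inj₂ s) (tri≈ _ i≡j _) = ⊥-elim (linear (f i ∷ i ∷ h ∷ n ∷ []) (λ fi i h n →
                  n :≡ con 3 :+ 2 :* h :⇒ fi :≡ i :+ n :⇒ 1+ fi :+ 2 :* h :≡ i :+ 2 :* n :⇒ :⊥)
                  n≡ fi (subst (λ j → suc (f j) + 2 * h ≡ j + N) (sym i≡j) s))
          go (inj₂ s) (tri< i<j _ _) = ⊥-elim (linear (f i ∷ f j ∷ i ∷ j ∷ h ∷ n ∷ []) (λ fi fj i j h n →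
                  n :≡ con 3 :+ 2 :* h :⇒ fi :≡ i :+ n :⇒ 1+ fj :+ 2 :* h :≡ j :+ 2 :* n :⇒ i :< j :⇒ fj :< 2 :* n :⇒
                  nests i fi j fj :⇒ :⊥) n≡ fi s i<j (dom j<N) nest)
          go (inj₂ s) (tri> _ _ j<i) = inj₂ (inj₂ (inj₁ (linear (f i ∷ f j ∷ i ∷ j ∷ h ∷ n ∷ []) (λ fi fj i j h n →
                  n :≡ con 3 :+ 2 :* h :⇒ fi :≡ i :+ n :⇒ 1+ fj :+ 2 :* h :≡ j :+ 2 :* n :⇒ j :< i :⇒ i :< n :⇒ fj :< 2 :* n :⇒
                  nests j fj i fi :⇒ i :≡ 1+ j :∧ 1+ i :< n :∧ fj :≡ 1+ (i :+ n)) n≡ fi s j<i i<n (dom j<N) nest)))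

        1≢n : 1 ≢ n
        1≢n e with () ← trans e n≡

        outer-unique : ∀ {i j k} → OuterEdge i j → OuterEdge i k → j ≡ k
        outer-unique (inj₁ (_ , refl , _))        (inj₁ (_ , refl , _))        = refl
        outer-unique (inj₁ (refl , _))            (inj₂ (inj₁ (() , _)))
        outer-unique (inj₁ (refl , _))            (inj₂ (inj₂ (_ , e , _)))    = ⊥-elim (1≢n e)
        outer-unique (inj₂ (inj₁ (() , _)))       (inj₁ (refl , _))
        outer-unique (inj₂ (inj₁ (refl , _)))     (inj₂ (inj₁ (refl , _)))     = refl
        outer-unique (inj₂ (inj₁ (_ , p , _)))    (inj₂ (inj₂ (_ , q , _)))    = ⊥-elim (<⇒≢ p q)
        outer-unique (inj₂ (inj₂ (_ , e , _)))    (inj₁ (refl , _))            = ⊥-elim (1≢n e)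
        outer-unique (inj₂ (inj₂ (_ , q , _)))    (inj₂ (inj₁ (_ , p , _)))    = ⊥-elim (<⇒≢ p q)
        outer-unique (inj₂ (inj₂ (refl , _)))     (inj₂ (inj₂ (refl , _)))     = refl

        -- Each side of the diameter has room for one such edge, so two different ones lie on
        -- different sides.
        assemble : ∀ {i j k} → i < n → f i ≡ i + n → j ≢ k → Beside i j → Beside i k → OddAt i
        assemble i<n fi j≢k (inj₁ (refl , s)) (inj₂ o)           = i<n , fi , s , _ , o
        assemble i<n fi j≢k (inj₂ o)          (inj₁ (refl , s))  = i<n , fi , s , _ , o
        assemble i<n fi j≢k (inj₁ (refl , _)) (inj₁ (refl , _))  = ⊥-elim (j≢k refl)
        assemble i<n fi j≢k (inj₂ o)          (inj₂ o′)          = ⊥-elim (j≢k (outer-unique o o′))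

      shape⇒OddAt : (∃[ x ] IsEdgeRep n M x × ThroughCenter n M x × len n M x ≡ suc h) →
                    (∃[ y ] ∃[ z ] (y ≢ z) × IsEdgeRep n M y × IsEdgeRep n M z × len n M y ≡ h × len n M z ≡ h) → ∃[ p ] OddAt p
      shape⇒OddAt (x , _ , through , _) (y , z , y≢z , ry , rz , ly , lz) =
        toℕ x , assemble x<n fx (y≢z ∘ toℕ-injective)
          (beside x<n fx (toℕ<n y) (rep⇒spans ry ly)) (beside x<n fx (toℕ<n z) (rep⇒spans rz lz))
        where
        fx : f (toℕ x) ≡ toℕ x + n
        fx = trans (val-toℕ M x) through
        x<n : toℕ x < n
        x<n = linear (toℕ x ∷ f (toℕ x) ∷ n ∷ []) (λ x fx n → fx :≡ x :+ n :⇒ fx :< 2 :* n :⇒ x :< n) fx (dom (toℕ<n x))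

      OddAt⇒shape : ∀ {p} → OddAt p →
                    (∃[ x ] IsEdgeRep n M x × ThroughCenter n M x × len n M x ≡ suc h) ×
                    (∃[ y ] ∃[ z ] (y ≢ z) × IsEdgeRep n M y × IsEdgeRep n M z × len n M y ≡ h × len n M z ≡ h)
      OddAt⇒shape {p} (p<n , fp , f1+p , q , o) = central (spans⇒rep small⁺ p<N spans-p) ,
        flanks (spans⇒rep small 1+p<N spans-1+p) (spans⇒rep small (q<N o) (spans-q o))
        where
        small : 2 * h < n
        small = linear (h ∷ n ∷ []) (λ h n → n :≡ con 3 :+ 2 :* h :⇒ 2 :* h :< n) n≡
        small⁺ : 2 * suc h < n
        small⁺ = linear (h ∷ n ∷ []) (λ h n → n :≡ con 3 :+ 2 :* h :⇒ 2 :* (1+ h) :< n) n≡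
        p<N : p < N
        p<N = <-≤-trans p<n (m≤m+n n _)
        1+p<N : suc p < N
        1+p<N = linear (h ∷ n ∷ p ∷ []) (λ h n p → n :≡ con 3 :+ 2 :* h :⇒ p :< n :⇒ 1+ p :< 2 :* n) n≡ p<n
        spans-p : Spans p (suc h)
        spans-p = linear (h ∷ n ∷ p ∷ f p ∷ []) (λ h n p y →
          n :≡ con 3 :+ 2 :* h :⇒ y :≡ p :+ n :⇒ spans n p y (1+ h)) n≡ fp
        spans-1+p : Spans (suc p) h
        spans-1+p = linear (h ∷ n ∷ p ∷ f (suc p) ∷ []) (λ h n p y →
          n :≡ con 3 :+ 2 :* h :⇒ 1+ y :≡ p :+ n :⇒ spans n (1+ p) y h) n≡ f1+p
        q<N : OuterEdge p q → q < N
        q<N (inj₁ (_ , refl , _))        = linear (h ∷ n ∷ []) (λ h n → n :≡ con 3 :+ 2 :* h :⇒ 1+ n :< 2 :* n) n≡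
        q<N (inj₂ (inj₁ (refl , _)))     = <-trans ≤-refl p<N
        q<N (inj₂ (inj₂ (refl , _)))     = ≤-<-trans z≤n p<N
        spans-q : OuterEdge p q → Spans q h
        spans-q (inj₁ (_ , e , e′)) = linear (h ∷ n ∷ q ∷ f q ∷ []) (λ h n q y →
          n :≡ con 3 :+ 2 :* h :⇒ q :≡ 1+ n :⇒ 1+ y :≡ 2 :* n :⇒ spans n q y h) n≡ e e′
        spans-q (inj₂ (inj₁ (e , _ , e′))) = linear (h ∷ n ∷ p ∷ q ∷ f q ∷ []) (λ h n p q y →
          n :≡ con 3 :+ 2 :* h :⇒ p :≡ 1+ q :⇒ y :≡ 1+ (p :+ n) :⇒ spans n q y h) n≡ e e′
        spans-q (inj₂ (inj₂ (e , e′ , e″))) = linear (h ∷ n ∷ p ∷ q ∷ f q ∷ []) (λ h n p q y →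
          n :≡ con 3 :+ 2 :* h :⇒ q :≡ con 0 :⇒ 1+ p :≡ n :⇒ 1+ y :≡ p :⇒ spans n q y h) n≡ e e′ e″
        1+p≢q : OuterEdge p q → suc p ≢ q
        1+p≢q (inj₁ (refl , refl , _)) e = <⇒≢ (≤-<-trans z≤n p<n) (suc-injective e)
        1+p≢q (inj₂ (inj₁ (refl , _))) ()
        1+p≢q (inj₂ (inj₂ (refl , _))) ()
        central : Rep p (suc h) → ∃[ x ] IsEdgeRep n M x × ThroughCenter n M x × len n M x ≡ suc h
        central (x , refl , r , l) = x , r , trans (sym (val-toℕ M x)) fp , l
        flanks : Rep (suc p) h → Rep q h →
                 ∃[ y ] ∃[ z ] (y ≢ z) × IsEdgeRep n M y × IsEdgeRep n M z × len n M y ≡ h × len n M z ≡ h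
        flanks (y , y≡ , ry , ly) (z , z≡ , rz , lz) =
          y , z , (λ { refl → 1+p≢q o (trans (sym y≡) z≡) }) , ry , rz , ly , lz

open Shapes

-- From a standard position to minimum degree, description and count

module Families where

  open import Data.List using (List; []; _∷_; map; length; upTo; cartesianProduct)
  open import Data.List.Membership.Propositional using (_∈_)
  open import Data.List.Membership.Propositional.Properties using (∈-map⁺; ∈-map⁻; ∈-cartesianProduct⁺; ∈-cartesianProduct⁻; ∈-upTo⁺; ∈-upTo⁻)
  open import Data.List.Properties using (length-map; length-++; length-upTo)
  import Data.List.Relation.Unary.Unique.Propositional.Properties as Unique
  open import Data.Vec using (tabulate)

  -- Base describes, in standard position, the matchings that are claimed to have the minimum degree δ;
  -- they consist of fixed edges and of two arbitrary matchings A and B with h edges each.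
  record Family (n δ h : ℕ) : Set₁ where
    field
      0<n            : 0 < n
      Base           : (ℕ → ℕ) → Set
      Base-cong      : ∀ {f g} → (∀ x → f x ≡ g x) → Base f → Base g
      tree           : Tree → Tree → Tree
      tree-injective : ∀ {A B A′ B′} → tree A B ≡ tree A′ B′ → A ≡ A′ × B ≡ B′
      tree-size      : ∀ A B → ∥ A ∥ ≡ h → ∥ B ∥ ≡ h → ∥ tree A B ∥ ≡ n
      tree-base      : ∀ A B → ∥ A ∥ ≡ h → ∥ B ∥ ≡ h → Base (enc (tree A B) 0)
      base-tree      : ∀ t → ∥ t ∥ ≡ n → Base (enc t 0) → ∃[ A ] ∃[ B ] ∥ A ∥ ≡ h × ∥ B ∥ ≡ h × tree A B ≡ t
      half-turn      : ∀ {M} → IsNCM n M → Base (val M) → Base (val (rots n M))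
      rigid          : ∀ {M r} → IsNCM n M → Base (val M) → 0 < r → r < n → ¬ Base (val (rots r M))
      degree         : ∀ {M} → IsNCM n M → Base (val M) → Deg n M δ
      short-case     : ∀ {M} (ncm : IsNCM n M) → Central.Short {n} {M} ncm → AtLeast (Adj n M) (suc δ) ⊎ Base (val M)
      diameter-case  : ∀ {M} → IsNCM n M → val M 0 ≡ n → AtLeast (Adj n M) (suc δ) ⊎ Base (val M)

    0<N : 0 < 2 * n
    0<N = <-≤-trans 0<n (m≤m+n n _)

    Rotated : PM n → Set
    Rotated M = ∃[ p ] ∃[ M₀ ] p < n × IsNCM n M₀ × Base (val M₀) × rots p M₀ ≡ M

    -- When `p` reaches `n`, the rotation is absorbed into the standard position by `half-turn`, and
    -- `p` starts again at `0`.
    rotated-stable : RotationStable {n} Rotated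
    rotated-stable = record { stable = λ M _ → turn {M} }
      where
      turn : ∀ {M} → Rotated M → Rotated (rot M)
      turn (p , M₀ , p<n , ncm , base , refl) with m≤n⇒m<n∨m≡n p<n
      ... | inj₁ q = suc p , M₀ , q , ncm , base , refl
      ... | inj₂ q = 0 , rots n M₀ , 0<n , rots-NCM {n} n {M₀} ncm , half-turn {M₀} ncm base , cong (λ r → rots r M₀) (sym q)

    -- Both alternatives are stable under rotation, so only a short outer face and a diameter at the
    -- origin have to be examined.
    rich-or-rotated : ∀ M → IsNCM n M → AtLeast (Adj n M) (suc δ) ⊎ Rotated M
    rich-or-rotated = centre-induction {n}
      (record { stable = λ M ncm → Sum.map (stable (Adj-stable {n} (suc δ)) M ncm) (stable rotated-stable M ncm) })
      (λ {M} ncm s → Sum.map id (unturned {M} ncm) (short-case {M} ncm s))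
      (λ {M} ncm d → Sum.map id (unturned {M} ncm) (diameter-case {M} ncm d)) 0<n
      where
      unturned : ∀ {M} → IsNCM n M → Base (val M) → Rotated M
      unturned {M} ncm base = 0 , M , 0<n , ncm , base , refl

    rotated⇒NCM : ∀ {M} → Rotated M → IsNCM n M
    rotated⇒NCM (p , M₀ , _ , ncm , _ , refl) = rots-NCM {n} p {M₀} ncm

    rotated⇒Deg : ∀ {M} → Rotated M → Deg n M δ
    rotated⇒Deg (p , M₀ , _ , ncm , base , refl) = stable* (Deg-stable {n} 0<N δ) p M₀ ncm (degree {M₀} ncm base)

    Deg⇒rotated : ∀ {M} → IsNCM n M → Deg n M δ → Rotated M
    Deg⇒rotated {M} ncm deg = [ (λ rich → ⊥-elim (<-irrefl refl (AtLeast⇒≤ rich deg))) , id ]′ (rich-or-rotated M ncm)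

    δ≤deg : ∀ M k → IsNCM n M → Deg n M k → δ ≤ k
    δ≤deg M k ncm deg = [ (λ rich → <⇒≤ (AtLeast⇒≤ rich deg)) ,
      (λ r → ≤-reflexive (HasCard-unique (rotated⇒Deg r) deg)) ]′ (rich-or-rotated M ncm)

    -- The value at trees of the wrong size is irrelevant.
    matching : Tree → PM n
    matching t with ∥ t ∥ ≟ n
    ... | yes eq = encode t eq
    ... | no  _  = tabulate id

    matching-encode : ∀ {t} (eq : ∥ t ∥ ≡ n) → matching t ≡ encode t eq
    matching-encode {t} eq with ∥ t ∥ ≟ n
    ... | yes eq′ = cong (encode t) (≡-irrelevant eq′ eq)
    ... | no ¬eq  = ⊥-elim (¬eq eq)

    member : ℕ × Tree × Tree → PM n
    member (p , A , B) = rots p (matching (tree A B))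

    parameters : List (ℕ × Tree × Tree)
    parameters = cartesianProduct (upTo n) (cartesianProduct (trees h) (trees h))

    members : List (PM n)
    members = map member parameters

    module _ {A B} (A≡ : ∥ A ∥ ≡ h) (B≡ : ∥ B ∥ ≡ h) where

      matching-base : IsNCM n (matching (tree A B)) × Base (val (matching (tree A B)))
      matching-base rewrite matching-encode (tree-size A B A≡ B≡) =
        encode-NCM {n} (tree A B) (tree-size A B A≡ B≡) , Base-cong (val-encode (tree A B) (tree-size A B A≡ B≡)) (tree-base A B A≡ B≡)

    parameters⁻ : ∀ {p A B} → (p , A , B) ∈ parameters → p < n × ∥ A ∥ ≡ h × ∥ B ∥ ≡ h
    parameters⁻ x∈ =
      let p∈ , AB∈ = ∈-cartesianProduct⁻ (upTo n) (cartesianProduct (trees h) (trees h)) x∈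
          A∈ , B∈  = ∈-cartesianProduct⁻ (trees h) (trees h) AB∈
      in ∈-upTo⁻ p∈ , trees-sound A∈ , trees-sound B∈

    -- Different values of `p` would give a rotation by `0 < r < n` steps between two standard
    -- positions, against `rigid`. For equal `p` the rotations cancel and the encodings are
    -- compared.
    member-injective : ∀ {x y} → x ∈ parameters → y ∈ parameters → member x ≡ member y → x ≡ y
    member-injective {p , A , B} {p′ , A′ , B′} x∈ y∈ eq = go (parameters⁻ x∈) (parameters⁻ y∈)
      where
      M = matching (tree A B)
      M′ = matching (tree A′ B′)
      clash : ∀ {p p′ M M′} → IsNCM n M′ → Base (val M) → Base (val M′) → p < p′ → p′ < n → rots p M ≢ rots p′ M′
      clash {p} {p′} {M} {M′} ncm′ base base′ p<p′ p′<n e = rigid {M′} {p′ ∸ p} ncm′ base′ (m<n⇒0<n∸m p<p′) (≤-<-trans (m∸n≤m p′ p) p′<n)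
        (subst (λ V → Base (val V)) (rots-injective p (trans e
          (trans (cong (λ r → rots r M′) (sym (m+[n∸m]≡n (<⇒≤ p<p′)))) (rots-+ p (p′ ∸ p) M′)))) base)
      go : p < n × ∥ A ∥ ≡ h × ∥ B ∥ ≡ h → p′ < n × ∥ A′ ∥ ≡ h × ∥ B′ ∥ ≡ h → (p , A , B) ≡ (p′ , A′ , B′)
      go (p<n , a , b) (p′<n , a′ , b′) with <-cmp p p′
      ... | tri< q _ _ = ⊥-elim (clash {M = M} {M′} (proj₁ (matching-base a′ b′)) (proj₂ (matching-base a b)) (proj₂ (matching-base a′ b′)) q p′<n eq)
      ... | tri> _ _ q = ⊥-elim (clash {M = M′} {M} (proj₁ (matching-base a b)) (proj₂ (matching-base a′ b′)) (proj₂ (matching-base a b)) q p<n (sym eq))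
      ... | tri≈ _ refl _ = let s = tree-size A B a b ; s′ = tree-size A′ B′ a′ b′
                                e , e′ = tree-injective (encode-injective s s′
                                  (trans (sym (matching-encode s)) (trans (rots-injective p eq) (matching-encode s′))))
                            in cong₂ (λ A B → p , A , B) e e′

    member⇒rotated : ∀ {M} → M ∈ members → Rotated M
    member⇒rotated M∈ with ∈-map⁻ member M∈
    ... | (p , A , B) , x∈ , refl = let p<n , a , b = parameters⁻ x∈ ; ncm , base = matching-base a b in
      p , matching (tree A B) , p<n , ncm , base , refl

    rotated⇒member : ∀ {M} → Rotated M → M ∈ members
    rotated⇒member {M} (p , M₀ , p<n , ncm , base , eq) =
      let t , size , M₀≡ = encode-surjective {n} {M₀} ncm
          A , B , a , b , t≡ = base-tree t size
            (Base-cong (λ x → trans (cong (λ V → val V x) (sym M₀≡)) (sym (val-encode t size x))) base)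
          x∈ = ∈-cartesianProduct⁺ (∈-upTo⁺ p<n) (∈-cartesianProduct⁺
                 (subst (λ k → A ∈ trees k) a (trees-complete A)) (subst (λ k → B ∈ trees k) b (trees-complete B)))
      in subst (_∈ members)
           (trans (cong (rots p) (trans (cong matching t≡) (trans (matching-encode size) M₀≡))) eq)
           (∈-map⁺ member x∈)

    length-product : ∀ {X Y : Set} (xs : List X) (ys : List Y) → length (cartesianProduct xs ys) ≡ length xs * length ys
    length-product []       ys = refl
    length-product (x ∷ xs) ys = trans (length-++ (map (x ,_) ys)) (cong₂ _+_ (length-map _ ys) (length-product xs ys))

    length-members : length members ≡ n * Catalan h ^ 2
    length-members = begin
      length members                                 ≡⟨ length-map member parameters ⟩
      length parameters                              ≡⟨ length-product (upTo n) _ ⟩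
      length (upTo n) * length (cartesianProduct (trees h) (trees h))
                                                     ≡⟨ cong₂ _*_ (length-upTo n) (length-product (trees h) (trees h)) ⟩
      n * (length (trees h) * length (trees h))      ≡⟨ cong (λ c → n * (c * c)) (length-trees h) ⟩
      n * (Catalan h * Catalan h)                    ≡⟨ cong (λ c → n * (Catalan h * c)) (*-identityʳ (Catalan h)) ⟨
      n * Catalan h ^ 2                              ∎
      where open ≡-Reasoning

    minDegree : MinDegree n δ
    minDegree = δ≤deg , matching (tree (path h) (path h)) , proj₁ base , degree {matching (tree (path h) (path h))} (proj₁ base) (proj₂ base)
      where
      -- Any tree with `h` nodes would do as a witness that the minimum is attained.
      path : ℕ → Tree
      path zero    = leaf
      path (suc k) = node leaf (path k)
      path-size : ∀ k → ∥ path k ∥ ≡ k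
      path-size zero    = refl
      path-size (suc k) = cong suc (path-size k)
      base = matching-base (path-size h) (path-size h)

    card : HasCard (λ M → IsNCM n M × Deg n M δ) (n * Catalan h ^ 2)
    card = members , map-Unique member-injective
        (Unique.cartesianProduct⁺ (Unique.upTo⁺ n) (Unique.cartesianProduct⁺ (trees-unique h) (trees-unique h))) ,
      length-members , λ M → mk⇔ (λ M∈ → let r = member⇒rotated M∈ in rotated⇒NCM r , rotated⇒Deg r)
                                 (λ (ncm , deg) → rotated⇒member (Deg⇒rotated ncm deg))

open Families

-- The even and the odd case

module Parities where

  shift-keep : ∀ {N} r x → x + r < N → Shift N r x (x + r)
  shift-keep r x p = inj₁ (p , refl)

  shift-wrap : ∀ {N x′} r x → x′ + N ≡ x + r → Shift N r x x′
  shift-wrap {N} {x′} r x e = inj₂ (≤-trans (m≤n+m N x′) (≤-reflexive e) , e)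

  ∥∥≡0⇒leaf : ∀ {t} → ∥ t ∥ ≡ 0 → t ≡ leaf
  ∥∥≡0⇒leaf {leaf} _ = refl

  module Even (h : ℕ) where

    private
      n = 2 + 2 * h
      ñ : Exp → Exp
      ñ h = con 2 :+ 2 :* h
      N = 2 * n
      0<n : 0 < n
      0<n = s≤s z≤n
      n<N : n < N
      n<N = linear (h ∷ []) (λ h → ñ h :< 2 :* ñ h)

    module _ {M : PM n} (ncm : IsNCM n M) where
      private
        R = IsNCM⇒NC {n} {M} ncm
        f = val M

      -- The half turn exchanges the two edges of the standard position.
      even-half-turn : EvenBase n f → EvenBase n (val (rots n M))
      even-half-turn (f0 , fn) =
        cong suc (rots-val M (<⇒≤ n<N) n<N (NC.dom R n<N) refl
          (shift-wrap n n (linear (h ∷ []) (λ h → 2 :* ñ h :≡ ñ h :+ ñ h)))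
          (shift-wrap n (f n) (linear (h ∷ f n ∷ []) (λ h y → 1+ y :≡ 2 :* ñ h :⇒
            1+ 2 :* h :+ 2 :* ñ h :≡ y :+ ñ h) fn))) ,
        trans (cong suc (rots-val M (<⇒≤ n<N) (<-trans 0<n n<N) (NC.dom R (<-trans 0<n n<N)) refl (shift-keep n 0 n<N)
          (shift-keep n (f 0) (linear (h ∷ f 0 ∷ []) (λ h y → 1+ y :≡ ñ h :⇒
            y :+ ñ h :< 2 :* ñ h) f0))))
          (trans (cong (_+ n) f0) (linear (n ∷ []) (λ n → n :+ n :≡ 2 :* n)))

      -- The rotated matching would contain `{0 , n - 1}` and `{r , r + n - 1}`, which cross, or
      -- share the point `n - 1` if `r = n - 1`.
      even-rigid : ∀ {r} → EvenBase n f → 0 < r → r < n → ¬ EvenBase n (val (rots r M))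
      even-rigid {r} (f0 , _) 0<r r<n (g0 , _) = linear (r ∷ f 0 ∷ g 0 ∷ g r ∷ h ∷ []) (λ r f0 g0 gr h →
          1+ f0 :≡ ñ h :⇒ 1+ g0 :≡ ñ h :⇒ gr :≡ f0 :+ r :⇒ con 0 :< r :⇒ r :< ñ h :⇒
          :¬ (r :≡ g0) :⇒ nests (con 0) g0 r gr :⇒ :⊥) f0 g0 gr 0<r r<n r≢g0 (NC.nest R′)
        where
        g = val (rots r M)
        R′ = IsNCM⇒NC {n} {rots r M} (rots-NCM {n} r {M} ncm)
        gr : g r ≡ f 0 + r
        gr = rots-val M (<⇒≤ (<-trans r<n n<N)) (<-trans 0<n n<N) (NC.dom R (<-trans 0<n n<N)) refl
          (shift-keep r 0 (<-trans r<n n<N))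
          (shift-keep r (f 0) (linear (r ∷ f 0 ∷ h ∷ []) (λ r y h → 1+ y :≡ ñ h :⇒ r :< ñ h :⇒
            y :+ r :< 2 :* ñ h) f0 r<n))
        r≢g0 : r ≢ g 0
        r≢g0 e = <⇒≢ (<-≤-trans 0<r (≤-trans (m≤n+m r (f 0)) (≤-reflexive (sym gr)))) (sym (NC.adjoint R′ (sym e)))

    -- `A` lies under the edge of the block `[0 , n)`, `B` under that of `[n , 2n)`.
    even-tree : Tree → Tree → Tree
    even-tree A B = node A (node B leaf)

    even-tree-base : ∀ A B → ∥ A ∥ ≡ h → ∥ B ∥ ≡ h → EvenBase n (enc (even-tree A B) 0)
    even-tree-base A B refl b = cong suc (enc-open A (node B leaf) 0) ,
      trans (cong suc (trans (enc-right A (node B leaf) 0 ≤-refl) (enc-open B leaf n)))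
        (linear (h ∷ ∥ B ∥ ∷ []) (λ h b → b :≡ h :⇒ 1+ (1+ ñ h :+ 2 :* b) :≡ 2 :* ñ h) b)

    -- The partners of `0` and `n` fix the sizes of `A` and `B`, and the total size leaves no node
    -- for the rest.
    even-base-tree : ∀ t → ∥ t ∥ ≡ n → EvenBase n (enc t 0) → ∃[ A ] ∃[ B ] ∥ A ∥ ≡ h × ∥ B ∥ ≡ h × even-tree A B ≡ t
    even-base-tree leaf ()
    even-base-tree (node A leaf) size (f0 , _) = ⊥-elim (linear (h ∷ ∥ A ∥ ∷ []) (λ h a → 1+ (a :+ con 0) :≡ ñ h :⇒
      1+ (1+ 2 :* a) :≡ ñ h :⇒ :⊥) size (trans (cong suc (sym (enc-open A leaf 0))) f0))
    even-base-tree (node A (node B S)) size (f0 , fn) = A , B , a , b , cong (λ S → node A (node B S)) (sym (∥∥≡0⇒leaf s))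
      where
      a : ∥ A ∥ ≡ h
      a = linear (h ∷ ∥ A ∥ ∷ []) (λ h a → 1+ (1+ 2 :* a) :≡ ñ h :⇒ a :≡ h)
        (trans (cong suc (sym (enc-open A (node B S) 0))) f0)
      n≡ : n ≡ suc (closing A 0)
      n≡ = cong (λ k → 2 + 2 * k) (sym a)
      b : ∥ B ∥ ≡ h
      b = linear (h ∷ ∥ B ∥ ∷ []) (λ h b → 1+ (1+ ñ h :+ 2 :* b) :≡ 2 :* ñ h :⇒ b :≡ h)
        (trans (cong suc (sym (trans (enc-right A (node B S) 0 (≤-reflexive (sym n≡)))
          (trans (cong (λ o → enc (node B S) o n) (sym n≡)) (enc-open B S n))))) fn)
      s : ∥ S ∥ ≡ 0
      s = linear (h ∷ ∥ A ∥ ∷ ∥ B ∥ ∷ ∥ S ∥ ∷ []) (λ h a b s → a :≡ h :⇒ b :≡ h :⇒ 1+ (a :+ 1+ (b :+ s)) :≡ ñ h :⇒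
        s :≡ con 0) a b size

    even-family : Family n 1 h
    even-family = record
      { 0<n = 0<n
      ; Base = EvenBase n
      ; Base-cong = λ e (f0 , fn) → trans (cong suc (sym (e 0))) f0 , trans (cong suc (sym (e n))) fn
      ; tree = even-tree
      ; tree-injective = λ { refl → refl , refl }
      ; tree-size = λ A B a b → linear (h ∷ ∥ A ∥ ∷ ∥ B ∥ ∷ []) (λ h a b → a :≡ h :⇒ b :≡ h :⇒
          1+ (a :+ 1+ (b :+ con 0)) :≡ ñ h) a b
      ; tree-base = even-tree-base
      ; base-tree = even-base-tree
      ; half-turn = λ {M} → even-half-turn {M}
      ; rigid = λ {M} ncm base p q → even-rigid {M} ncm base p q
      ; degree = λ {M} ncm → evenBase⇒Deg {n} {M} ncm 0<n
      ; short-case = λ {M} ncm → short-even {n} {M} ncm 0<n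
      ; diameter-case = λ {M} ncm e → ⊥-elim (no-diameter {M} ncm e)
      }
      where
      -- A diameter at `0` would close a prefix of `n + 1` points, an odd number.
      no-diameter : ∀ {M} → IsNCM n M → val M 0 ≡ n → ⊥
      no-diameter {M} ncm e = let k , 1+n≡ = even {n} {M} ncm (Top.closed⁺ D) n<N in
        1+2*≢2* (suc h) k (trans (linear (h ∷ []) (λ h → 1+ 2 :* (1+ h) :≡ 1+ ñ h)) 1+n≡)
        where
        D : Top (IsNCM⇒NC {n} {M} ncm) 0 n
        D = record { partner = e ; a<b = 0<n ; b<N = n<N ; closed = λ () }

    open Family even-family using (Rotated)

    even-rotated⇒at : ∀ {M} (ncm : IsNCM n M) → Rotated M → ∃[ p ] EvenAt {n} {M} ncm p
    even-rotated⇒at ncm (p , M₀ , p<n , ncm₀ , (f0 , fn) , refl) = p , p<n , trans (cong suc at-p) (trans (cong (_+ p) f0) (+-comm n p)) , other p refl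
      where
      R₀ = IsNCM⇒NC {n} {M₀} ncm₀
      f = val M₀
      g = val (rots p M₀)
      p<N = <-trans p<n n<N
      at-p : g p ≡ f 0 + p
      at-p = rots-val M₀ (<⇒≤ p<N) (<-trans 0<n n<N) (NC.dom R₀ (<-trans 0<n n<N)) refl (shift-keep p 0 p<N)
        (shift-keep p (f 0) (linear (p ∷ f 0 ∷ h ∷ []) (λ p y h → 1+ y :≡ ñ h :⇒ p :< ñ h :⇒
            y :+ p :< 2 :* ñ h) f0 p<n))
      other : ∀ k → p ≡ k → (p ≡ 0 × suc (g n) ≡ N) ⊎ (∃[ q ] p ≡ suc q × g q ≡ p + n)
      other zero    refl = inj₁ (refl , fn)
      other (suc q) refl = inj₂ (q , refl , trans (NC.adjoint (IsNCM⇒NC {n} {rots p M₀} ncm)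
        (rots-val M₀ (<⇒≤ p<N) n<N (NC.dom R₀ n<N) refl
          (shift-keep p n (linear (p ∷ h ∷ []) (λ p h → p :< ñ h :⇒ ñ h :+ p :< 2 :* ñ h) p<n))
          (shift-wrap p (f n) (linear (q ∷ f n ∷ h ∷ []) (λ q y h → 1+ y :≡ 2 :* ñ h :⇒
            q :+ 2 :* ñ h :≡ y :+ (1+ q)) fn)))) (+-comm n p))

    -- A rotation by `p` is undone by `r = 2 * n ∸ p` steps forward, so `rots r M` is the standard
    -- position to exhibit.
    even-at⇒rotated : ∀ {M p} (ncm : IsNCM n M) → EvenAt {n} {M} ncm p → Rotated M
    even-at⇒rotated {M} {p} ncm (p<n , fp , other) =
      p , rots r M , p<n , rots-NCM {n} r {M} ncm ,
      (cong suc (rots-val M (m∸n≤m N p) p<N (NC.dom R p<N) refl (shift-wrap r p (sym p+r))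
        (shift-wrap r (f p) (linear (p ∷ r ∷ f p ∷ h ∷ []) (λ p r y h → p :+ r :≡ 2 :* ñ h :⇒ 1+ y :≡ p :+ ñ h :⇒
          1+ 2 :* h :+ 2 :* ñ h :≡ y :+ r) p+r fp))) , at-n other) ,
      trans (sym (rots-+ p r M)) (trans (cong (λ k → rots k M) p+r) (rots-cycle M))
      where
      R = IsNCM⇒NC {n} {M} ncm
      f = val M
      p<N = <-trans p<n n<N
      r = N ∸ p
      p+r : p + r ≡ N
      p+r = m+[n∸m]≡n (<⇒≤ p<N)
      at-n : (p ≡ 0 × suc (f n) ≡ N) ⊎ (∃[ q ] p ≡ suc q × f q ≡ p + n) → suc (val (rots r M) n) ≡ N
      at-n (inj₁ (p≡0 , fn)) = trans (cong suc (rots-val M (m∸n≤m N p) n<N (NC.dom R n<N) refl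
        (shift-wrap r n (cong (n +_) (sym r≡N))) (shift-wrap r (f n) (cong (f n +_) (sym r≡N))))) fn
        where
        r≡N : r ≡ N
        r≡N = trans (cong (_+ r) (sym p≡0)) p+r
      at-n (inj₂ (q , refl , fq)) = trans (cong suc (rots-val M (m∸n≤m N p)
        (linear (p ∷ h ∷ []) (λ p h → p :< ñ h :⇒ p :+ ñ h :< 2 :* ñ h) p<n)
        (<-trans ≤-refl p<N) (NC.adjoint R fq)
        (shift-wrap r (p + n) (linear (p ∷ r ∷ h ∷ []) (λ p r h → p :+ r :≡ 2 :* ñ h :⇒
          ñ h :+ 2 :* ñ h :≡ p :+ ñ h :+ r) p+r))
        (shift-keep r q (≤-reflexive p+r)))) p+r

    even-theorem : MinDegree n 1 × HasCard (λ (M : PM n) → IsNCM n M × Deg n M 1) (n * Catalan h ^ 2) ×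
                   (∀ (M : PM n) → IsNCM n M → (Deg n M 1 ⇔ numEdgesOfLength n M h ≡ 2))
    even-theorem = minDegree , card , λ M ncm → mk⇔
      (λ deg → EvenAt⇒shape {n} {M} ncm h refl (proj₂ (even-rotated⇒at {M} ncm (Deg⇒rotated {M} ncm deg))))
      (λ s → rotated⇒Deg {M} (even-at⇒rotated {M} ncm (proj₂ (shape⇒EvenAt {n} {M} ncm h refl s))))
      where open Family even-family

  module Odd (h : ℕ) where

    private
      n = 3 + 2 * h
      ñ : Exp → Exp
      ñ h = con 3 :+ 2 :* h
      N = 2 * n
      0<n : 0 < n
      0<n = s≤s z≤n
      n<N : n < N
      n<N = linear (h ∷ []) (λ h → ñ h :< 2 :* ñ h)
      1+n<N : suc n < N
      1+n<N = linear (h ∷ []) (λ h → 1+ ñ h :< 2 :* ñ h)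
      0<N : 0 < N
      0<N = <-trans 0<n n<N
      1<N : 1 < N
      1<N = linear (h ∷ []) (λ h → con 1 :< 2 :* ñ h)
      n+n : n + n ≡ N
      n+n = linear (n ∷ []) (λ n → n :+ n :≡ 2 :* n)

    module _ {M : PM n} (ncm : IsNCM n M) where
      private
        R = IsNCM⇒NC {n} {M} ncm
        f = val M

      odd-half-turn : OddBase n f → OddBase n (val (rots n M))
      odd-half-turn (f0 , f1 , f1+n) =
        rots-val M (<⇒≤ n<N) n<N 0<N (NC.adjoint R f0) (shift-wrap n n (sym n+n)) (shift-keep n 0 n<N) ,
        cong suc (rots-val M (<⇒≤ n<N) 1+n<N (NC.dom R 1+n<N) refl
          (shift-wrap n (suc n) (cong suc (sym n+n)))
          (shift-wrap n (f (suc n)) (linear (h ∷ f (suc n) ∷ []) (λ h y → 1+ y :≡ 2 :* ñ h :⇒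
            con 2 :+ 2 :* h :+ 2 :* ñ h :≡ y :+ ñ h) f1+n))) ,
        trans (cong suc (rots-val M (<⇒≤ n<N) 1<N (NC.dom R 1<N) refl (shift-keep n 1 1+n<N)
          (shift-keep n (f 1) (subst (f 1 + n <_) n+n (+-monoˡ-< n (≤-reflexive f1))))))
          (trans (cong (_+ n) f1) n+n)

      -- The rotated matching would contain the two diameters `{0 , n}` and `{r , r + n}`, and these
      -- cross.
      odd-rigid : ∀ {r} → OddBase n f → 0 < r → r < n → ¬ OddBase n (val (rots r M))
      odd-rigid {r} (f0 , _) 0<r r<n (g0 , _) =
        <⇒≱ (subst₂ _<_ gr g0 (proj₂ (NC.nest R′ 0<r (subst (r <_) (sym g0) r<n)))) (m≤m+n n r)
        where
        g = val (rots r M)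
        R′ = IsNCM⇒NC {n} {rots r M} (rots-NCM {n} r {M} ncm)
        gr : g r ≡ n + r
        gr = rots-val M (<⇒≤ (<-trans r<n n<N)) 0<N n<N f0 (shift-keep r 0 (<-trans r<n n<N))
          (shift-keep r n (subst (n + r <_) n+n (+-monoʳ-< n r<n)))

    -- The root is the diameter `{0 , n}`. Under it lies `{1 , n - 1}` with `A` inside; behind it
    -- follows `{n + 1 , 2n - 1}` with `B` inside.
    odd-tree : Tree → Tree → Tree
    odd-tree A B = node (node A leaf) (node B leaf)

    odd-tree-base : ∀ A B → ∥ A ∥ ≡ h → ∥ B ∥ ≡ h → OddBase n (enc (odd-tree A B) 0)
    odd-tree-base A B a b = trans (enc-open L (node B leaf) 0) closing≡ ,
      trans (cong suc (trans (enc-left L (node B leaf) 0 (λ ()) (subst (1 <_) (sym closing≡) (s≤s (s≤s z≤n)))) (enc-open A leaf 1)))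
        (cong (λ k → 3 + 2 * k) a) ,
      trans (cong suc (trans (enc-right L (node B leaf) 0 (≤-reflexive (cong suc closing≡)))
        (trans (cong (λ o → enc (node B leaf) (suc o) (suc n)) closing≡) (enc-open B leaf (suc n)))))
        (linear (h ∷ ∥ B ∥ ∷ []) (λ h b → b :≡ h :⇒ 1+ (1+ (1+ ñ h) :+ 2 :* b) :≡ 2 :* ñ h) b)
      where
      L = node A leaf
      closing≡ : closing L 0 ≡ n
      closing≡ = linear (h ∷ ∥ A ∥ ∷ []) (λ h a → a :≡ h :⇒ 1+ 2 :* (1+ (a :+ con 0)) :≡ ñ h) a

    odd-base-tree : ∀ t → ∥ t ∥ ≡ n → OddBase n (enc t 0) → ∃[ A ] ∃[ B ] ∥ A ∥ ≡ h × ∥ B ∥ ≡ h × odd-tree A B ≡ t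
    odd-base-tree leaf ()
    odd-base-tree (node leaf r) size (f0 , _) with () ← trans (sym (enc-open leaf r 0)) f0
    odd-base-tree (node (node A S) leaf) size (f0 , _) = ⊥-elim (linear (h ∷ ∥ node A S ∥ ∷ []) (λ h l →
      1+ (l :+ con 0) :≡ ñ h :⇒ 1+ 2 :* l :≡ ñ h :⇒ :⊥) size
      (trans (sym (enc-open (node A S) leaf 0)) f0))
    odd-base-tree (node (node A S) (node B S′)) size (f0 , f1 , f1+n) =
      A , B , a , b , cong₂ (λ S S′ → node (node A S) (node B S′)) (sym (∥∥≡0⇒leaf s)) (sym (∥∥≡0⇒leaf s′))
      where
      L = node A S
      closing≡ : closing L 0 ≡ n
      closing≡ = trans (sym (enc-open L (node B S′) 0)) f0
      a : ∥ A ∥ ≡ h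
      a = linear (h ∷ ∥ A ∥ ∷ []) (λ h a → 1+ (con 2 :+ 2 :* a) :≡ ñ h :⇒ a :≡ h)
        (trans (cong suc (sym (trans (enc-left L (node B S′) 0 (λ ()) (subst (1 <_) (sym closing≡) (s≤s (s≤s z≤n)))) (enc-open A S 1)))) f1)
      b : ∥ B ∥ ≡ h
      b = linear (h ∷ ∥ B ∥ ∷ []) (λ h b → 1+ (1+ (1+ ñ h) :+ 2 :* b) :≡ 2 :* ñ h :⇒ b :≡ h)
        (trans (cong suc (sym (trans (enc-right L (node B S′) 0 (≤-reflexive (cong suc closing≡)))
          (trans (cong (λ o → enc (node B S′) (suc o) (suc n)) closing≡) (enc-open B S′ (suc n)))))) f1+n)
      s : ∥ S ∥ ≡ 0
      s = linear (h ∷ ∥ A ∥ ∷ ∥ S ∥ ∷ []) (λ h a s → a :≡ h :⇒ 1+ 2 :* (1+ (a :+ s)) :≡ ñ h :⇒ s :≡ con 0) a closing≡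
      s′ : ∥ S′ ∥ ≡ 0
      s′ = linear (h ∷ ∥ A ∥ ∷ ∥ B ∥ ∷ ∥ S ∥ ∷ ∥ S′ ∥ ∷ []) (λ h a b s s′ → a :≡ h :⇒ b :≡ h :⇒
        1+ ((1+ (a :+ s)) :+ 1+ (b :+ s′)) :≡ ñ h :⇒ s′ :≡ con 0) a b size

    odd-family : Family n 2 h
    odd-family = record
      { 0<n = 0<n
      ; Base = OddBase n
      ; Base-cong = λ e (f0 , f1 , f1+n) → trans (sym (e 0)) f0 , trans (cong suc (sym (e 1))) f1 , trans (cong suc (sym (e (suc n)))) f1+n
      ; tree = odd-tree
      ; tree-injective = λ { refl → refl , refl }
      ; tree-size = λ A B a b → linear (h ∷ ∥ A ∥ ∷ ∥ B ∥ ∷ []) (λ h a b → a :≡ h :⇒ b :≡ h :⇒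
          1+ ((1+ (a :+ con 0)) :+ 1+ (b :+ con 0)) :≡ ñ h) a b
      ; tree-base = odd-tree-base
      ; base-tree = odd-base-tree
      ; half-turn = λ {M} → odd-half-turn {M}
      ; rigid = λ {M} ncm base p q → odd-rigid {M} ncm base p q
      ; degree = λ {M} ncm → oddBase⇒Deg {n} {M} ncm (s≤s (s≤s (s≤s z≤n)))
      -- Three neighbours always exist here, so matchings of degree two arise from the diameter case
      -- alone.
      ; short-case = λ {M} ncm s → inj₁ (short-odd {n} {M} ncm (suc h) n≡ (s≤s z≤n) s)
      ; diameter-case = λ {M} ncm → diameter-odd {n} {M} ncm (suc h) n≡ (s≤s z≤n)
      }
      where
      n≡ : n ≡ suc (2 * suc h)
      n≡ = linear (h ∷ []) (λ h → ñ h :≡ 1+ 2 :* (1+ h))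

    open Family odd-family using (Rotated)

    odd-rotated⇒at : ∀ {M} (ncm : IsNCM n M) → Rotated M → ∃[ p ] OddAt {n} {M} ncm p
    odd-rotated⇒at ncm (p , M₀ , p<n , ncm₀ , (f0 , f1 , f1+n) , refl) = p , p<n ,
      trans (rots-val M₀ (<⇒≤ p<N) 0<N n<N f0 (shift-keep p 0 p<N) (shift-keep p n (subst (n + p <_) n+n (+-monoʳ-< n p<n)))) (+-comm n p) ,
      trans (cong suc (rots-val M₀ (<⇒≤ p<N) 1<N (NC.dom R₀ 1<N) refl (shift-keep p 1 (<-≤-trans (s≤s p<n) n<N))
        (shift-keep p (f 1) (linear (p ∷ f 1 ∷ h ∷ []) (λ p y h → 1+ y :≡ ñ h :⇒ p :< ñ h :⇒
          y :+ p :< 2 :* ñ h) f1 p<n)))) (trans (cong (_+ p) f1) (+-comm n p)) ,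
      outer p refl
      where
      R₀ = IsNCM⇒NC {n} {M₀} ncm₀
      f = val M₀
      p<N = <-trans p<n n<N
      to-q : ∀ q → p ≡ suc q → Shift N p (f (suc n)) q
      to-q q refl = shift-wrap p (f (suc n)) (linear (q ∷ f (suc n) ∷ h ∷ []) (λ q y h → 1+ y :≡ 2 :* ñ h :⇒
            q :+ 2 :* ñ h :≡ y :+ (1+ q)) f1+n)
      -- Which ends of the outer edge pass the origin decides between the cases of `OuterEdge`.
      outer : ∀ k → p ≡ k → ∃ (OuterEdge {n} {rots p M₀} ncm p)
      outer zero    refl = suc n , inj₁ (refl , refl , f1+n)
      outer (suc q) refl with m≤n⇒m<n∨m≡n p<n
      ... | inj₁ 1+p<n = q , inj₂ (inj₁ (refl , 1+p<n , trans (NC.adjoint (IsNCM⇒NC {n} {rots p M₀} ncm)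
              (rots-val M₀ (<⇒≤ p<N) 1+n<N (NC.dom R₀ 1+n<N) refl
                (shift-keep p (suc n) (linear (p ∷ h ∷ []) (λ p h → 1+ p :< ñ h :⇒
                  1+ ñ h :+ p :< 2 :* ñ h) 1+p<n))
                (to-q q refl))) (cong suc (+-comm n p))))
      ... | inj₂ 1+p≡n = 0 , inj₂ (inj₂ (refl , 1+p≡n , cong suc
              (rots-val M₀ (<⇒≤ p<N) 1+n<N (NC.dom R₀ 1+n<N) refl
                (shift-wrap p (suc n) (linear (p ∷ h ∷ []) (λ p h → 1+ p :≡ ñ h :⇒
                  2 :* ñ h :≡ 1+ ñ h :+ p) 1+p≡n))
                (to-q q refl))))

    odd-at⇒rotated : ∀ {M p} (ncm : IsNCM n M) → OddAt {n} {M} ncm p → Rotated M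
    odd-at⇒rotated {M} {p} ncm (p<n , fp , f1+p , q , o) =
      p , rots r M , p<n , rots-NCM {n} r {M} ncm ,
      ( rots-val M r≤N p<N p+n<N fp (shift-wrap r p (sym p+r))
          (shift-wrap r (p + n) (linear (p ∷ r ∷ n ∷ []) (λ p r n → p :+ r :≡ 2 :* n :⇒ n :+ 2 :* n :≡ p :+ n :+ r) p+r))
      , cong suc (rots-val M r≤N 1+p<N (NC.dom R 1+p<N) refl (shift-wrap r (suc p) (cong suc (sym p+r)))
          (shift-wrap r (f (suc p)) (linear (p ∷ r ∷ f (suc p) ∷ h ∷ []) (λ p r y h →
            p :+ r :≡ 2 :* ñ h :⇒ 1+ y :≡ p :+ ñ h :⇒
            con 2 :+ 2 :* h :+ 2 :* ñ h :≡ y :+ r) p+r f1+p)))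
      , at-1+n o ) ,
      trans (sym (rots-+ p r M)) (trans (cong (λ k → rots k M) p+r) (rots-cycle M))
      where
      R = IsNCM⇒NC {n} {M} ncm
      f = val M
      p<N = <-trans p<n n<N
      1+p<N : suc p < N
      1+p<N = ≤-<-trans p<n n<N
      p+n<N : p + n < N
      p+n<N = subst (p + n <_) n+n (+-monoˡ-< n p<n)
      r = N ∸ p
      r≤N : r ≤ N
      r≤N = m∸n≤m N p
      p+r : p + r ≡ N
      p+r = m+[n∸m]≡n (<⇒≤ p<N)
      at-1+n : OuterEdge {n} {M} ncm p q → suc (val (rots r M) (suc n)) ≡ N
      at-1+n (inj₁ (p≡0 , refl , fq)) = trans (cong suc (rots-val M r≤N 1+n<N (NC.dom R 1+n<N) refl
        (shift-wrap r (suc n) (cong (suc n +_) (sym r≡N))) (shift-wrap r (f (suc n)) (cong (f (suc n) +_) (sym r≡N))))) fq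
        where
        r≡N : r ≡ N
        r≡N = trans (cong (_+ r) (sym p≡0)) p+r
      at-1+n (inj₂ (inj₁ (refl , 1+p<n , fq))) = trans (cong suc (rots-val M r≤N
        (linear (p ∷ h ∷ []) (λ p h → 1+ p :< ñ h :⇒ 1+ (p :+ ñ h) :< 2 :* ñ h) 1+p<n)
        (<-trans ≤-refl p<N) (NC.adjoint R fq)
        (shift-wrap r (suc (p + n)) (linear (p ∷ r ∷ n ∷ []) (λ p r n → p :+ r :≡ 2 :* n :⇒
          1+ n :+ 2 :* n :≡ 1+ (p :+ n) :+ r) p+r))
        (shift-keep r q (≤-reflexive p+r)))) p+r
      -- Since `p = n - 1`, the rotation is by `r = n + 1` steps and sends the end `0` to `n + 1`
      -- without a wrap.
      at-1+n (inj₂ (inj₂ (refl , 1+p≡n , f0))) = trans (cong (suc ∘ val (rots r M)) (sym r≡))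
        (trans (cong suc (rots-val M r≤N 0<N (NC.dom R 0<N) refl (shift-keep r 0 (subst (_< N) (sym r≡) 1+n<N))
          (shift-keep r (f 0) (≤-reflexive (trans (cong (_+ r) f0) p+r))))) (trans (cong (_+ r) f0) p+r))
        where
        r≡ : r ≡ suc n
        r≡ = linear (p ∷ r ∷ n ∷ []) (λ p r n → 1+ p :≡ n :⇒ p :+ r :≡ 2 :* n :⇒ r :≡ 1+ n) 1+p≡n p+r

    odd-theorem : MinDegree n 2 × HasCard (λ (M : PM n) → IsNCM n M × Deg n M 2) (n * Catalan h ^ 2) ×
                  (∀ (M : PM n) → IsNCM n M → (Deg n M 2 ⇔
                    ((∃[ x ] IsEdgeRep n M x × ThroughCenter n M x × len n M x ≡ suc h) ×
                     (∃[ y ] ∃[ z ] (y ≢ z) × IsEdgeRep n M y × IsEdgeRep n M z × len n M y ≡ h × len n M z ≡ h))))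
    odd-theorem = minDegree , card , λ M ncm → mk⇔
      (λ deg → OddAt⇒shape {n} {M} ncm h refl (proj₂ (odd-rotated⇒at {M} ncm (Deg⇒rotated {M} ncm deg))))
      (λ (c , s) → rotated⇒Deg {M} (odd-at⇒rotated {M} ncm (proj₂ (shape⇒OddAt {n} {M} ncm h refl c s))))
      where open Family odd-family

open Parities

-- Parity of `n`, the value of `μ`, and the final statement

open import Data.Nat using (⌊_/2⌋; ⌈_/2⌉)
open import Data.Nat.DivMod using (m≡m%n+[m/n]*n; m*n/n≡m)

2*h/2≡h : ∀ h → 2 * h / 2 ≡ h
2*h/2≡h h = trans (cong (_/ 2) (*-comm 2 h)) (m*n/n≡m h 2)

μ-even : ∀ h → μ (2 + 2 * h) ≡ h
μ-even h = trans (cong (λ k → ⌈ h + k /2⌉) (+-identityʳ h)) (sym (n≡⌈n+n/2⌉ h))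

μ-odd : ∀ h → μ (3 + 2 * h) ≡ suc h
μ-odd h = cong suc (trans (cong (λ k → ⌊ h + k /2⌋) (+-identityʳ h)) (sym (n≡⌊n+n/2⌋ h)))

halves : ∀ n r → n % 2 ≡ r → n ≡ r + 2 * (n / 2)
halves n r eq = trans (m≡m%n+[m/n]*n n 2) (cong₂ _+_ eq (*-comm (n / 2) 2))

OddCase EvenCase : ℕ → Set
OddCase n =
  MinDegree n 2 ×
  HasCard (λ (M : PM n) → IsNCM n M × Deg n M 2) (n * Catalan ((n ∸ 3) / 2) ^ 2) ×
  (∀ (M : PM n) → IsNCM n M → (Deg n M 2 ⇔ OddShape n M))
EvenCase n =
  MinDegree n 1 ×
  HasCard (λ (M : PM n) → IsNCM n M × Deg n M 1) (n * Catalan ((n ∸ 2) / 2) ^ 2) ×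
  (∀ (M : PM n) → IsNCM n M → (Deg n M 1 ⇔ EvenShape n M))

-- With `n` in the form `3 + 2 * h` the difference `n ∸ 3` reduces to `2 * h`, and only the halving
-- in the Catalan index and the value of `μ` have to be rewritten.
oddCase : ∀ h → OddCase (3 + 2 * h)
oddCase h = let md , c , iff = Odd.odd-theorem h in
  md , subst (λ k → HasCard (λ M → IsNCM n M × Deg n M 2) (n * Catalan k ^ 2)) (sym (2*h/2≡h h)) c ,
  λ M ncm → subst (λ m → Deg n M 2 ⇔
    ((∃[ x ] IsEdgeRep n M x × ThroughCenter n M x × len n M x ≡ m) ×
     (∃[ y ] ∃[ z ] (y ≢ z) × IsEdgeRep n M y × IsEdgeRep n M z × len n M y ≡ m ∸ 1 × len n M z ≡ m ∸ 1)))
    (sym (μ-odd h)) (iff M ncm)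
  where n = 3 + 2 * h

evenCase : ∀ h → EvenCase (2 + 2 * h)
evenCase h = let md , c , iff = Even.even-theorem h in
  md , subst (λ k → HasCard (λ M → IsNCM n M × Deg n M 1) (n * Catalan k ^ 2)) (sym (2*h/2≡h h)) c ,
  λ M ncm → subst (λ m → Deg n M 1 ⇔ numEdgesOfLength n M m ≡ 2) (sym (μ-even h)) (iff M ncm)
  where n = 2 + 2 * h

theorem5 : ((n : ℕ) → 3 ≤ n → n % 2 ≡ 1 →
    MinDegree n 2 ×
    HasCard (λ (M : PM n) → IsNCM n M × Deg n M 2) (n * Catalan ((n ∸ 3) / 2) ^ 2) ×
    (∀ (M : PM n) → IsNCM n M → (Deg n M 2 ⇔ OddShape n M)))
    ×
    ((n : ℕ) → 2 ≤ n → n % 2 ≡ 0 →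
    MinDegree n 1 ×
    HasCard (λ (M : PM n) → IsNCM n M × Deg n M 1) (n * Catalan ((n ∸ 2) / 2) ^ 2) ×
    (∀ (M : PM n) → IsNCM n M → (Deg n M 1 ⇔ EvenShape n M)))
theorem5 = (λ n 3≤n r → from-odd n (n / 2) 3≤n (halves n 1 r)) , (λ n 2≤n r → from-even n (n / 2) 2≤n (halves n 0 r))
  where
  from-odd : ∀ n k → 3 ≤ n → n ≡ 1 + 2 * k → OddCase n
  from-odd n zero    3≤n eq = ⊥-elim (<⇒≱ 3≤n (≤-trans (≤-reflexive eq) (s≤s z≤n)))
  from-odd n (suc h) _   eq = subst OddCase (sym (trans eq (cong suc (*-suc 2 h)))) (oddCase h)
  from-even : ∀ n k → 2 ≤ n → n ≡ 2 * k → EvenCase n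
  from-even n zero    2≤n eq = ⊥-elim (<⇒≱ 2≤n (≤-trans (≤-reflexive eq) z≤n))
  from-even n (suc h) _   eq = subst EvenCase (sym (trans eq (*-suc 2 h))) (evenCase h)
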